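{- There exists an integer $d_0>0$ such that for every fixed integer $d\geq d_0$, if $G$ is the uniformly random $d$-regular graph on the vertex set $[n]$ (with $dn$ even), then with probability tending to $1$ as $n\to\infty$, Maker has a winning strategy in the Maker-Breaker Hamiltonicity game played on the edges of $G$.
   Context: The Maker-Breaker Hamiltonicity game on a graph $G$: two players, Maker and Breaker, alternately claim one previously unclaimed edge of $G$ per turn, Breaker moving first, until all edges are claimed. Maker wins if the graph formed by Maker's edges (on the vertex set of $G$) contains a Hamilton cycle; otherwise Breaker wins. Maker has a winning strategy if Maker can guarantee a win against every strategy of Breaker. -}

module Defs where

open import Data.Nat using (ℕ; zero; suc; _≤_; _<ᵇ_; _≡ᵇ_)
open import Data.Bool using (Bool; true; false; T; _∨_; if_then_else_)
open import Data.Fin using (Fin; toℕ)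
import Data.Fin as F
open import Data.Product using (_×_; _,_; Σ; ∃; ∃-syntax)
open import Data.Sum using (_⊎_)
open import Data.Unit using (⊤)
open import Data.List using (List; []; _∷_; _++_; [_]; length; concatMap; map; allFin)
open import Data.List.Relation.Unary.Any using (_─_)
open import Data.List.Membership.Propositional using (_∈_)
open import Data.List.Relation.Binary.Permutation.Propositional using (_↭_)
open import Data.Vec using (Vec; []; _∷_)
open import Relation.Nullary.Decidable using (⌊_⌋)

Edge : ℕ → Set
Edge n = Fin n × Fin n

boolFilter : ∀ {A : Set} → (A → Bool) → List A → List A
boolFilter p []       = []
boolFilter p (x ∷ xs) = if p x then x ∷ boolFilter p xs else boolFilter p xs

completeEdges : (n : ℕ) → List (Edge n)
completeEdges n =
  concatMap (λ i → map (λ j → (i , j)) (boolFilter (λ j → toℕ i <ᵇ toℕ j) (allFin n)))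
            (allFin n)

-- A (simple, labelled) graph on [n] is a subset of the edges of K_n,
-- encoded as its characteristic vector.
record Graph (n : ℕ) : Set where
  constructor graph
  field bits : Vec Bool (length (completeEdges n))

select : ∀ {A : Set} {m} → List A → Vec Bool m → List A
select []       _             = []
select (x ∷ xs) []            = []
select (x ∷ xs) (true  ∷ bs)  = x ∷ select xs bs
select (x ∷ xs) (false ∷ bs)  = select xs bs

edges : ∀ {n} → Graph n → List (Edge n)
edges {n} g = select (completeEdges n) (Graph.bits g)

allVecs : (m : ℕ) → List (Vec Bool m)
allVecs zero    = [] ∷ []
allVecs (suc m) = map (true ∷_) (allVecs m) ++ map (false ∷_) (allVecs m)

allGraphs : (n : ℕ) → List (Graph n)
allGraphs n = map graph (allVecs (length (completeEdges n)))

incident : ∀ {n} → Fin n → Edge n → Bool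
incident v (a , b) = ⌊ a F.≟ v ⌋ ∨ ⌊ b F.≟ v ⌋

degree : ∀ {n} → Graph n → Fin n → ℕ
degree {n} g v = length (boolFilter (incident v) (edges {n} g))

allB : ∀ {A : Set} → (A → Bool) → List A → Bool
allB p []       = true
allB p (x ∷ xs) = if p x then allB p xs else false

isRegular : ∀ {n} → ℕ → Graph n → Bool
isRegular {n} d g = allB (λ v → degree {n} g v ≡ᵇ d) (allFin n)

-- Number of d-regular graphs on [n] (size of the uniform probability space).
numRegular : ℕ → ℕ → ℕ
numRegular n d = length (boolFilter (isRegular d) (allGraphs n))

Adj : ∀ {n} → List (Edge n) → Fin n → Fin n → Set
Adj es u v = ((u , v) ∈ es) ⊎ ((v , u) ∈ es)

Walk : ∀ {n} → List (Edge n) → List (Fin n) → Set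
Walk es []            = ⊤
Walk es (x ∷ [])      = ⊤
Walk es (x ∷ y ∷ r)   = Adj es x y × Walk es (y ∷ r)

HasHamCycle : (n : ℕ) → List (Edge n) → Set
HasHamCycle n es =
  3 ≤ n × Σ (Fin n) λ x → Σ (List (Fin n)) λ xs →
    ((x ∷ xs) ↭ allFin n) × Walk es (x ∷ xs ++ [ x ])

-- Maker-Breaker Hamiltonicity game. A position is Maker's current edge list
-- `mk` and the list `rem` of still unclaimed edges of G.
-- MakerWinsB mk rem : Breaker is to move and Maker has a winning strategy.
-- MakerWinsM mk rem : Maker is to move and Maker has a winning strategy.
-- The game ends when all edges are claimed; Maker wins iff his graph
-- contains a Hamilton cycle.
mutual
  data MakerWinsB {n : ℕ} (mk : List (Edge n)) : List (Edge n) → Set where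
    endB  : HasHamCycle n mk → MakerWinsB mk []
    moveB : ∀ {e rem} →
            (∀ {f} (p : f ∈ (e ∷ rem)) → MakerWinsM mk ((e ∷ rem) ─ p)) →
            MakerWinsB mk (e ∷ rem)

  data MakerWinsM {n : ℕ} (mk : List (Edge n)) : List (Edge n) → Set where
    endM  : HasHamCycle n mk → MakerWinsM mk []
    moveM : ∀ {f rem} (p : f ∈ rem) →
            MakerWinsB (f ∷ mk) (rem ─ p) →
            MakerWinsM mk rem

MakerWinsHam : ∀ {n} → Graph n → Set
MakerWinsHam {n} g = MakerWinsB [] (edges {n} g)

{-# OPTIONS --safe #-}
-- In the uniform d-regular graph G, switchings (replace edges xy, zw by xz, yw) bound both the
-- probability of containing prescribed edges and the lower tail of |E(G) ∩ B| for a dense set B of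
-- pairs. Orienting G in a balanced way gives every vertex about d/2 edges of its own. If each vertex
-- picks four random pairs of its own edges, then by a union bound any choice of one edge from each
-- pair almost surely expands all sets up to a fixed proportion of n. Maker keeps one edge of each pair
-- by answering inside the pairs; elsewhere he follows the Erdős–Selfridge potential to take an edge
-- from the boosters of every subgraph of G with at most 9n edges. The lower tail gives each of them so
-- many boosters in G that, for d large, the number of these subgraphs is negligible in comparison.
-- Now take a path P of Maker's graph that cannot be lengthened. The chosen edges together with P form
-- such a subgraph, and by Pósa rotations quadratically many pairs of vertices close a path on |P|
-- vertices to a cycle. Maker owns one of them, and the cycle spans because an edge of Maker leaving it
-- would give a longer path.
module Submission where

open import Defs
open import Data.Nat using (ℕ; zero; suc; _+_; _*_; _∸_; _^_; _≤_; _<_; z≤n; s≤s; _<ᵇ_; _≤ᵇ_; _≡ᵇ_; NonZero; nonZero; >-nonZero)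
open import Data.Nat.Properties hiding (_≟_)
open import Data.Nat.DivMod using (_/_; _%_; m≡m%n+[m/n]*n; m%n<n)
open import Data.Nat.Divisibility using (_∣_)
open import Data.Nat.Tactic.RingSolver using (solve-∀)
open import Algebra.Properties.CommutativeSemigroup *-commutativeSemigroup using (x∙yz≈y∙xz; xy∙z≈y∙xz; xy∙z≈xz∙y)
open import Data.Bool using (Bool; true; false; T; _∧_; _∨_; not; if_then_else_)
open import Data.Bool.Properties using (∧-identityʳ; ∧-zeroʳ)
open import Data.Empty using (⊥; ⊥-elim)
open import Data.Unit using (tt)
open import Data.Product using (_×_; _,_; Σ; ∃-syntax; proj₁; proj₂; swap)
open import Data.Product.Properties using (≡-dec)
open import Data.Sum using (_⊎_; inj₁; inj₂)
open import Data.Fin using (Fin; toℕ) renaming (zero to fz; suc to fs)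
import Data.Fin as F
import Data.Fin.Properties as FP
open import Data.Vec using (Vec; []; _∷_)
import Data.Vec as V
import Data.Vec.Properties as VP
open import Data.List using (List; []; _∷_; _++_; [_]; length; concatMap; map; allFin; tabulate; lookup; upTo; downFrom; _ʳ++_)
open import Data.List.Properties using (length-map; length-++; length-tabulate; length-upTo)
import Data.List.Properties as LP
open import Data.List.Membership.Propositional using (_∈_; _∉_)
open import Data.List.Membership.Propositional.Properties using (∈-++⁺ˡ; ∈-++⁺ʳ; ∈-++⁻; ∈-map⁺; ∈-map⁻; ∈-allFin; ∈-concat⁺′; ∈-concat⁻′; ∈-lookup; ∈-upTo⁺; ∈-downFrom⁺; ∈-∃++)
open import Data.List.Relation.Unary.Any using (here; there; _─_)
open import Data.List.Relation.Unary.All using (All; []; _∷_)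
import Data.List.Relation.Unary.All as All
import Data.List.Relation.Unary.All.Properties as AllP
open import Data.List.Relation.Unary.AllPairs using ([]; _∷_)
import Data.List.Relation.Unary.AllPairs as AP
import Data.List.Relation.Unary.AllPairs.Properties as APP
open import Data.List.Relation.Unary.Unique.Propositional using (Unique)
import Data.List.Relation.Unary.Unique.Propositional.Properties as Unq
open import Data.List.Relation.Binary.Permutation.Propositional using (_↭_; ↭-refl; ↭-trans; ↭-sym)
import Data.List.Relation.Binary.Permutation.Propositional as Perm
open import Data.List.Relation.Binary.Permutation.Propositional.Properties using (∈-resp-↭; All-resp-↭; ↭-length; ++↭ʳ++; shift; ++-comm)
open import Relation.Nullary using (¬_; Dec; yes; no)
open import Relation.Nullary.Decidable using (⌊_⌋; decidable-stable)
open import Relation.Binary.Definitions using (DecidableEquality; tri<; tri≈; tri>)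
open import Relation.Binary.PropositionalEquality using (_≡_; _≢_; refl; sym; trans; cong; cong₂; subst; subst₂; module ≡-Reasoning)
open import Function using (_∘_; id; _$_)

-- Booleans and indicator sums

-- Probabilities are quotients of numbers of graphs, so every estimate is an inequality of naturals
-- with its denominators cleared. The orientation is an arbitrary function of the graph, hence no
-- fixed position in it can be treated as a random edge. A random pick among `b` (about d/16) owned
-- edges removes this dependence: the chance to point into U is governed by the number of edges from
-- S to U, and the factor d in the cost of a prescribed edge cancels against `b`. Therefore the
-- expansion constant `D` does not depend on d. Everything later rests on this: boosters have
-- density at least 1/D², a lower tail 2^(-t) with t of order nd/D² follows, while G has at most
-- q^(9n) (1 + 1/q)^(nd/2) subgraphs with 9n edges, and q can be a large multiple of D². Four pairs
-- per vertex are taken because a set S of size s puts 4s conditions on its pairs, against about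
-- (n/s)^(3s) candidates for a set U of size 3s around it. The path to be closed is unknown during
-- the game; hence boosters of all sparse subgraphs of G have to be hit, and since the boosters
-- depend on the subgraph, the lower tail is proved relative to the graphs that contain it.

𝟙 : Bool → ℕ
𝟙 true  = 1
𝟙 false = 0

t≢f : ∀ {b} → b ≡ true → b ≡ false → ⊥
t≢f refl ()

bool? : ∀ b → b ≡ true ⊎ b ≡ false
bool? true  = inj₁ refl
bool? false = inj₂ refl

¬t⇒f : ∀ {b} → ¬ (b ≡ true) → b ≡ false
¬t⇒f {true}  h = ⊥-elim (h refl)
¬t⇒f {false} h = refl

∧-t⁻ : ∀ {a b} → a ∧ b ≡ true → a ≡ true × b ≡ true
∧-t⁻ {true} {true} _ = refl , refl

∧-t⁺ : ∀ {a b} → a ≡ true → b ≡ true → a ∧ b ≡ true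
∧-t⁺ refl refl = refl

∨-t⁻ : ∀ {a b} → a ∨ b ≡ true → a ≡ true ⊎ b ≡ true
∨-t⁻ {true}  _ = inj₁ refl
∨-t⁻ {false} p = inj₂ p

∨-t⁺ˡ : ∀ {a b} → a ≡ true → a ∨ b ≡ true
∨-t⁺ˡ refl = refl

∨-t⁺ʳ : ∀ {a b} → b ≡ true → a ∨ b ≡ true
∨-t⁺ʳ {true}  _ = refl
∨-t⁺ʳ {false} p = p

not-t⁻ : ∀ {a} → not a ≡ true → a ≡ false
not-t⁻ {false} _ = refl

not-t⁺ : ∀ {a} → a ≡ false → not a ≡ true
not-t⁺ refl = refl

not-f⁻ : ∀ {a} → not a ≡ false → a ≡ true
not-f⁻ {true} _ = refl

T⇒t : ∀ {b} → T b → b ≡ true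
T⇒t {true} _ = refl

t⇒T : ∀ {b} → b ≡ true → T b
t⇒T refl = tt

𝟙≤1 : ∀ b → 𝟙 b ≤ 1
𝟙≤1 true  = ≤-refl
𝟙≤1 false = z≤n

𝟙-∧ : ∀ a b → 𝟙 (a ∧ b) ≡ 𝟙 a * 𝟙 b
𝟙-∧ true  b = sym (+-identityʳ _)
𝟙-∧ false b = refl

𝟙-not : ∀ a → 𝟙 a + 𝟙 (not a) ≡ 1
𝟙-not true  = refl
𝟙-not false = refl

𝟙-mono : ∀ {a b} → (a ≡ true → b ≡ true) → 𝟙 a ≤ 𝟙 b
𝟙-mono {true}  h rewrite h refl = ≤-refl
𝟙-mono {false} h = z≤n

𝟙-bound : ∀ {a m} → (a ≡ true → 1 ≤ m) → 𝟙 a ≤ m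
𝟙-bound {true}  h = h refl
𝟙-bound {false} h = z≤n

𝟙-*≤ : ∀ {a x y} → (a ≡ true → x ≤ y) → 𝟙 a * x ≤ 𝟙 a * y
𝟙-*≤ {true}  h = *-monoʳ-≤ 1 (h refl)
𝟙-*≤ {false} h = z≤n

⌊⌋-t⁻ : ∀ {p} {P : Set p} {d : Dec P} → ⌊ d ⌋ ≡ true → P
⌊⌋-t⁻ {d = yes p} _ = p

⌊⌋-t⁺ : ∀ {p} {P : Set p} {d : Dec P} → P → ⌊ d ⌋ ≡ true
⌊⌋-t⁺ {d = yes p} _ = refl
⌊⌋-t⁺ {d = no ¬p} p = ⊥-elim (¬p p)

⌊⌋-f⁺ : ∀ {p} {P : Set p} {d : Dec P} → ¬ P → ⌊ d ⌋ ≡ false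
⌊⌋-f⁺ {d = yes p} ¬p = ⊥-elim (¬p p)
⌊⌋-f⁺ {d = no _} _ = refl

≤ᵇ-t⁺ : ∀ {m n} → m ≤ n → (m ≤ᵇ n) ≡ true
≤ᵇ-t⁺ p = T⇒t (≤⇒≤ᵇ p)

≤ᵇ-t⁻ : ∀ m n → (m ≤ᵇ n) ≡ true → m ≤ n
≤ᵇ-t⁻ m n p = ≤ᵇ⇒≤ m n (t⇒T p)

<ᵇ-t⁺ : ∀ {m n} → m < n → (m <ᵇ n) ≡ true
<ᵇ-t⁺ p = T⇒t (<⇒<ᵇ p)

<ᵇ-t⁻ : ∀ m n → (m <ᵇ n) ≡ true → m < n
<ᵇ-t⁻ m n p = <ᵇ⇒< m n (t⇒T p)

≡ᵇ-t⁺ : ∀ {m n} → m ≡ n → (m ≡ᵇ n) ≡ true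
≡ᵇ-t⁺ {m} {n} p = T⇒t (≡⇒≡ᵇ m n p)

≡ᵇ-t⁻ : ∀ m n → (m ≡ᵇ n) ≡ true → m ≡ n
≡ᵇ-t⁻ m n p = ≡ᵇ⇒≡ m n (t⇒T p)

-- Finite sums over lists

∑ : {A : Set} → List A → (A → ℕ) → ℕ
∑ []       f = 0
∑ (x ∷ xs) f = f x + ∑ xs f

module _ {A : Set} where

  ∑-cong : ∀ (xs : List A) {f g : A → ℕ} → (∀ x → f x ≡ g x) → ∑ xs f ≡ ∑ xs g
  ∑-cong []       h = refl
  ∑-cong (x ∷ xs) h = cong₂ _+_ (h x) (∑-cong xs h)

  ∑-cong-∈ : ∀ (xs : List A) {f g : A → ℕ} → (∀ x → x ∈ xs → f x ≡ g x) → ∑ xs f ≡ ∑ xs g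
  ∑-cong-∈ []       h = refl
  ∑-cong-∈ (x ∷ xs) h = cong₂ _+_ (h x (here refl)) (∑-cong-∈ xs (λ y p → h y (there p)))

  ∑-mono : ∀ (xs : List A) {f g : A → ℕ} → (∀ x → f x ≤ g x) → ∑ xs f ≤ ∑ xs g
  ∑-mono []       h = z≤n
  ∑-mono (x ∷ xs) h = +-mono-≤ (h x) (∑-mono xs h)

  ∑-mono-∈ : ∀ (xs : List A) {f g : A → ℕ} → (∀ x → x ∈ xs → f x ≤ g x) → ∑ xs f ≤ ∑ xs g
  ∑-mono-∈ []       h = z≤n
  ∑-mono-∈ (x ∷ xs) h = +-mono-≤ (h x (here refl)) (∑-mono-∈ xs (λ y p → h y (there p)))

  ∑-zero : ∀ (xs : List A) → ∑ xs (λ _ → 0) ≡ 0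
  ∑-zero []       = refl
  ∑-zero (x ∷ xs) = ∑-zero xs

  ∑-+ : ∀ (xs : List A) (f g : A → ℕ) → ∑ xs (λ x → f x + g x) ≡ ∑ xs f + ∑ xs g
  ∑-+ []       f g = refl
  ∑-+ (x ∷ xs) f g rewrite ∑-+ xs f g = lem (f x) (g x) (∑ xs f) (∑ xs g)
    where
    lem : ∀ a b c d → a + b + (c + d) ≡ a + c + (b + d)
    lem = solve-∀

  ∑-*ˡ : ∀ (xs : List A) c (f : A → ℕ) → ∑ xs (λ x → c * f x) ≡ c * ∑ xs f
  ∑-*ˡ []       c f = sym (*-zeroʳ c)
  ∑-*ˡ (x ∷ xs) c f rewrite ∑-*ˡ xs c f = sym (*-distribˡ-+ c (f x) (∑ xs f))

  ∑-*ʳ : ∀ (xs : List A) (f : A → ℕ) c → ∑ xs (λ x → f x * c) ≡ ∑ xs f * c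
  ∑-*ʳ []       f c = refl
  ∑-*ʳ (x ∷ xs) f c rewrite ∑-*ʳ xs f c = sym (*-distribʳ-+ c (f x) (∑ xs f))

  ∑-const : ∀ (xs : List A) c → ∑ xs (λ _ → c) ≡ length xs * c
  ∑-const []       c = refl
  ∑-const (x ∷ xs) c = cong (c +_) (∑-const xs c)

  ∑-≤const : ∀ (xs : List A) {f : A → ℕ} c → (∀ x → f x ≤ c) → ∑ xs f ≤ length xs * c
  ∑-≤const xs c h = ≤-trans (∑-mono xs h) (≤-reflexive (∑-const xs c))

  ∑-++ : ∀ (xs ys : List A) f → ∑ (xs ++ ys) f ≡ ∑ xs f + ∑ ys f
  ∑-++ []       ys f = refl
  ∑-++ (x ∷ xs) ys f rewrite ∑-++ xs ys f = sym (+-assoc (f x) _ _)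

  ∑-boolFilter : ∀ (p : A → Bool) xs f → ∑ (boolFilter p xs) f ≡ ∑ xs (λ x → 𝟙 (p x) * f x)
  ∑-boolFilter p []       f = refl
  ∑-boolFilter p (x ∷ xs) f with p x
  ... | true  = cong₂ _+_ (sym (+-identityʳ (f x))) (∑-boolFilter p xs f)
  ... | false = ∑-boolFilter p xs f

  length-boolFilter : ∀ (p : A → Bool) xs → length (boolFilter p xs) ≡ ∑ xs (λ x → 𝟙 (p x))
  length-boolFilter p []       = refl
  length-boolFilter p (x ∷ xs) with p x
  ... | true  = cong suc (length-boolFilter p xs)
  ... | false = length-boolFilter p xs

  ∈-boolFilter⁻ : ∀ (p : A → Bool) xs {x} → x ∈ boolFilter p xs → x ∈ xs × p x ≡ true
  ∈-boolFilter⁻ p (y ∷ xs) q with p y in eq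
  ∈-boolFilter⁻ p (y ∷ xs) (here refl) | true = here refl , eq
  ∈-boolFilter⁻ p (y ∷ xs) (there q)   | true  = let a , b = ∈-boolFilter⁻ p xs q in there a , b
  ∈-boolFilter⁻ p (y ∷ xs) q           | false = let a , b = ∈-boolFilter⁻ p xs q in there a , b

  ∈-boolFilter⁺ : ∀ (p : A → Bool) xs {x} → x ∈ xs → p x ≡ true → x ∈ boolFilter p xs
  ∈-boolFilter⁺ p (y ∷ xs) (here refl) e rewrite e = here refl
  ∈-boolFilter⁺ p (y ∷ xs) (there q)   e with p y
  ... | true  = there (∈-boolFilter⁺ p xs q e)
  ... | false = ∈-boolFilter⁺ p xs q e

  boolFilter-All : ∀ {P : A → Set} (p : A → Bool) xs → All P xs → All P (boolFilter p xs)
  boolFilter-All p []       []       = []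
  boolFilter-All p (x ∷ xs) (q ∷ qs) with p x
  ... | true  = q ∷ boolFilter-All p xs qs
  ... | false = boolFilter-All p xs qs

  boolFilter-Unique : ∀ (p : A → Bool) xs → Unique xs → Unique (boolFilter p xs)
  boolFilter-Unique p []       []       = []
  boolFilter-Unique p (x ∷ xs) (q ∷ qs) with p x
  ... | true  = boolFilter-All p xs q ∷ boolFilter-Unique p xs qs
  ... | false = boolFilter-Unique p xs qs

  ∈⇒≤∑ : ∀ {xs : List A} {x} (f : A → ℕ) → x ∈ xs → f x ≤ ∑ xs f
  ∈⇒≤∑ f (here refl) = m≤m+n _ _
  ∈⇒≤∑ f (there p)   = ≤-trans (∈⇒≤∑ f p) (m≤n+m _ _)

  ∑-mono-⊆ : ∀ (xs : List A) {p q : A → Bool} → (∀ x → p x ≡ true → q x ≡ true) →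
             ∑ xs (λ x → 𝟙 (p x)) ≤ ∑ xs (λ x → 𝟙 (q x))
  ∑-mono-⊆ xs h = ∑-mono xs (λ x → 𝟙-mono (h x))

  ∑>0⇒∃ : ∀ (xs : List A) (p : A → Bool) → 0 < ∑ xs (λ x → 𝟙 (p x)) → ∃[ x ] (x ∈ xs × p x ≡ true)
  ∑>0⇒∃ (x ∷ xs) p h with p x in eq
  ... | true  = x , here refl , eq
  ... | false = let y , m , q = ∑>0⇒∃ xs p h in y , there m , q

  allB-t⁻ : ∀ (p : A → Bool) xs → allB p xs ≡ true → ∀ {x} → x ∈ xs → p x ≡ true
  allB-t⁻ p (y ∷ xs) e q with p y in eq
  allB-t⁻ p (y ∷ xs) e (here refl) | true = eq
  allB-t⁻ p (y ∷ xs) e (there q)   | true = allB-t⁻ p xs e q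

  allB-t⁺ : ∀ (p : A → Bool) xs → (∀ {x} → x ∈ xs → p x ≡ true) → allB p xs ≡ true
  allB-t⁺ p []       h = refl
  allB-t⁺ p (y ∷ xs) h rewrite h (here refl) = allB-t⁺ p xs (λ q → h (there q))

  allB-f⁻ : ∀ (p : A → Bool) xs → allB p xs ≡ false → ∃[ x ] (x ∈ xs × p x ≡ false)
  allB-f⁻ p (y ∷ xs) e with p y in eq
  ... | true  = let z , m , q = allB-f⁻ p xs e in z , there m , q
  ... | false = y , here refl , eq

  allB-cong : ∀ {p q : A → Bool} xs → (∀ x → p x ≡ q x) → allB p xs ≡ allB q xs
  allB-cong []       h = refl
  allB-cong {q = q} (x ∷ xs) h rewrite h x with q x
  ... | true  = allB-cong xs h
  ... | false = refl

  anyB : (A → Bool) → List A → Bool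
  anyB p xs = not (allB (λ x → not (p x)) xs)

  anyB-t⁻ : ∀ (p : A → Bool) xs → anyB p xs ≡ true → ∃[ x ] (x ∈ xs × p x ≡ true)
  anyB-t⁻ p xs e with allB (λ x → not (p x)) xs in eq
  anyB-t⁻ p xs e | false with allB-f⁻ (λ x → not (p x)) xs eq
  ... | x , m , q with p x in eq'
  ... | true = x , m , eq'

  anyB-t⁺ : ∀ (p : A → Bool) {xs x} → x ∈ xs → p x ≡ true → anyB p xs ≡ true
  anyB-t⁺ p {xs} m q with allB (λ x → not (p x)) xs in eq
  ... | false = refl
  ... | true  = ⊥-elim (t≢f q (not-t⁻ (allB-t⁻ _ xs eq m)))

  anyB≤∑ : ∀ (p : A → Bool) xs → 𝟙 (anyB p xs) ≤ ∑ xs (λ x → 𝟙 (p x))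
  anyB≤∑ p xs = 𝟙-bound λ e → let x , m , q = anyB-t⁻ p xs e in
    ≤-trans (≤-reflexive (cong 𝟙 (sym q))) (∈⇒≤∑ (λ x → 𝟙 (p x)) m)

∑-map : ∀ {A B : Set} (h : A → B) xs f → ∑ (map h xs) f ≡ ∑ xs (λ x → f (h x))
∑-map h []       f = refl
∑-map h (x ∷ xs) f = cong (f (h x) +_) (∑-map h xs f)

∑-concatMap : ∀ {A B : Set} (h : A → List B) xs f → ∑ (concatMap h xs) f ≡ ∑ xs (λ x → ∑ (h x) f)
∑-concatMap h []       f = refl
∑-concatMap h (x ∷ xs) f = trans (∑-++ (h x) _ f) (cong (∑ (h x) f +_) (∑-concatMap h xs f))

∑-swap : ∀ {A B : Set} (xs : List A) (ys : List B) (f : A → B → ℕ) →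
         ∑ xs (λ x → ∑ ys (λ y → f x y)) ≡ ∑ ys (λ y → ∑ xs (λ x → f x y))
∑-swap []       ys f = sym (∑-zero ys)
∑-swap (x ∷ xs) ys f rewrite ∑-swap xs ys f = sym (∑-+ ys (f x) (λ y → ∑ xs (λ x → f x y)))

module Delta {A : Set} (_≟_ : DecidableEquality A) where

  infix 4 _≈ᵇ_
  _≈ᵇ_ : A → A → Bool
  x ≈ᵇ y = ⌊ x ≟ y ⌋

  ∑-δ-∉ : ∀ (xs : List A) (f : A → ℕ) x → x ∉ xs → ∑ xs (λ y → 𝟙 (x ≈ᵇ y) * f y) ≡ 0
  ∑-δ-∉ []       f x h = refl
  ∑-δ-∉ (y ∷ xs) f x h with x ≟ y
  ... | yes refl = ⊥-elim (h (here refl))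
  ... | no  _    = ∑-δ-∉ xs f x (λ p → h (there p))

  ∑-δ : ∀ {xs : List A} (f : A → ℕ) {x} → Unique xs → x ∈ xs → ∑ xs (λ y → 𝟙 (x ≈ᵇ y) * f y) ≡ f x
  ∑-δ {y ∷ xs} f {x} (u ∷ us) p with x ≟ y
  ∑-δ {y ∷ xs} f {x} (u ∷ us) p | yes refl =
    trans (cong₂ _+_ (+-identityʳ (f x)) (∑-δ-∉ xs f x (λ q → All.lookup u q refl))) (+-identityʳ (f x))
  ∑-δ {y ∷ xs} f {x} (u ∷ us) (here refl) | no ¬p = ⊥-elim (¬p refl)
  ∑-δ {y ∷ xs} f {x} (u ∷ us) (there p)   | no ¬p = ∑-δ f us p

  ∑-δ≤ : ∀ {xs : List A} (f : A → ℕ) x → Unique xs → ∑ xs (λ y → 𝟙 (x ≈ᵇ y) * f y) ≤ f x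
  ∑-δ≤ {[]} f x us = z≤n
  ∑-δ≤ {y ∷ xs} f x (u ∷ us) with x ≟ y
  ... | yes refl = ≤-reflexive
    (trans (cong₂ _+_ (+-identityʳ (f x)) (∑-δ-∉ xs f x (λ q → All.lookup u q refl))) (+-identityʳ (f x)))
  ... | no ¬p = ∑-δ≤ f x us

  _∈ᵇ_ : A → List A → Bool
  x ∈ᵇ xs = anyB (λ y → y ≈ᵇ x) xs

  ∈ᵇ-t⁻ : ∀ {x xs} → x ∈ᵇ xs ≡ true → x ∈ xs
  ∈ᵇ-t⁻ {x} {xs} e with anyB-t⁻ (λ y → y ≈ᵇ x) xs e
  ... | y , m , q with y ≟ x
  ... | yes refl = m

  ∈ᵇ-t⁺ : ∀ {x xs} → x ∈ xs → x ∈ᵇ xs ≡ true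
  ∈ᵇ-t⁺ {x} m = anyB-t⁺ (λ y → y ≈ᵇ x) m (⌊⌋-t⁺ {d = x ≟ x} refl)

  ∑-∈ᵇ≤ : ∀ {xs} (ys : List A) → Unique xs → ∑ xs (λ x → 𝟙 (x ∈ᵇ ys)) ≤ length ys
  ∑-∈ᵇ≤ {xs} ys u = begin
    ∑ xs (λ x → 𝟙 (x ∈ᵇ ys))              ≤⟨ ∑-mono xs (λ x → anyB≤∑ (λ y → y ≈ᵇ x) ys) ⟩
    ∑ xs (λ x → ∑ ys (λ y → 𝟙 (y ≈ᵇ x)))   ≡⟨ ∑-swap xs ys _ ⟩
    ∑ ys (λ y → ∑ xs (λ x → 𝟙 (y ≈ᵇ x)))   ≤⟨ ∑-≤const ys 1 (λ y → ≤-trans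
       (≤-reflexive (∑-cong xs (λ x → sym (*-identityʳ _)))) (∑-δ≤ (λ _ → 1) y u)) ⟩
    length ys * 1                          ≡⟨ *-identityʳ _ ⟩
    length ys ∎
    where open ≤-Reasoning

module _ {n : ℕ} where
  open Delta (F._≟_ {n}) public using () renaming (_≈ᵇ_ to _==_; _∈ᵇ_ to _∈F_; ∈ᵇ-t⁻ to ∈F-t⁻; ∈ᵇ-t⁺ to ∈F-t⁺)

allFin-Unique : ∀ n → Unique (allFin n)
allFin-Unique = Unq.allFin⁺

length-allFin : ∀ n → length (allFin n) ≡ n
length-allFin n = length-tabulate {n = n} id

∑F : ∀ {n} → (Fin n → ℕ) → ℕ
∑F {n} f = ∑ (allFin n) f

∑F-δ : ∀ {n} (f : Fin n → ℕ) i → ∑F (λ j → 𝟙 (i == j) * f j) ≡ f i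
∑F-δ {n} f i = Delta.∑-δ F._≟_ f (allFin-Unique n) (∈-allFin i)

∑F-const : ∀ {n} c → ∑F {n} (λ _ → c) ≡ n * c
∑F-const {n} c = trans (∑-const (allFin n) c) (cong (_* c) (length-allFin n))

==-refl : ∀ {n} (i : Fin n) → (i == i) ≡ true
==-refl i = ⌊⌋-t⁺ {d = i F.≟ i} refl

==-t⁻ : ∀ {n} {i j : Fin n} → (i == j) ≡ true → i ≡ j
==-t⁻ {i = i} {j} e = ⌊⌋-t⁻ {d = i F.≟ j} e

==-f⁺ : ∀ {n} {i j : Fin n} → i ≢ j → (i == j) ≡ false
==-f⁺ {i = i} {j} h = ⌊⌋-f⁺ {d = i F.≟ j} h

==-f⁻ : ∀ {n} {i j : Fin n} → (i == j) ≡ false → i ≢ j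
==-f⁻ {i = i} e refl = t≢f (==-refl i) e

==-sym : ∀ {n} (i j : Fin n) → (i == j) ≡ (j == i)
==-sym i j with i F.≟ j
... | yes refl = sym (==-refl i)
... | no  h    = sym (==-f⁺ (λ e → h (sym e)))

-- Bit vectors indexed by a list of items

module Bits {A : Set} (_≟_ : DecidableEquality A) where

  look : (E : List A) → Vec Bool (length E) → A → Bool
  look []      _        e = false
  look (x ∷ E) (b ∷ bs) e = if ⌊ x ≟ e ⌋ then b else look E bs e

  tog : (E : List A) → Vec Bool (length E) → A → Vec Bool (length E)
  tog []      v        e = v
  tog (x ∷ E) (b ∷ bs) e = if ⌊ x ≟ e ⌋ then not b ∷ bs else b ∷ tog E bs e

  mkV : (E : List A) → (A → Bool) → Vec Bool (length E)
  mkV []      p = []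
  mkV (x ∷ E) p = p x ∷ mkV E p

  look-∉ : ∀ E v e → e ∉ E → look E v e ≡ false
  look-∉ []      v        e h = refl
  look-∉ (x ∷ E) (b ∷ bs) e h with x ≟ e
  ... | yes refl = ⊥-elim (h (here refl))
  ... | no _     = look-∉ E bs e (λ p → h (there p))

  look-tog-same : ∀ E v e → e ∈ E → look E (tog E v e) e ≡ not (look E v e)
  look-tog-same (x ∷ E) (b ∷ bs) e m with x ≟ e in eq
  look-tog-same (x ∷ E) (b ∷ bs) e m | yes _ rewrite eq = refl
  look-tog-same (x ∷ E) (b ∷ bs) e (here refl) | no ¬p = ⊥-elim (¬p refl)
  look-tog-same (x ∷ E) (b ∷ bs) e (there m)   | no ¬p rewrite eq = look-tog-same E bs e m

  look-tog-diff : ∀ E v e e′ → e ≢ e′ → look E (tog E v e) e′ ≡ look E v e′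
  look-tog-diff []      v        e e′ h = refl
  look-tog-diff (x ∷ E) (b ∷ bs) e e′ h with x ≟ e
  look-tog-diff (x ∷ E) (b ∷ bs) e e′ h | yes refl with x ≟ e′
  ... | yes refl = ⊥-elim (h refl)
  ... | no _     = refl
  look-tog-diff (x ∷ E) (b ∷ bs) e e′ h | no _ with x ≟ e′
  ... | yes _ = refl
  ... | no _  = look-tog-diff E bs e e′ h

  -- Flipping a bit permutes the vectors. At the flipped position the half of `allVecs` that starts
  -- with `true` and the half that starts with `false` change places.
  ∑-tog : ∀ E e (f : Vec Bool (length E) → ℕ) →
          ∑ (allVecs (length E)) (λ v → f (tog E v e)) ≡ ∑ (allVecs (length E)) f
  ∑-tog []      e f = refl
  ∑-tog (x ∷ E) e f = begin
    ∑ (map (true ∷_) V ++ map (false ∷_) V) (λ v → f (tog (x ∷ E) v e))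
      ≡⟨ split (λ v → f (tog (x ∷ E) v e)) ⟩
    ∑ V (λ v → f (tog (x ∷ E) (true ∷ v) e)) + ∑ V (λ v → f (tog (x ∷ E) (false ∷ v) e))
      ≡⟨ mid ⟩
    ∑ V (λ v → f (true ∷ v)) + ∑ V (λ v → f (false ∷ v))
      ≡⟨ sym (split f) ⟩
    ∑ (map (true ∷_) V ++ map (false ∷_) V) f ∎
    where
    open ≡-Reasoning
    V = allVecs (length E)
    split : ∀ g → ∑ (map (true ∷_) V ++ map (false ∷_) V) g ≡ ∑ V (λ v → g (true ∷ v)) + ∑ V (λ v → g (false ∷ v))
    split g = trans (∑-++ (map (true ∷_) V) _ g) (cong₂ _+_ (∑-map _ V g) (∑-map _ V g))
    mid : ∑ V (λ v → f (tog (x ∷ E) (true ∷ v) e)) + ∑ V (λ v → f (tog (x ∷ E) (false ∷ v) e))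
        ≡ ∑ V (λ v → f (true ∷ v)) + ∑ V (λ v → f (false ∷ v))
    mid with x ≟ e
    ... | yes _ = +-comm (∑ V (λ v → f (false ∷ v))) _
    ... | no _  = cong₂ _+_ (∑-tog E e (λ v → f (true ∷ v))) (∑-tog E e (λ v → f (false ∷ v)))

  -- Both directions of a flip in one equation without subtraction: the left indicator is 1 when `e`
  -- is removed, the right one when `e` is added.
  select-tog : ∀ E v e (h : A → ℕ) → e ∈ E →
    ∑ (select E (tog E v e)) h + 𝟙 (look E v e) * h e ≡ ∑ (select E v) h + 𝟙 (not (look E v e)) * h e
  select-tog (x ∷ E) (b ∷ bs) e h m with x ≟ e
  select-tog (x ∷ E) (true ∷ bs)  e h m | yes refl = trans (cong (∑ (select E bs) h +_) (+-identityʳ (h x)))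
    (trans (+-comm (∑ (select E bs) h) (h x)) (sym (+-identityʳ _)))
  select-tog (x ∷ E) (false ∷ bs) e h m | yes refl = trans (+-identityʳ _)
    (trans (+-comm (h x) _) (cong (∑ (select E bs) h +_) (sym (+-identityʳ (h x)))))
  select-tog (x ∷ E) (b ∷ bs) e h (here refl) | no ¬p = ⊥-elim (¬p refl)
  select-tog (x ∷ E) (true ∷ bs)  e h (there m) | no ¬p =
    trans (+-assoc (h x) _ _) (trans (cong (h x +_) (select-tog E bs e h m)) (sym (+-assoc (h x) _ _)))
  select-tog (x ∷ E) (false ∷ bs) e h (there m) | no ¬p = select-tog E bs e h m

  look-head : ∀ x E b bs → look (x ∷ E) (b ∷ bs) x ≡ b
  look-head x E b bs with x ≟ x
  ... | yes _ = refl
  ... | no ¬p = ⊥-elim (¬p refl)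

  look-tail : ∀ x E b bs e → x ≢ e → look (x ∷ E) (b ∷ bs) e ≡ look E bs e
  look-tail x E b bs e h with x ≟ e
  ... | yes p = ⊥-elim (h p)
  ... | no _  = refl

  select-look : ∀ E v (h : A → ℕ) → Unique E → ∑ (select E v) h ≡ ∑ E (λ e → 𝟙 (look E v e) * h e)
  select-look []      []       h u = refl
  select-look (x ∷ E) (b ∷ bs) h (u ∷ us)
    rewrite look-head x E b bs
          | ∑-cong-∈ E {λ e → 𝟙 (look (x ∷ E) (b ∷ bs) e) * h e} {λ e → 𝟙 (look E bs e) * h e}
              (λ e m → cong (λ z → 𝟙 z * h e) (look-tail x E b bs e (All.lookup u m)))
          | sym (select-look E bs h us)
    with b
  ... | true  = cong (_+ ∑ (select E bs) h) (sym (+-identityʳ (h x)))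
  ... | false = refl

  ∈-select⁻ : ∀ E (v : Vec Bool (length E)) {e} → Unique E → e ∈ select E v → e ∈ E × look E v e ≡ true
  ∈-select⁻ (x ∷ E) (true ∷ bs)  (u ∷ us) (here refl) = here refl , look-head x E true bs
  ∈-select⁻ (x ∷ E) (true ∷ bs)  (u ∷ us) (there m) =
    let a , b = ∈-select⁻ E bs us m in there a , trans (look-tail x E true bs _ (All.lookup u a)) b
  ∈-select⁻ (x ∷ E) (false ∷ bs) (u ∷ us) m =
    let a , b = ∈-select⁻ E bs us m in there a , trans (look-tail x E false bs _ (All.lookup u a)) b

  ∈-select⁺ : ∀ E (v : Vec Bool (length E)) {e} → look E v e ≡ true → e ∈ select E v
  ∈-select⁺ (x ∷ E) (b ∷ bs) {e} q with x ≟ e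
  ∈-select⁺ (x ∷ E) (true ∷ bs) q | yes refl = here refl
  ∈-select⁺ (x ∷ E) (true ∷ bs)  q | no _ = there (∈-select⁺ E bs q)
  ∈-select⁺ (x ∷ E) (false ∷ bs) q | no _ = ∈-select⁺ E bs q

  look-mkV : ∀ E p e → e ∈ E → look E (mkV E p) e ≡ p e
  look-mkV (x ∷ E) p e m with x ≟ e
  look-mkV (x ∷ E) p e m           | yes refl = refl
  look-mkV (x ∷ E) p e (here refl) | no ¬p = ⊥-elim (¬p refl)
  look-mkV (x ∷ E) p e (there m)   | no ¬p = look-mkV E p e m

-- Inclusion of bit vectors and the number of small subsets

wt : ∀ {m} → Vec Bool m → ℕ
wt []       = 0
wt (b ∷ bs) = 𝟙 b + wt bs

infix 4 _⊆ᵇ_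
_⊆ᵇ_ : ∀ {m} → Vec Bool m → Vec Bool m → Bool
[]       ⊆ᵇ []       = true
(a ∷ as) ⊆ᵇ (b ∷ bs) = (not a ∨ b) ∧ (as ⊆ᵇ bs)

module SubBits {A : Set} (_≟_ : DecidableEquality A) where
  open Bits _≟_

  ⊆ᵇ-look : ∀ E v w e → (v ⊆ᵇ w) ≡ true → look E v e ≡ true → look E w e ≡ true
  ⊆ᵇ-look (x ∷ E) (a ∷ v) (b ∷ w) e s q with ∧-t⁻ {not a ∨ b} s
  ... | s₁ , s₂ with x ≟ e
  ⊆ᵇ-look (x ∷ E) (true ∷ v) (b ∷ w) e s q | s₁ , s₂ | yes _ = s₁
  ... | no _ = ⊆ᵇ-look E v w e s₂ q

  ⊆ᵇ-tog : ∀ E v w e → (v ⊆ᵇ w) ≡ true → look E v e ≡ false → (v ⊆ᵇ tog E w e) ≡ true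
  ⊆ᵇ-tog []      []      []      e s q = refl
  ⊆ᵇ-tog (x ∷ E) (a ∷ v) (b ∷ w) e s q with ∧-t⁻ {not a ∨ b} s
  ... | s₁ , s₂ with x ≟ e
  ⊆ᵇ-tog (x ∷ E) (false ∷ v) (b ∷ w) e s q | s₁ , s₂ | yes _ = s₂
  ... | no _ = ∧-t⁺ s₁ (⊆ᵇ-tog E v w e s₂ q)

  mkV-⊆ᵇ : ∀ E p w → Unique E → (∀ e → e ∈ E → p e ≡ true → look E w e ≡ true) → (mkV E p ⊆ᵇ w) ≡ true
  mkV-⊆ᵇ []      p []      u h = refl
  mkV-⊆ᵇ (x ∷ E) p (b ∷ w) (u ∷ us) h = ∧-t⁺ hd
    (mkV-⊆ᵇ E p w us (λ e m q → trans (sym (look-tail x E b w e (All.lookup u m))) (h e (there m) q)))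
    where
    hd : not (p x) ∨ b ≡ true
    hd with p x in eq
    ... | true  = trans (sym (look-head x E b w)) (h x (here refl) eq)
    ... | false = refl

  wt-mkV : ∀ E p → wt (mkV E p) ≡ ∑ E (λ e → 𝟙 (p e))
  wt-mkV []      p = refl
  wt-mkV (x ∷ E) p = cong (𝟙 (p x) +_) (wt-mkV E p)

  wt-select : ∀ (E : List A) (v : Vec Bool (length E)) → ∑ (select E v) (λ _ → 1) ≡ wt v
  wt-select []      []          = refl
  wt-select (x ∷ E) (true ∷ v)  = cong suc (wt-select E v)
  wt-select (x ∷ E) (false ∷ v) = wt-select E v

∑-allVecs : ∀ {m} (f : Vec Bool (suc m) → ℕ) →
  ∑ (allVecs (suc m)) f ≡ ∑ (allVecs m) (λ v → f (true ∷ v)) + ∑ (allVecs m) (λ v → f (false ∷ v))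
∑-allVecs {m} f = trans (∑-++ (map (true ∷_) (allVecs m)) _ f) (cong₂ _+_ (∑-map _ (allVecs m) f) (∑-map _ (allVecs m) f))

∈-allVecs : ∀ {m} (v : Vec Bool m) → v ∈ allVecs m
∈-allVecs []          = here refl
∈-allVecs (true ∷ v)  = ∈-++⁺ˡ (∈-map⁺ (true ∷_) (∈-allVecs v))
∈-allVecs (false ∷ v) = ∈-++⁺ʳ (map (true ∷_) (allVecs _)) (∈-map⁺ (false ∷_) (∈-allVecs v))

allVecs-Unique : ∀ m → Unique (allVecs m)
allVecs-Unique zero    = [] ∷ []
allVecs-Unique (suc m) = Unq.++⁺ (Unq.map⁺ (λ { refl → refl }) (allVecs-Unique m))
                                 (Unq.map⁺ (λ { refl → refl }) (allVecs-Unique m)) disj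
  where
  disj : ∀ {v} → ¬ (v ∈ map (true ∷_) (allVecs m) × v ∈ map (false ∷_) (allVecs m))
  disj (p , q) with ∈-map⁻ _ p | ∈-map⁻ _ q
  ... | a , _ , refl | b , _ , ()

length-allVecs : ∀ m → length (allVecs m) ≡ 2 ^ m
length-allVecs zero    = refl
length-allVecs (suc m) = trans (length-++ (map (true ∷_) (allVecs m)))
  (cong₂ _+_ (trans (length-map _ (allVecs m)) (length-allVecs m))
             (trans (length-map _ (allVecs m)) (trans (length-allVecs m) (sym (+-identityʳ _)))))

allGraphs-Unique : ∀ n → Unique (allGraphs n)
allGraphs-Unique n = Unq.map⁺ (λ { refl → refl }) (allVecs-Unique _)

∈-allGraphs : ∀ {n} (g : Graph n) → g ∈ allGraphs n
∈-allGraphs (graph v) = ∈-map⁺ graph (∈-allVecs v)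

suc-≤ᵇ : ∀ a b → (suc a ≤ᵇ suc b) ≡ (a ≤ᵇ b)
suc-≤ᵇ zero    b = refl
suc-≤ᵇ (suc a) b = refl

-- Multiplying out (x + y)^|g| and keeping the terms of small subsets; stated without subtraction.
subset-count : ∀ {m} (g : Vec Bool m) w x y → x ≤ y →
  ∑ (allVecs m) (λ v → 𝟙 ((v ⊆ᵇ g) ∧ (wt v ≤ᵇ w))) * (x ^ w * y ^ wt g) ≤ y ^ w * (x + y) ^ wt g
subset-count [] w x y h = begin
  1 * (x ^ w * 1) ≡⟨ lem (x ^ w) ⟩
  x ^ w           ≤⟨ ^-monoˡ-≤ w h ⟩
  y ^ w           ≡⟨ sym (*-identityʳ _) ⟩
  y ^ w * 1 ∎
  where
  open ≤-Reasoning
  lem : ∀ u → 1 * (u * 1) ≡ u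
  lem = solve-∀
subset-count {suc m} (false ∷ g) w x y h
  rewrite ∑-allVecs (λ v → 𝟙 ((v ⊆ᵇ (false ∷ g)) ∧ (wt v ≤ᵇ w))) | ∑-zero (allVecs m) = subset-count g w x y h
subset-count {suc m} (true ∷ g) zero x y h
  rewrite ∑-allVecs (λ v → 𝟙 ((v ⊆ᵇ (true ∷ g)) ∧ (wt v ≤ᵇ 0)))
        | ∑-cong (allVecs m) {λ v → 𝟙 ((v ⊆ᵇ g) ∧ false)} {λ _ → 0} (λ v → cong 𝟙 (∧-zeroʳ (v ⊆ᵇ g)))
        | ∑-zero (allVecs m) = begin
    c * (1 * (y * y ^ wt g))       ≡⟨ lem₁ c y (y ^ wt g) ⟩
    c * (1 * y ^ wt g) * y         ≤⟨ *-monoˡ-≤ y (subset-count g 0 x y h) ⟩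
    1 * (x + y) ^ wt g * y         ≤⟨ *-monoʳ-≤ (1 * (x + y) ^ wt g) (m≤n+m y x) ⟩
    1 * (x + y) ^ wt g * (x + y)   ≡⟨ lem₂ (x + y) ((x + y) ^ wt g) ⟩
    1 * ((x + y) * (x + y) ^ wt g) ∎
  where
  open ≤-Reasoning
  c = ∑ (allVecs m) (λ v → 𝟙 ((v ⊆ᵇ g) ∧ (wt v ≤ᵇ 0)))
  lem₁ : ∀ c y z → c * (1 * (y * z)) ≡ c * (1 * z) * y
  lem₁ = solve-∀
  lem₂ : ∀ u z → 1 * z * u ≡ 1 * (u * z)
  lem₂ = solve-∀
subset-count {suc m} (true ∷ g) (suc w) x y h
  rewrite ∑-allVecs (λ v → 𝟙 ((v ⊆ᵇ (true ∷ g)) ∧ (wt v ≤ᵇ suc w)))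
        | ∑-cong (allVecs m) {λ v → 𝟙 ((v ⊆ᵇ g) ∧ (suc (wt v) ≤ᵇ suc w))} {λ v → 𝟙 ((v ⊆ᵇ g) ∧ (wt v ≤ᵇ w))}
                 (λ v → cong (λ z → 𝟙 ((v ⊆ᵇ g) ∧ z)) (suc-≤ᵇ (wt v) w)) = begin
    (c₁ + c₂) * (x * x ^ w * (y * y ^ W))
      ≡⟨ lem₁ c₁ c₂ x y (x ^ w) (y ^ W) ⟩
    c₁ * (x ^ w * y ^ W) * (x * y) + c₂ * (x * x ^ w * y ^ W) * y
      ≤⟨ +-mono-≤ (*-monoˡ-≤ (x * y) (subset-count g w x y h)) (*-monoˡ-≤ y (subset-count g (suc w) x y h)) ⟩
    y ^ w * (x + y) ^ W * (x * y) + y * y ^ w * (x + y) ^ W * y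
      ≡⟨ lem₂ x y (y ^ w) ((x + y) ^ W) ⟩
    y * y ^ w * ((x + y) * (x + y) ^ W) ∎
  where
  open ≤-Reasoning
  W = wt g
  c₁ = ∑ (allVecs m) (λ v → 𝟙 ((v ⊆ᵇ g) ∧ (wt v ≤ᵇ w)))
  c₂ = ∑ (allVecs m) (λ v → 𝟙 ((v ⊆ᵇ g) ∧ (wt v ≤ᵇ suc w)))
  lem₁ : ∀ c₁ c₂ x y u z → (c₁ + c₂) * (x * u * (y * z)) ≡ c₁ * (u * z) * (x * y) + c₂ * (x * u * z) * y
  lem₁ = solve-∀
  lem₂ : ∀ x y u z → u * z * (x * y) + y * u * z * y ≡ y * u * ((x + y) * z)
  lem₂ = solve-∀

-- Adjacency

_≟E_ : ∀ {n} → DecidableEquality (Edge n)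
_≟E_ = ≡-dec F._≟_ F._≟_

open module BitsE {n} = Bits (_≟E_ {n}) public
open module SubBitsE {n} = SubBits (_≟E_ {n}) public
open module DeltaE {n} = Delta (_≟E_ {n}) public using () renaming (_≈ᵇ_ to _==E_; _∈ᵇ_ to _∈E_; ∈ᵇ-t⁻ to ∈E-t⁻; ∈ᵇ-t⁺ to ∈E-t⁺; ∑-∈ᵇ≤ to ∑-∈E≤)

infix 4 _<F_
_<F_ : ∀ {n} → Fin n → Fin n → Bool
i <F j = toℕ i <ᵇ toℕ j

<F-irrefl : ∀ {n} (i : Fin n) → (i <F i) ≡ false
<F-irrefl i = ¬t⇒f (λ e → <-irrefl refl (<ᵇ-t⁻ (toℕ i) (toℕ i) e))

<F-asym : ∀ {n} {i j : Fin n} → (i <F j) ≡ true → (j <F i) ≡ false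
<F-asym {i = i} {j} e = ¬t⇒f (λ e′ → <-asym (<ᵇ-t⁻ (toℕ i) (toℕ j) e) (<ᵇ-t⁻ (toℕ j) (toℕ i) e′))

<F-conn : ∀ {n} {i j : Fin n} → i ≢ j → (i <F j) ≡ false → (j <F i) ≡ true
<F-conn {i = i} {j} h e with <-cmp (toℕ i) (toℕ j)
... | tri< a _ _ = ⊥-elim (t≢f (<ᵇ-t⁺ a) e)
... | tri≈ _ b _ = ⊥-elim (h (FP.toℕ-injective b))
... | tri> _ _ c = <ᵇ-t⁺ c

∑-complete : ∀ {n} (h : Edge n → ℕ) → ∑ (completeEdges n) h ≡ ∑F (λ i → ∑F (λ j → 𝟙 (i <F j) * h (i , j)))
∑-complete {n} h = trans (∑-concatMap _ (allFin n) h)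
  (∑-cong (allFin n) (λ i → trans (∑-map (i ,_) (boolFilter (i <F_) (allFin n)) h) (∑-boolFilter (i <F_) (allFin n) _)))

∈-complete⁺ : ∀ {n} {i j : Fin n} → (i <F j) ≡ true → (i , j) ∈ completeEdges n
∈-complete⁺ {n} {i} {j} e = ∈-concat⁺′ (∈-map⁺ (i ,_) (∈-boolFilter⁺ (i <F_) (allFin n) (∈-allFin j) e)) (∈-map⁺ _ (∈-allFin i))

∈-complete⁻ : ∀ {n} {i j : Fin n} → (i , j) ∈ completeEdges n → (i <F j) ≡ true
∈-complete⁻ {n} {i} {j} p with ∈-concat⁻′ (map (λ i → map (i ,_) (boolFilter (i <F_) (allFin n))) (allFin n)) p
... | xs , q , r with ∈-map⁻ _ r
... | k , _ , refl with ∈-map⁻ (k ,_) q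
... | l , s , refl = proj₂ (∈-boolFilter⁻ (k <F_) (allFin n) s)

complete-Unique : ∀ n → Unique (completeEdges n)
complete-Unique n = Unq.concat⁺
  (AllP.map⁺ (All.universal (λ i → Unq.map⁺ (λ { refl → refl }) (boolFilter-Unique _ _ (allFin-Unique n))) (allFin n)))
  (APP.map⁺ (AP.map (λ i≢j {e} → λ { (p , q) → i≢j (trans (sym (fst p)) (fst q)) }) (allFin-Unique n)))
  where
  fst : ∀ {i : Fin n} {e ys} → e ∈ map (i ,_) ys → proj₁ e ≡ i
  fst p with ∈-map⁻ _ p
  ... | _ , _ , refl = refl

nrm : ∀ {n} → Fin n → Fin n → Edge n
nrm u v = if u <F v then (u , v) else (v , u)

-- On the diagonal the pair looked up is not in `completeEdges`, where `look` defaults to `false`;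
-- this makes the relation irreflexive.
adj : ∀ {n} → Graph n → Fin n → Fin n → Bool
adj {n} g u v = look (completeEdges n) (Graph.bits g) (nrm u v)

nrm-< : ∀ {n} {u v : Fin n} → (u <F v) ≡ true → nrm u v ≡ (u , v)
nrm-< e rewrite e = refl

nrm-> : ∀ {n} {u v : Fin n} → (v <F u) ≡ true → nrm u v ≡ (v , u)
nrm-> {u = u} {v} e rewrite <F-asym {i = v} {u} e = refl

nrm-sym : ∀ {n} (u v : Fin n) → nrm u v ≡ nrm v u
nrm-sym u v with u F.≟ v
... | yes refl = refl
... | no h with u <F v in eq
... | true  = sym (nrm-> eq)
... | false = sym (nrm-< (<F-conn h eq))

nrm-inj : ∀ {n} {u v x y : Fin n} → nrm u v ≡ nrm x y → (u ≡ x × v ≡ y) ⊎ (u ≡ y × v ≡ x)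
nrm-inj {u = u} {v} {x} {y} e with u <F v | x <F y
nrm-inj refl | true  | true  = inj₁ (refl , refl)
nrm-inj refl | true  | false = inj₂ (refl , refl)
nrm-inj refl | false | true  = inj₂ (refl , refl)
nrm-inj refl | false | false = inj₁ (refl , refl)

nrm-∈ : ∀ {n} {u v : Fin n} → u ≢ v → nrm u v ∈ completeEdges n
nrm-∈ {u = u} {v} h with u <F v in eq
... | true  = ∈-complete⁺ eq
... | false = ∈-complete⁺ (<F-conn h eq)

adj-sym : ∀ {n} (g : Graph n) u v → adj g u v ≡ adj g v u
adj-sym {n} g u v = cong (look (completeEdges n) (Graph.bits g)) (nrm-sym u v)

adj-irr : ∀ {n} (g : Graph n) u → adj g u u ≡ false
adj-irr {n} g u = look-∉ (completeEdges n) (Graph.bits g) _ h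
  where
  h : nrm u u ∉ completeEdges n
  h p with u <F u in eq
  ... | true  = t≢f eq (<F-irrefl u)
  ... | false = t≢f (∈-complete⁻ p) (<F-irrefl u)

adj⇒≢ : ∀ {n} (g : Graph n) {u v} → adj g u v ≡ true → u ≢ v
adj⇒≢ g {u} e refl = t≢f e (adj-irr g u)

adj⇒∈ : ∀ {n} (g : Graph n) {u v} → adj g u v ≡ true → nrm u v ∈ edges g
adj⇒∈ {n} g e = ∈-select⁺ (completeEdges n) (Graph.bits g) e

∈⇒adj : ∀ {n} (g : Graph n) {u v} → (u , v) ∈ edges g → adj g u v ≡ true × (u <F v) ≡ true
∈⇒adj {n} g {u} {v} m with ∈-select⁻ (completeEdges n) (Graph.bits g) (complete-Unique n) m
... | a , b = trans (cong (look (completeEdges n) (Graph.bits g)) (nrm-< (∈-complete⁻ a))) b , ∈-complete⁻ a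

-- An edge is listed once, smaller end first, while the double sum over ordered pairs meets it in
-- both orders.
∑-adj : ∀ {n} (g : Graph n) (f : Fin n → Fin n → ℕ) →
  ∑F (λ x → ∑F (λ z → 𝟙 (adj g x z) * f x z)) ≡ ∑ (edges g) (λ e → f (proj₁ e) (proj₂ e) + f (proj₂ e) (proj₁ e))
∑-adj {n} g f = sym (begin
  ∑ (edges g) h
    ≡⟨ select-look (completeEdges n) (Graph.bits g) h (complete-Unique n) ⟩
  ∑ (completeEdges n) (λ e → 𝟙 (lk e) * h e)
    ≡⟨ ∑-complete {n} (λ e → 𝟙 (lk e) * h e) ⟩
  ∑F (λ i → ∑F (λ j → 𝟙 (i <F j) * (𝟙 (lk (i , j)) * (f i j + f j i))))
    ≡⟨ ∑-cong V (λ i → ∑-cong V (λ j → lem₁ (𝟙 (i <F j)) (𝟙 (lk (i , j))) (f i j) (f j i))) ⟩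
  ∑F (λ i → ∑F (λ j → p i j + q i j))
    ≡⟨ trans (∑-cong V (λ i → ∑-+ V (p i) (q i))) (∑-+ V _ _) ⟩
  ∑F (λ i → ∑F (λ j → p i j)) + ∑F (λ i → ∑F (λ j → q i j))
    ≡⟨ cong (∑F (λ i → ∑F (λ j → p i j)) +_) (∑-swap V V q) ⟩
  ∑F (λ i → ∑F (λ j → p i j)) + ∑F (λ j → ∑F (λ i → q i j))
    ≡⟨ sym (trans (∑-cong V (λ i → ∑-+ V (p i) (λ j → q j i))) (∑-+ V _ _)) ⟩
  ∑F (λ x → ∑F (λ z → p x z + q z x))
    ≡⟨ ∑-cong V (λ x → ∑-cong V (λ z → pt x z)) ⟩
  ∑F (λ x → ∑F (λ z → 𝟙 (adj g x z) * f x z)) ∎)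
  where
  open ≡-Reasoning
  V = allFin n
  lk = look (completeEdges n) (Graph.bits g)
  h : Edge n → ℕ
  h e = f (proj₁ e) (proj₂ e) + f (proj₂ e) (proj₁ e)
  p q : Fin n → Fin n → ℕ
  p i j = 𝟙 (i <F j) * (𝟙 (lk (i , j)) * f i j)
  q i j = 𝟙 (i <F j) * (𝟙 (lk (i , j)) * f j i)
  lem₁ : ∀ a b c d → a * (b * (c + d)) ≡ a * (b * c) + a * (b * d)
  lem₁ = solve-∀
  pt : ∀ x z → p x z + q z x ≡ 𝟙 (adj g x z) * f x z
  pt x z with x F.≟ z
  ... | yes refl rewrite adj-irr g x | <F-irrefl x = refl
  ... | no x≢z with x <F z in eq
  ... | true  rewrite <F-asym {i = x} {z} eq = trans (+-identityʳ _) (+-identityʳ _)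
  ... | false rewrite <F-conn x≢z eq = +-identityʳ _

incident-𝟙 : ∀ {n} (v : Fin n) {a b} → a ≢ b → 𝟙 (incident v (a , b)) ≡ 𝟙 (a == v) + 𝟙 (b == v)
incident-𝟙 v {a} {b} h with a F.≟ v | b F.≟ v
... | yes refl | yes refl = ⊥-elim (h refl)
... | yes _ | no _  = refl
... | no _  | yes _ = refl
... | no _  | no _  = refl

degree-∑ : ∀ {n} (g : Graph n) v → degree g v ≡ ∑ (edges g) (λ e → 𝟙 (incident v e))
degree-∑ g v = length-boolFilter (incident v) (edges g)

∑-adj-row : ∀ {n} (g : Graph n) v → ∑F (λ z → 𝟙 (adj g v z)) ≡ degree g v
∑-adj-row {n} g v = sym (begin
  degree g v                                    ≡⟨ degree-∑ g v ⟩
  ∑ (edges g) (λ e → 𝟙 (incident v e))          ≡⟨ ∑-cong-∈ (edges g) (λ { (a , b) m → incident-𝟙 v (adj⇒≢ g (proj₁ (∈⇒adj g m))) }) ⟩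
  ∑ (edges g) (λ e → 𝟙 (proj₁ e == v) + 𝟙 (proj₂ e == v)) ≡⟨ sym (∑-adj g (λ x z → 𝟙 (x == v))) ⟩
  ∑F (λ x → ∑F (λ z → 𝟙 (adj g x z) * 𝟙 (x == v)))
    ≡⟨ ∑-cong V (λ x → trans (∑-*ʳ V (λ z → 𝟙 (adj g x z)) (𝟙 (x == v)))
         (trans (*-comm _ (𝟙 (x == v))) (cong (λ t → 𝟙 t * ∑F (λ z → 𝟙 (adj g x z))) (==-sym x v)))) ⟩
  ∑F (λ x → 𝟙 (v == x) * ∑F (λ z → 𝟙 (adj g x z))) ≡⟨ ∑F-δ (λ x → ∑F (λ z → 𝟙 (adj g x z))) v ⟩
  ∑F (λ z → 𝟙 (adj g v z)) ∎)
  where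
  open ≡-Reasoning
  V = allFin n

regular⇒degree : ∀ {n} d (g : Graph n) → isRegular d g ≡ true → ∀ v → degree g v ≡ d
regular⇒degree {n} d g r v = ≡ᵇ-t⁻ (degree g v) d (allB-t⁻ _ (allFin n) r (∈-allFin v))

row : ∀ {n} d (g : Graph n) → isRegular d g ≡ true → ∀ v → ∑F (λ z → 𝟙 (adj g v z)) ≡ d
row d g r v = trans (∑-adj-row g v) (regular⇒degree d g r v)

wt-adj : ∀ {n} (g : Graph n) → ∑F (λ x → ∑F (λ z → 𝟙 (adj g x z))) ≡ 2 * wt (Graph.bits g)
wt-adj {n} g = begin
  ∑F (λ x → ∑F (λ z → 𝟙 (adj g x z)))     ≡⟨ ∑-cong V (λ x → ∑-cong V (λ z → sym (*-identityʳ _))) ⟩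
  ∑F (λ x → ∑F (λ z → 𝟙 (adj g x z) * 1)) ≡⟨ ∑-adj g (λ _ _ → 1) ⟩
  ∑ (edges g) (λ _ → 2 * 1)               ≡⟨ ∑-*ˡ (edges g) 2 (λ _ → 1) ⟩
  2 * ∑ (edges g) (λ _ → 1)               ≡⟨ cong (2 *_) (wt-select {n} (completeEdges n) (Graph.bits g)) ⟩
  2 * wt (Graph.bits g) ∎
  where
  open ≡-Reasoning
  V = allFin n

edges-Unique : ∀ {n} (g : Graph n) → Unique (edges g)
edges-Unique {n} g = go (completeEdges n) (Graph.bits g) (complete-Unique n)
  where
  sel-All : ∀ {P : Edge n → Set} E (v : Vec Bool (length E)) → All P E → All P (select E v)
  sel-All []      v           []       = []
  sel-All (x ∷ E) (true ∷ v)  (p ∷ ps) = p ∷ sel-All E v ps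
  sel-All (x ∷ E) (false ∷ v) (p ∷ ps) = sel-All E v ps
  go : ∀ E (v : Vec Bool (length E)) → Unique E → Unique (select E v)
  go []      v           u        = []
  go (x ∷ E) (true ∷ v)  (u ∷ us) = sel-All E v u ∷ go E v us
  go (x ∷ E) (false ∷ v) (u ∷ us) = go E v us

-- Switchings

#_ : ∀ {n} → (Graph n → Bool) → ℕ
#_ {n} A = ∑ (allGraphs n) (λ g → 𝟙 (A g))

tg : ∀ {n} → Edge n → Graph n → Graph n
tg {n} e g = graph (tog (completeEdges n) (Graph.bits g) e)

∑-tg : ∀ {n} e (f : Graph n → ℕ) → ∑ (allGraphs n) (λ g → f (tg e g)) ≡ ∑ (allGraphs n) f
∑-tg {n} e f = trans (∑-map graph V (λ g → f (tg e g)))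
  (trans (∑-tog (completeEdges n) e (λ v → f (graph v))) (sym (∑-map graph V f)))
  where V = allVecs (length (completeEdges n))

Quad : ℕ → Set
Quad n = Fin n × Fin n × Fin n × Fin n

-- Being a composition of bit flips, this is a bijection on all graphs; it is a switching where sv holds.
sw : ∀ {n} → Quad n → Graph n → Graph n
sw (x , y , z , w) g = tg (nrm x z) (tg (nrm y w) (tg (nrm x y) (tg (nrm z w) g)))

∑-sw : ∀ {n} q (f : Graph n → ℕ) → ∑ (allGraphs n) (λ g → f (sw q g)) ≡ ∑ (allGraphs n) f
∑-sw (x , y , z , w) f =
  trans (∑-tg (nrm z w) (λ g → f (tg (nrm x z) (tg (nrm y w) (tg (nrm x y) g)))))
  (trans (∑-tg (nrm x y) (λ g → f (tg (nrm x z) (tg (nrm y w) g))))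
  (trans (∑-tg (nrm y w) (λ g → f (tg (nrm x z) g))) (∑-tg (nrm x z) f)))

sv : ∀ {n} → Quad n → Graph n → Bool
sv (x , y , z , w) g = (adj g x y ∧ adj g z w) ∧ ((not (adj g x z) ∧ not (adj g y w)) ∧ (not (x == z) ∧ not (y == w)))

lk : ∀ {n} → Graph n → Edge n → Bool
lk {n} g = look (completeEdges n) (Graph.bits g)

∑-tg-remove : ∀ {n} (g : Graph n) e (h : Edge n → ℕ) → e ∈ completeEdges n → lk g e ≡ true →
              ∑ (edges (tg e g)) h + h e ≡ ∑ (edges g) h
∑-tg-remove {n} g e h m p with select-tog (completeEdges n) (Graph.bits g) e h m
... | q rewrite p = trans (cong (∑ (edges (tg e g)) h +_) (sym (+-identityʳ (h e)))) (trans q (+-identityʳ _))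

∑-tg-add : ∀ {n} (g : Graph n) e (h : Edge n → ℕ) → e ∈ completeEdges n → lk g e ≡ false →
           ∑ (edges (tg e g)) h ≡ ∑ (edges g) h + h e
∑-tg-add {n} g e h m p with select-tog (completeEdges n) (Graph.bits g) e h m
... | q rewrite p = trans (sym (+-identityʳ _)) (trans q (cong (∑ (edges g) h +_) (+-identityʳ (h e))))

lk-same : ∀ {n} (g : Graph n) e → e ∈ completeEdges n → lk (tg e g) e ≡ not (lk g e)
lk-same {n} g e = look-tog-same (completeEdges n) (Graph.bits g) e

lk-diff : ∀ {n} (g : Graph n) e e′ → e ≢ e′ → lk (tg e g) e′ ≡ lk g e′
lk-diff {n} g e e′ = look-tog-diff (completeEdges n) (Graph.bits g) e e′

incident-nrm : ∀ {n} (v : Fin n) {a b} → a ≢ b → 𝟙 (incident v (nrm a b)) ≡ 𝟙 (a == v) + 𝟙 (b == v)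
incident-nrm v {a} {b} h with a <F b
... | true  = incident-𝟙 v h
... | false = trans (incident-𝟙 v (λ e → h (sym e))) (+-comm (𝟙 (b == v)) _)

module Switch {n} (g : Graph n) (x y z w : Fin n) (valid : sv (x , y , z , w) g ≡ true) where

  private
    q : Quad n
    q = x , y , z , w
    v₁ = ∧-t⁻ {adj g x y ∧ adj g z w} valid
    v₂ = ∧-t⁻ {adj g x y} (proj₁ v₁)
    v₃ = ∧-t⁻ {not (adj g x z) ∧ not (adj g y w)} (proj₂ v₁)
    v₄ = ∧-t⁻ {not (adj g x z)} (proj₁ v₃)
    v₅ = ∧-t⁻ {not (x == z)} (proj₂ v₃)

  xy : adj g x y ≡ true
  xy = proj₁ v₂
  zw : adj g z w ≡ true
  zw = proj₂ v₂
  xz : adj g x z ≡ false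
  xz = not-t⁻ (proj₁ v₄)
  yw : adj g y w ≡ false
  yw = not-t⁻ (proj₂ v₄)
  x≢z : x ≢ z
  x≢z = ==-f⁻ (not-t⁻ (proj₁ v₅))
  y≢w : y ≢ w
  y≢w = ==-f⁻ (not-t⁻ (proj₂ v₅))

  e₁ e₂ e₃ e₄ : Edge n
  e₁ = nrm x y
  e₂ = nrm z w
  e₃ = nrm x z
  e₄ = nrm y w

  g₁ g₂ g₃ : Graph n
  g₁ = tg e₂ g
  g₂ = tg e₁ g₁
  g₃ = tg e₄ g₂

  -- For x = w the edge zw would be the non-edge xz. This is what separates the two removed edges
  -- from each other, and likewise the two added ones.
  x≢w : x ≢ w
  x≢w refl = t≢f zw (trans (adj-sym g z x) xz)

  x≢y : x ≢ y
  x≢y = adj⇒≢ g xy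

  z≢w : z ≢ w
  z≢w = adj⇒≢ g zw

  e₂≢e₁ : e₂ ≢ e₁
  e₂≢e₁ e with nrm-inj {u = z} {w} {x} {y} e
  ... | inj₁ (p , _) = x≢z (sym p)
  ... | inj₂ (_ , p) = x≢w (sym p)

  e₄≢e₃ : e₄ ≢ e₃
  e₄≢e₃ e with nrm-inj {u = y} {w} {x} {z} e
  ... | inj₁ (p , _) = x≢y (sym p)
  ... | inj₂ (_ , p) = x≢w (sym p)

  tf : ∀ {e e′} → lk g e ≡ true → lk g e′ ≡ false → e ≢ e′
  tf p q refl = t≢f p q

  lk-sw : ∀ e → e ≢ e₁ → e ≢ e₂ → e ≢ e₃ → e ≢ e₄ → lk (sw q g) e ≡ lk g e
  lk-sw e h₁ h₂ h₃ h₄ = trans (lk-diff g₃ e₃ e (h₃ ∘ sym)) (trans (lk-diff g₂ e₄ e (h₄ ∘ sym))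
    (trans (lk-diff g₁ e₁ e (h₁ ∘ sym)) (lk-diff g e₂ e (h₂ ∘ sym))))

  keep : ∀ {u v} → adj g u v ≡ true → nrm u v ≢ e₁ → nrm u v ≢ e₂ → adj (sw q g) u v ≡ true
  keep {u} {v} p h₁ h₂ = trans (lk-sw (nrm u v) h₁ h₂ (tf p xz) (tf p yw)) p

  new : ∀ {u v} → adj (sw q g) u v ≡ true → adj g u v ≡ true ⊎ (nrm u v ≡ e₃ ⊎ nrm u v ≡ e₄)
  new {u} {v} p with nrm u v ≟E e₃ | nrm u v ≟E e₄
  ... | yes e | _     = inj₂ (inj₁ e)
  ... | no _  | yes e = inj₂ (inj₂ e)
  ... | no h₃ | no h₄ with nrm u v ≟E e₁ | nrm u v ≟E e₂
  ... | yes e | _     = inj₁ (trans (cong (lk g) e) xy)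
  ... | no _  | yes e = inj₁ (trans (cong (lk g) e) zw)
  ... | no h₁ | no h₂ = inj₁ (trans (sym (lk-sw (nrm u v) h₁ h₂ h₃ h₄)) p)

  lk-e₁ : lk g₁ e₁ ≡ true
  lk-e₁ = trans (lk-diff g e₂ e₁ e₂≢e₁) xy

  lk-e₄ : lk g₂ e₄ ≡ false
  lk-e₄ = trans (lk-diff g₁ e₁ e₄ (tf xy yw)) (trans (lk-diff g e₂ e₄ (tf zw yw)) yw)

  lk-e₃ : lk g₃ e₃ ≡ false
  lk-e₃ = trans (lk-diff g₂ e₄ e₃ e₄≢e₃)
    (trans (lk-diff g₁ e₁ e₃ (tf xy xz)) (trans (lk-diff g e₂ e₃ (tf zw xz)) xz))

  sw-xz : adj (sw q g) x z ≡ true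
  sw-xz = trans (lk-same g₃ e₃ (nrm-∈ x≢z)) (cong not lk-e₃)

  sw-yw : adj (sw q g) y w ≡ true
  sw-yw = trans (lk-diff g₃ e₃ e₄ (e₄≢e₃ ∘ sym)) (trans (lk-same g₂ e₄ (nrm-∈ y≢w)) (cong not lk-e₄))

  sw-degree : ∀ v → degree (sw q g) v ≡ degree g v
  sw-degree v = trans (degree-∑ (sw q g) v) (trans (+-cancelʳ-≡ (h e₁ + h e₂) _ _ tot) (sym (degree-∑ g v)))
    where
    h : Edge n → ℕ
    h e = 𝟙 (incident v e)
    D = λ g → ∑ (edges g) h
    -- The removed pair xy, zw and the added pair xz, yw both cover each of x, y, z, w once.
    bal : h e₁ + h e₂ ≡ h e₄ + h e₃
    bal rewrite incident-nrm v x≢y | incident-nrm v z≢w | incident-nrm v x≢z | incident-nrm v y≢w =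
      lem (𝟙 (x == v)) (𝟙 (y == v)) (𝟙 (z == v)) (𝟙 (w == v))
      where
      lem : ∀ a b c d → a + b + (c + d) ≡ b + d + (a + c)
      lem = solve-∀
    open ≡-Reasoning
    tot : D (sw q g) + (h e₁ + h e₂) ≡ D g + (h e₁ + h e₂)
    tot = begin
      D (sw q g) + (h e₁ + h e₂)          ≡⟨ cong (_+ (h e₁ + h e₂)) (∑-tg-add g₃ e₃ h (nrm-∈ x≢z) lk-e₃) ⟩
      D g₃ + h e₃ + (h e₁ + h e₂)         ≡⟨ cong (λ t → t + h e₃ + (h e₁ + h e₂)) (∑-tg-add g₂ e₄ h (nrm-∈ y≢w) lk-e₄) ⟩
      D g₂ + h e₄ + h e₃ + (h e₁ + h e₂)  ≡⟨ lem (D g₂) (h e₄) (h e₃) (h e₁) (h e₂) ⟩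
      D g₂ + h e₁ + h e₂ + (h e₄ + h e₃)  ≡⟨ cong (λ t → t + h e₂ + (h e₄ + h e₃)) (∑-tg-remove g₁ e₁ h (nrm-∈ x≢y) lk-e₁) ⟩
      D g₁ + h e₂ + (h e₄ + h e₃)         ≡⟨ cong (_+ (h e₄ + h e₃)) (∑-tg-remove g e₂ h (nrm-∈ z≢w) zw) ⟩
      D g + (h e₄ + h e₃)                 ≡⟨ cong (D g +_) (sym bal) ⟩
      D g + (h e₁ + h e₂) ∎
      where
      lem : ∀ a b c d e → a + b + c + (d + e) ≡ a + d + e + (b + c)
      lem = solve-∀

  sw-regular : ∀ d → isRegular d g ≡ true → isRegular d (sw q g) ≡ true
  sw-regular d r = trans (allB-cong (allFin n) (λ v → cong (λ t → t ≡ᵇ d) (sw-degree v))) r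

  sw-⊆ : ∀ Γ → (Graph.bits Γ ⊆ᵇ Graph.bits g) ≡ true → adj Γ x y ≡ false → adj Γ z w ≡ false →
         (Graph.bits Γ ⊆ᵇ Graph.bits (sw q g)) ≡ true
  sw-⊆ Γ s h₁ h₂ = step g₃ e₃ (step g₂ e₄ (step g₁ e₁ (step g e₂ s h₂) h₁) (off yw)) (off xz)
    where
    step : ∀ g′ e → (Graph.bits Γ ⊆ᵇ Graph.bits g′) ≡ true → lk Γ e ≡ false → (Graph.bits Γ ⊆ᵇ Graph.bits (tg e g′)) ≡ true
    step g′ e = ⊆ᵇ-tog (completeEdges n) (Graph.bits Γ) (Graph.bits g′) e
    off : ∀ {e} → lk g e ≡ false → lk Γ e ≡ false
    off {e} p = ¬t⇒f (λ t → t≢f (⊆ᵇ-look (completeEdges n) (Graph.bits Γ) (Graph.bits g) e s t) p)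

-- Double counting of pairs (graph, quadruple): `F` bounds from below the valid switchings out of a
-- graph in `A`, `R` from above those that lead into a graph in `B`. Each `sw q` permutes all
-- graphs, valid or not, so the sum over graphs can be reindexed for every `q` separately.
switching : ∀ {n} (A B : Graph n → Bool) (Q : List (Quad n)) (val rv : Quad n → Graph n → Bool) F R →
  (∀ q g → q ∈ Q → A g ≡ true → val q g ≡ true → B (sw q g) ≡ true × rv q (sw q g) ≡ true) →
  (∀ g → A g ≡ true → F ≤ ∑ Q (λ q → 𝟙 (val q g))) →
  (∀ g → B g ≡ true → ∑ Q (λ q → 𝟙 (rv q g)) ≤ R) →
  # A * F ≤ # B * R
switching {n} A B Q val rv F R h₁ h₂ h₃ = begin
  # A * F                                              ≡⟨ sym (∑-*ʳ G _ F) ⟩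
  ∑ G (λ g → 𝟙 (A g) * F)                              ≤⟨ ∑-mono G (λ g → 𝟙-*≤ (h₂ g)) ⟩
  ∑ G (λ g → 𝟙 (A g) * ∑ Q (λ q → 𝟙 (val q g)))        ≡⟨ ∑-cong G (λ g → sym (∑-*ˡ Q (𝟙 (A g)) _)) ⟩
  ∑ G (λ g → ∑ Q (λ q → 𝟙 (A g) * 𝟙 (val q g)))        ≡⟨ ∑-swap G Q _ ⟩
  ∑ Q (λ q → ∑ G (λ g → 𝟙 (A g) * 𝟙 (val q g)))        ≤⟨ ∑-mono-∈ Q (λ q m → ∑-mono G (λ g → pt q g m)) ⟩
  ∑ Q (λ q → ∑ G (λ g → 𝟙 (B (sw q g)) * 𝟙 (rv q (sw q g)))) ≡⟨ ∑-cong Q (λ q → ∑-sw q (λ g → 𝟙 (B g) * 𝟙 (rv q g))) ⟩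
  ∑ Q (λ q → ∑ G (λ g → 𝟙 (B g) * 𝟙 (rv q g)))         ≡⟨ sym (∑-swap G Q _) ⟩
  ∑ G (λ g → ∑ Q (λ q → 𝟙 (B g) * 𝟙 (rv q g)))         ≡⟨ ∑-cong G (λ g → ∑-*ˡ Q (𝟙 (B g)) _) ⟩
  ∑ G (λ g → 𝟙 (B g) * ∑ Q (λ q → 𝟙 (rv q g)))         ≤⟨ ∑-mono G (λ g → 𝟙-*≤ (h₃ g)) ⟩
  ∑ G (λ g → 𝟙 (B g) * R)                              ≡⟨ ∑-*ʳ G _ R ⟩
  # B * R ∎
  where
  open ≤-Reasoning
  G = allGraphs n
  pt : ∀ q g → q ∈ Q → 𝟙 (A g) * 𝟙 (val q g) ≤ 𝟙 (B (sw q g)) * 𝟙 (rv q (sw q g))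
  pt q g m with A g in a | val q g in v
  ... | false | _     = z≤n
  ... | true  | false = z≤n
  ... | true  | true  with h₁ q g m a v
  ... | b , r rewrite b | r = ≤-refl

-- Sums over pairs of vertices

∑∑ : ∀ {n} → (Fin n → Fin n → ℕ) → ℕ
∑∑ f = ∑F (λ x → ∑F (λ y → f x y))

∑∑-mono : ∀ {n} {f g : Fin n → Fin n → ℕ} → (∀ x y → f x y ≤ g x y) → ∑∑ f ≤ ∑∑ g
∑∑-mono {n} h = ∑-mono (allFin n) (λ x → ∑-mono (allFin n) (h x))

∑∑-cong : ∀ {n} {f g : Fin n → Fin n → ℕ} → (∀ x y → f x y ≡ g x y) → ∑∑ f ≡ ∑∑ g
∑∑-cong {n} h = ∑-cong (allFin n) (λ x → ∑-cong (allFin n) (h x))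

∑∑-+ : ∀ {n} (f g : Fin n → Fin n → ℕ) → ∑∑ (λ x y → f x y + g x y) ≡ ∑∑ f + ∑∑ g
∑∑-+ {n} f g = trans (∑-cong (allFin n) (λ x → ∑-+ (allFin n) (f x) (g x))) (∑-+ (allFin n) _ _)

∑∑-*ˡ : ∀ {n} c (f : Fin n → Fin n → ℕ) → ∑∑ (λ x y → c * f x y) ≡ c * ∑∑ f
∑∑-*ˡ {n} c f = trans (∑-cong (allFin n) (λ x → ∑-*ˡ (allFin n) c (f x))) (∑-*ˡ (allFin n) c _)

∑∑-*ʳ : ∀ {n} (f : Fin n → Fin n → ℕ) c → ∑∑ (λ x y → f x y * c) ≡ ∑∑ f * c
∑∑-*ʳ {n} f c = trans (∑-cong (allFin n) (λ x → ∑-*ʳ (allFin n) (f x) c)) (∑-*ʳ (allFin n) _ c)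

∑∑-δ : ∀ {n} (a b : Fin n) → ∑∑ (λ z w → 𝟙 (a == z) * 𝟙 (b == w)) ≡ 1
∑∑-δ {n} a b = begin
  ∑∑ (λ z w → 𝟙 (a == z) * 𝟙 (b == w))
    ≡⟨ ∑-cong V (λ z → trans (∑-*ˡ V (𝟙 (a == z)) _) (cong (𝟙 (a == z) *_)
         (trans (∑-cong V (λ w → sym (*-identityʳ _))) (∑F-δ (λ _ → 1) b)))) ⟩
  ∑F (λ z → 𝟙 (a == z) * 1) ≡⟨ ∑F-δ (λ _ → 1) a ⟩
  1 ∎
  where
  open ≡-Reasoning
  V = allFin n

∑∑-nrm∈ : ∀ {n} (L : List (Edge n)) → ∑∑ (λ z w → 𝟙 (nrm z w ∈E L)) ≤ length L * 2
∑∑-nrm∈ {n} L = begin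
  ∑∑ (λ z w → 𝟙 (nrm z w ∈E L))
    ≤⟨ ∑∑-mono (λ z w → anyB≤∑ (λ y → y ==E nrm z w) L) ⟩
  ∑F (λ z → ∑F (λ w → ∑ L (λ l → 𝟙 (l ==E nrm z w))))
    ≡⟨ trans (∑-cong V (λ z → ∑-swap V L _)) (∑-swap V L _) ⟩
  ∑ L (λ l → ∑∑ (λ z w → 𝟙 (l ==E nrm z w)))
    ≤⟨ ∑-≤const L 2 one ⟩
  length L * 2 ∎
  where
  open ≤-Reasoning
  V = allFin n
  one : ∀ l → ∑∑ (λ z w → 𝟙 (l ==E nrm z w)) ≤ 2
  one (a , b) = begin
    ∑∑ (λ z w → 𝟙 ((a , b) ==E nrm z w))
      ≤⟨ ∑∑-mono pt ⟩
    ∑∑ (λ z w → 𝟙 (a == z) * 𝟙 (b == w) + 𝟙 (b == z) * 𝟙 (a == w))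
      ≡⟨ ∑∑-+ (λ z w → 𝟙 (a == z) * 𝟙 (b == w)) (λ z w → 𝟙 (b == z) * 𝟙 (a == w)) ⟩
    ∑∑ (λ z w → 𝟙 (a == z) * 𝟙 (b == w)) + ∑∑ (λ z w → 𝟙 (b == z) * 𝟙 (a == w))
      ≡⟨ cong₂ _+_ (∑∑-δ a b) (∑∑-δ b a) ⟩
    2 ∎
    where
    pt : ∀ z w → 𝟙 ((a , b) ==E nrm z w) ≤ 𝟙 (a == z) * 𝟙 (b == w) + 𝟙 (b == z) * 𝟙 (a == w)
    pt z w with (a , b) ≟E nrm z w
    ... | no _  = z≤n
    ... | yes e with z <F w
    pt z w | yes refl | true  rewrite ==-refl z | ==-refl w = s≤s z≤n
    pt z w | yes refl | false rewrite ==-refl z | ==-refl w = ≤-trans (s≤s z≤n) (m≤n+m 1 _)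

infixr 5 _⊗_
_⊗_ : ∀ {A B : Set} → List A → List B → List (A × B)
xs ⊗ ys = concatMap (λ x → map (x ,_) ys) xs

∑-⊗ : ∀ {A B : Set} (xs : List A) (ys : List B) f → ∑ (xs ⊗ ys) f ≡ ∑ xs (λ x → ∑ ys (λ y → f (x , y)))
∑-⊗ xs ys f = trans (∑-concatMap _ xs f) (∑-cong xs (λ x → ∑-map (x ,_) ys f))

module Regular {n} (d : ℕ) (g : Graph n) (reg : isRegular d g ≡ true) where
  private
    V = allFin n
    a : Fin n → Fin n → ℕ
    a x y = 𝟙 (adj g x y)

  ∑row : ∀ v → ∑F (λ z → 𝟙 (adj g v z)) ≡ d
  ∑row = row d g reg

  ∑col : ∀ v → ∑F (λ z → 𝟙 (adj g z v)) ≡ d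
  ∑col v = trans (∑-cong V (λ z → cong 𝟙 (adj-sym g z v))) (∑row v)

  ∑all : ∑∑ (λ x y → 𝟙 (adj g x y)) ≡ n * d
  ∑all = trans (∑-cong V ∑row) (∑F-const {n} d)

  ∑-from : ∀ (f : Fin n → ℕ) → ∑∑ (λ z w → f z * a z w) ≡ ∑F f * d
  ∑-from f = trans (∑-cong V (λ z → trans (∑-*ˡ V (f z) (a z)) (cong (f z *_) (∑row z)))) (∑-*ʳ V f d)

  ∑-into : ∀ (f : Fin n → ℕ) → ∑∑ (λ z w → f w * a z w) ≡ ∑F f * d
  ∑-into f = trans (∑-swap V V _) (trans (∑-cong V (λ w → trans (∑-*ˡ V (f w) (λ z → a z w)) (cong (f w *_) (∑col w)))) (∑-*ʳ V f d))

  ∑-δF : ∀ (x : Fin n) → ∑F (λ z → 𝟙 (x == z)) ≡ 1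
  ∑-δF x = trans (∑-cong V (λ z → sym (*-identityʳ _))) (∑F-δ (λ _ → 1) x)

-- Union bound over the four obstructions to switching the edges xy and zw. Each error term keeps
-- its factor for the edge zw, so that regularity evaluates its sum over z and w.
sw-split : ∀ {n} (g : Graph n) x y z w →
  𝟙 (adj g x y) * 𝟙 (adj g z w) ≤
  𝟙 (sv (x , y , z , w) g) + (𝟙 (adj g x z) * 𝟙 (adj g z w) + 𝟙 (adj g y w) * 𝟙 (adj g z w)
    + (𝟙 (x == z) * 𝟙 (adj g z w) + 𝟙 (y == w) * 𝟙 (adj g z w))) * 𝟙 (adj g x y)
sw-split g x y z w with adj g x y | adj g z w | adj g x z | adj g y w | x == z | y == w
... | false | _     | _     | _     | _     | _     = z≤n
... | true  | false | _     | _     | _     | _     = z≤n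
... | true  | true  | true  | _     | _     | _     = s≤s z≤n
... | true  | true  | false | true  | _     | _     = s≤s z≤n
... | true  | true  | false | false | true  | _     = s≤s z≤n
... | true  | true  | false | false | false | true  = s≤s z≤n
... | true  | true  | false | false | false | false = s≤s z≤n

-- Upper tail: graphs containing prescribed edges

-- Number of ordered edges zw, counted per obstruction, that cannot be switched with a given xy: d²
-- with xz an edge, d² with yw an edge, d with x = z, d with y = w. It is left unsimplified to match
-- the four sums of `obstructions`.
δ : ℕ → ℕ
δ d = d * d + d * d + (1 * d + 1 * d)

obstructions : ∀ {n} d (g : Graph n) → isRegular d g ≡ true → ∀ x y →
  ∑∑ (λ z w → 𝟙 (adj g x z) * 𝟙 (adj g z w) + 𝟙 (adj g y w) * 𝟙 (adj g z w)
            + (𝟙 (x == z) * 𝟙 (adj g z w) + 𝟙 (y == w) * 𝟙 (adj g z w))) ≡ δ d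
obstructions {n} d g reg x y =
  trans (∑∑-+ (λ z w → 𝟙 (adj g x z) * 𝟙 (adj g z w) + 𝟙 (adj g y w) * 𝟙 (adj g z w)) _)
  (cong₂ _+_
    (trans (∑∑-+ (λ z w → 𝟙 (adj g x z) * 𝟙 (adj g z w)) _)
      (cong₂ _+_ (trans (∑-from (λ z → 𝟙 (adj g x z))) (cong (_* d) (∑row x)))
                 (trans (∑-into (λ w → 𝟙 (adj g y w))) (cong (_* d) (∑row y)))))
    (trans (∑∑-+ (λ z w → 𝟙 (x == z) * 𝟙 (adj g z w)) _)
      (cong₂ _+_ (trans (∑-from (λ z → 𝟙 (x == z))) (cong (_* d) (∑-δF x)))
                 (trans (∑-into (λ w → 𝟙 (y == w))) (cong (_* d) (∑-δF y))))))
  where open Regular d g reg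

has : ∀ {n} → List (Edge n) → Graph n → Bool
has E₀ g = allB (λ e → adj g (proj₁ e) (proj₂ e)) E₀

nrms : ∀ {n} → List (Edge n) → List (Edge n)
nrms = map (λ e → nrm (proj₁ e) (proj₂ e))

containing : ∀ {n} → ℕ → List (Edge n) → ℕ
containing d E₀ = # (λ g → isRegular d g ∧ has E₀ g)

-- The edge xy is switched away while `E₀` is kept. The hypothesis leaves at least nd/2 choices of
-- zw, and a resulting graph arises in at most d² ways, since z is then a neighbour of x and w one
-- of y. The quotient is 2d/n.
contain-step : ∀ {n} d x y (E₀ : List (Edge n)) → 1 ≤ d → nrm x y ∉ nrms E₀ →
  2 * (length E₀ * 2 + δ d) ≤ n * d →
  n * containing d ((x , y) ∷ E₀) ≤ 2 * d * containing d E₀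
contain-step {n} d@(suc d-1) x y E₀ _ fresh H = *-cancelʳ-≤ _ _ d (begin
  n * # A * d               ≡⟨ xy∙z≈y∙xz n (# A) d ⟩
  # A * (n * d)             ≤⟨ *-monoʳ-≤ (# A) big ⟩
  # A * (2 * F₀)            ≡⟨ l₂ (# A) F₀ ⟩
  2 * (# A * F₀)            ≤⟨ *-monoʳ-≤ 2 (switching A B Q val rv F₀ (d * d) post fwd bwd) ⟩
  2 * (# B * (d * d))       ≡⟨ l₃ (# B) d ⟩
  2 * d * # B * d ∎)
  where
  open ≤-Reasoning
  V = allFin n
  K = length E₀ * 2 + δ d
  F₀ = n * d ∸ K
  l₂ : ∀ a b → a * (2 * b) ≡ 2 * (a * b)
  l₂ = solve-∀
  l₃ : ∀ b d → 2 * (b * (d * d)) ≡ 2 * d * b * d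
  l₃ = solve-∀
  A B : Graph n → Bool
  A g = isRegular d g ∧ has ((x , y) ∷ E₀) g
  B g = isRegular d g ∧ has E₀ g
  zw : Edge n → Quad n
  zw e = x , y , proj₁ e , proj₂ e
  Q : List (Quad n)
  Q = map zw (V ⊗ V)
  ∑Q : ∀ f → ∑ Q f ≡ ∑∑ (λ z w → f (x , y , z , w))
  ∑Q f = trans (∑-map zw (V ⊗ V) f) (∑-⊗ V V _)
  val rv : Quad n → Graph n → Bool
  val q@(x′ , y′ , z , w) g = sv q g ∧ not (nrm z w ∈E nrms E₀)
  rv (x′ , y′ , z , w) g = adj g x′ z ∧ adj g y′ w
  big : n * d ≤ 2 * F₀
  big = +-cancelʳ-≤ (2 * K) _ _ (begin
    n * d + 2 * K         ≤⟨ +-monoʳ-≤ (n * d) H ⟩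
    n * d + n * d         ≤⟨ +-mono-≤ (m≤n+m∸n (n * d) K) (m≤n+m∸n (n * d) K) ⟩
    K + F₀ + (K + F₀)     ≡⟨ l₄ K F₀ ⟩
    2 * F₀ + 2 * K ∎)
    where
    l₄ : ∀ k f → k + f + (k + f) ≡ 2 * f + 2 * k
    l₄ = solve-∀
  post : ∀ q g → q ∈ Q → A g ≡ true → val q g ≡ true → B (sw q g) ≡ true × rv q (sw q g) ≡ true
  post q g m a v with ∈-map⁻ zw m
  ... | (z , w) , _ , refl = ∧-t⁺ (sw-regular d (proj₁ a′)) (allB-t⁺ _ E₀ kp) , ∧-t⁺ sw-xz sw-yw
    where
    a′ = ∧-t⁻ {isRegular d g} a
    v′ = ∧-t⁻ {sv (x , y , z , w) g} v
    open Switch g x y z w (proj₁ v′) using (sw-regular; keep; sw-xz; sw-yw; xy)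
    all₀ : has E₀ g ≡ true
    all₀ with adj g x y | xy | proj₂ a′
    ... | true | _ | h = h
    kp : ∀ {e} → e ∈ E₀ → adj (sw (x , y , z , w) g) (proj₁ e) (proj₂ e) ≡ true
    kp {u , u′} i = keep (allB-t⁻ _ E₀ all₀ i)
      (λ e → fresh (subst (_∈ nrms E₀) e (∈-map⁺ _ i)))
      (λ e → t≢f (∈E-t⁺ (subst (_∈ nrms E₀) e (∈-map⁺ _ i))) (not-t⁻ (proj₂ v′)))
  fwd : ∀ g → A g ≡ true → F₀ ≤ ∑ Q (λ q → 𝟙 (val q g))
  fwd g a = m≤n+o⇒m∸n≤o _ K (begin
    n * d ≡⟨ sym ∑all ⟩
    ∑∑ (λ z w → 𝟙 (adj g z w)) ≤⟨ ∑∑-mono pt ⟩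
    ∑∑ (λ z w → 𝟙 (val (x , y , z , w) g) + 𝟙 (nrm z w ∈E nrms E₀) + I z w)
      ≡⟨ trans (∑∑-+ (λ z w → 𝟙 (val (x , y , z , w) g) + 𝟙 (nrm z w ∈E nrms E₀)) I)
           (cong (_+ ∑∑ I) (∑∑-+ (λ z w → 𝟙 (val (x , y , z , w) g)) _)) ⟩
    ∑∑ (λ z w → 𝟙 (val (x , y , z , w) g)) + ∑∑ (λ z w → 𝟙 (nrm z w ∈E nrms E₀)) + ∑∑ I
      ≤⟨ +-mono-≤ (+-monoʳ-≤ _ (∑∑-nrm∈ (nrms E₀))) (≤-reflexive (obstructions d g reg x y)) ⟩
    ∑∑ (λ z w → 𝟙 (val (x , y , z , w) g)) + length (nrms E₀) * 2 + δ d
      ≡⟨ cong₂ (λ s t → s + t * 2 + δ d) (sym (∑Q (λ q → 𝟙 (val q g)))) (length-map _ E₀) ⟩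
    ∑ Q (λ q → 𝟙 (val q g)) + length E₀ * 2 + δ d
      ≡⟨ trans (+-assoc (∑ Q (λ q → 𝟙 (val q g))) _ _) (+-comm _ K) ⟩
    K + ∑ Q (λ q → 𝟙 (val q g)) ∎)
    where
    a′ = ∧-t⁻ {isRegular d g} a
    reg = proj₁ a′
    open Regular d g reg
    xy : adj g x y ≡ true
    xy = allB-t⁻ _ ((x , y) ∷ E₀) (proj₂ a′) (here refl)
    I : Fin n → Fin n → ℕ
    I z w = 𝟙 (adj g x z) * 𝟙 (adj g z w) + 𝟙 (adj g y w) * 𝟙 (adj g z w)
            + (𝟙 (x == z) * 𝟙 (adj g z w) + 𝟙 (y == w) * 𝟙 (adj g z w))
    and-not : ∀ a b → 𝟙 a ≤ 𝟙 (a ∧ not b) + 𝟙 b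
    and-not false b     = z≤n
    and-not true  true  = s≤s z≤n
    and-not true  false = s≤s z≤n
    pt : ∀ z w → 𝟙 (adj g z w) ≤ 𝟙 (val (x , y , z , w) g) + 𝟙 (nrm z w ∈E nrms E₀) + I z w
    pt z w = begin
      𝟙 (adj g z w) ≡⟨ sym (trans (cong (λ t → 𝟙 t * 𝟙 (adj g z w)) xy) (+-identityʳ _)) ⟩
      𝟙 (adj g x y) * 𝟙 (adj g z w) ≤⟨ sw-split g x y z w ⟩
      𝟙 (sv (x , y , z , w) g) + I z w * 𝟙 (adj g x y)
        ≡⟨ cong (𝟙 (sv (x , y , z , w) g) +_) (trans (cong (λ t → I z w * 𝟙 t) xy) (*-identityʳ _)) ⟩
      𝟙 (sv (x , y , z , w) g) + I z w ≤⟨ +-monoˡ-≤ (I z w) (and-not (sv (x , y , z , w) g) (nrm z w ∈E nrms E₀)) ⟩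
      𝟙 (val (x , y , z , w) g) + 𝟙 (nrm z w ∈E nrms E₀) + I z w ∎
  bwd : ∀ g → B g ≡ true → ∑ Q (λ q → 𝟙 (rv q g)) ≤ d * d
  bwd g b = ≤-reflexive (trans (∑Q (λ q → 𝟙 (rv q g)))
    (trans (∑∑-cong (λ z w → 𝟙-∧ (adj g x z) _))
    (trans (∑-cong V (λ z → trans (∑-*ˡ V (𝟙 (adj g x z)) _) (cong (𝟙 (adj g x z) *_) (∑row y))))
    (trans (∑-*ʳ V _ d) (cong (_* d) (∑row x))))))
    where open Regular d g (proj₁ (∧-t⁻ {isRegular d g} b))

data Distinct {n} : List (Edge n) → Set where
  []  : Distinct []
  _∷_ : ∀ {e E₀} → nrm (proj₁ e) (proj₂ e) ∉ nrms E₀ → Distinct E₀ → Distinct (e ∷ E₀)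

contain-bound : ∀ {n} d (E₀ : List (Edge n)) → 1 ≤ d → Distinct E₀ →
  2 * (length E₀ * 2 + δ d) ≤ n * d →
  n ^ length E₀ * containing d E₀ ≤ (2 * d) ^ length E₀ * # (isRegular {n} d)
contain-bound {n} d [] h [] H = ≤-reflexive (cong (1 *_) (∑-cong (allGraphs n) (λ g → cong 𝟙 (∧-identityʳ (isRegular d g)))))
contain-bound {n} d ((x , y) ∷ E₀) h (f ∷ D) H = begin
  n * n ^ r * containing d ((x , y) ∷ E₀)    ≡⟨ xy∙z≈y∙xz n (n ^ r) _ ⟩
  n ^ r * (n * containing d ((x , y) ∷ E₀))  ≤⟨ *-monoʳ-≤ (n ^ r) (contain-step d x y E₀ h f H′) ⟩
  n ^ r * (2 * d * containing d E₀)          ≡⟨ x∙yz≈y∙xz (n ^ r) (2 * d) _ ⟩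
  2 * d * (n ^ r * containing d E₀)          ≤⟨ *-monoʳ-≤ (2 * d) (contain-bound d E₀ h D H′) ⟩
  2 * d * ((2 * d) ^ r * # (isRegular {n} d)) ≡⟨ sym (*-assoc (2 * d) ((2 * d) ^ r) _) ⟩
  2 * d * (2 * d) ^ r * # (isRegular {n} d) ∎
  where
  open ≤-Reasoning
  r = length E₀
  H′ : 2 * (r * 2 + δ d) ≤ n * d
  H′ = ≤-trans (*-monoʳ-≤ 2 (+-monoˡ-≤ (δ d) (*-monoˡ-≤ 2 (n≤1+n r)))) H

-- Lower tail: few edges in a dense set of pairs

module LowerTail {n} (d : ℕ) (Γ : Graph n) (B : Fin n → Fin n → Bool) where

  β : Graph n → ℕ
  β g = ∑∑ (λ x z → 𝟙 (adj g x z) * 𝟙 (B x z))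

  -- `Γ` is carried along because the set `B` will be determined by `Γ`: the tail estimate is needed
  -- among the graphs that contain `Γ`, and the switchings must not destroy it.
  ext : Graph n → Bool
  ext g = isRegular d g ∧ (Graph.bits Γ ⊆ᵇ Graph.bits g)

  few : ℕ → Graph n → Bool
  few m g = ext g ∧ (β g ≤ᵇ m)

  -- `loss` collects the quadruples given up: those with xy or zw in `Γ`, and the obstructed ones.
  ∣B∣ loss : ℕ
  ∣B∣ = ∑∑ (λ x z → 𝟙 (B x z))
  loss = (2 * wt (Graph.bits Γ) + 2 * wt (Graph.bits Γ) + δ d) * (n * d)

  private
    V = allFin n
    Q : List (Quad n)
    Q = V ⊗ V ⊗ V ⊗ V
    ∑Q : ∀ f → ∑ Q f ≡ ∑∑ (λ x y → ∑∑ (λ z w → f (x , y , z , w)))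
    ∑Q f = trans (∑-⊗ V (V ⊗ V ⊗ V) f) (∑-cong V (λ x → trans (∑-⊗ V (V ⊗ V) _) (∑-cong V (λ y → ∑-⊗ V V _))))
    val rv : Quad n → Graph n → Bool
    val q@(x , y , z , w) g = sv q g ∧ (B x z ∧ (not (adj Γ x y) ∧ not (adj Γ z w)))
    rv (x , y , z , w) g = (adj g x z ∧ B x z) ∧ adj g y w

    post : ∀ m q g → few m g ≡ true → val q g ≡ true → few (4 + m) (sw q g) ≡ true × rv q (sw q g) ≡ true
    post m (x , y , z , w) g a v =
      ∧-t⁺ (∧-t⁺ (sw-regular d (proj₁ a₂)) (sw-⊆ Γ (proj₂ a₂) (not-t⁻ (proj₁ v₃)) (not-t⁻ (proj₂ v₃))))
           (≤ᵇ-t⁺ (≤-trans grow (+-monoʳ-≤ 4 (≤ᵇ-t⁻ (β g) m (proj₂ a₁))))) ,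
      ∧-t⁺ (∧-t⁺ sw-xz (proj₁ v₂)) sw-yw
      where
      a₁ = ∧-t⁻ {ext g} a
      a₂ = ∧-t⁻ {isRegular d g} (proj₁ a₁)
      v₁ = ∧-t⁻ {sv (x , y , z , w) g} v
      v₂ = ∧-t⁻ {B x z} (proj₂ v₁)
      v₃ = ∧-t⁻ {not (adj Γ x y)} (proj₂ v₂)
      open Switch g x y z w (proj₁ v₁)
      L : List (Edge n)
      L = nrm x z ∷ nrm y w ∷ []
      pt : ∀ u t → 𝟙 (adj (sw (x , y , z , w) g) u t) * 𝟙 (B u t) ≤ 𝟙 (nrm u t ∈E L) + 𝟙 (adj g u t) * 𝟙 (B u t)
      pt u t with adj (sw (x , y , z , w) g) u t in eq
      ... | false = z≤n
      ... | true with new {u} {t} eq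
      ... | inj₁ p rewrite p = m≤n+m _ (𝟙 (nrm u t ∈E L))
      ... | inj₂ p = ≤-trans (≤-trans (≤-reflexive (+-identityʳ _)) (𝟙≤1 (B u t)))
              (≤-trans (≤-reflexive (cong 𝟙 (sym (mem p)))) (m≤m+n _ _))
        where
        mem : nrm u t ≡ nrm x z ⊎ nrm u t ≡ nrm y w → nrm u t ∈E L ≡ true
        mem (inj₁ e) = ∈E-t⁺ {xs = L} (here e)
        mem (inj₂ e) = ∈E-t⁺ {xs = L} (there (here e))
      -- At most two edges are new, and `β` meets each of them in both orders.
      grow : β (sw (x , y , z , w) g) ≤ 4 + β g
      grow = ≤-trans (∑∑-mono pt) (≤-trans (≤-reflexive (∑∑-+ (λ u t → 𝟙 (nrm u t ∈E L)) _))
               (+-monoˡ-≤ (β g) (∑∑-nrm∈ L)))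

    fwd : ∀ m g → few m g ≡ true → ∣B∣ * (d * d) ∸ loss ≤ ∑ Q (λ q → 𝟙 (val q g))
    fwd m g a = m≤n+o⇒m∸n≤o _ loss (begin
      ∣B∣ * (d * d)
        ≡⟨ sym lhs ⟩
      ∑∑ (λ x y → ∑∑ (λ z w → 𝟙 (B x z) * (𝟙 (adj g x y) * 𝟙 (adj g z w))))
        ≤⟨ ∑∑-mono (λ x y → ∑∑-mono (λ z w → pt x y z w)) ⟩
      ∑∑ (λ x y → ∑∑ (λ z w → 𝟙 (val (x , y , z , w) g) + (γ x y * a′ z w + γ z w * a′ x y + I x y z w * a′ x y)))
        ≡⟨ ∑∑-cong (λ x y → trans (∑∑-+ (λ z w → 𝟙 (val (x , y , z , w) g)) _)
             (cong (∑∑ (λ z w → 𝟙 (val (x , y , z , w) g)) +_) (rest x y))) ⟩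
      ∑∑ (λ x y → ∑∑ (λ z w → 𝟙 (val (x , y , z , w) g)) + (γ x y * (n * d) + 2wΓ * a′ x y + δ d * a′ x y))
        ≡⟨ trans (∑∑-+ (λ x y → ∑∑ (λ z w → 𝟙 (val (x , y , z , w) g))) _) (cong₂ _+_ (sym (∑Q (λ q → 𝟙 (val q g)))) tail) ⟩
      ∑ Q (λ q → 𝟙 (val q g)) + loss
        ≡⟨ +-comm _ loss ⟩
      loss + ∑ Q (λ q → 𝟙 (val q g)) ∎)
      where
      open ≤-Reasoning
      reg = proj₁ (∧-t⁻ {isRegular d g} (proj₁ (∧-t⁻ {ext g} a)))
      open Regular d g reg
      a′ γ : Fin n → Fin n → ℕ
      a′ x y = 𝟙 (adj g x y)
      γ x y = 𝟙 (adj Γ x y)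
      2wΓ = 2 * wt (Graph.bits Γ)
      I : Fin n → Fin n → Fin n → Fin n → ℕ
      I x y z w = 𝟙 (adj g x z) * 𝟙 (adj g z w) + 𝟙 (adj g y w) * 𝟙 (adj g z w)
                + (𝟙 (x == z) * 𝟙 (adj g z w) + 𝟙 (y == w) * 𝟙 (adj g z w))
      rest : ∀ x y → ∑∑ (λ z w → γ x y * a′ z w + γ z w * a′ x y + I x y z w * a′ x y)
                   ≡ γ x y * (n * d) + 2wΓ * a′ x y + δ d * a′ x y
      rest x y = trans (∑∑-+ (λ z w → γ x y * a′ z w + γ z w * a′ x y) _) (cong₂ _+_
        (trans (∑∑-+ (λ z w → γ x y * a′ z w) _) (cong₂ _+_
          (trans (∑∑-*ˡ (γ x y) a′) (cong (γ x y *_) ∑all))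
          (trans (∑∑-*ʳ γ (a′ x y)) (cong (_* a′ x y) (wt-adj Γ)))))
        (trans (∑∑-*ʳ (I x y) (a′ x y)) (cong (_* a′ x y) (obstructions d g reg x y))))
      tail : ∑∑ (λ x y → γ x y * (n * d) + 2wΓ * a′ x y + δ d * a′ x y) ≡ loss
      tail = trans (∑∑-+ (λ x y → γ x y * (n * d) + 2wΓ * a′ x y) _)
        (trans (cong₂ _+_ (trans (∑∑-+ (λ x y → γ x y * (n * d)) _)
           (cong₂ _+_ (trans (∑∑-*ʳ γ (n * d)) (cong (_* (n * d)) (wt-adj Γ)))
                      (trans (∑∑-*ˡ 2wΓ a′) (cong (2wΓ *_) ∑all))))
           (trans (∑∑-*ˡ (δ d) a′) (cong (δ d *_) ∑all)))
        (l 2wΓ (δ d) (n * d)))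
        where
        l : ∀ u v w → u * w + u * w + v * w ≡ (u + u + v) * w
        l = solve-∀
      lhs : ∑∑ (λ x y → ∑∑ (λ z w → 𝟙 (B x z) * (𝟙 (adj g x y) * 𝟙 (adj g z w)))) ≡ ∣B∣ * (d * d)
      lhs = trans (∑∑-cong (λ x y → trans (∑∑-cong (λ z w → x∙yz≈y∙xz (𝟙 (B x z)) (𝟙 (adj g x y)) (𝟙 (adj g z w))))
              (trans (∑∑-*ˡ (a′ x y) (λ z w → 𝟙 (B x z) * a′ z w)) (cong (a′ x y *_) (∑-from (λ z → 𝟙 (B x z)))))))
        (trans (∑-cong V (λ x → trans (∑-*ʳ V (a′ x) (∑F (λ z → 𝟙 (B x z)) * d)) (trans (cong (_* (∑F (λ z → 𝟙 (B x z)) * d)) (∑row x))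
                  (l′ d (∑F (λ z → 𝟙 (B x z)))))))
          (∑-*ʳ V _ (d * d)))
        where
        l′ : ∀ d b → d * (b * d) ≡ b * (d * d)
        l′ = solve-∀
      pt : ∀ x y z w → 𝟙 (B x z) * (𝟙 (adj g x y) * 𝟙 (adj g z w))
         ≤ 𝟙 (val (x , y , z , w) g) + (γ x y * a′ z w + γ z w * a′ x y + I x y z w * a′ x y)
      pt x y z w with B x z
      ... | false = z≤n
      ... | true = ≤-trans (≤-reflexive (+-identityʳ _)) (≤-trans (sw-split g x y z w) (≤-trans (+-monoˡ-≤ _ sv≤)
                     (≤-reflexive (+-assoc (𝟙 (sv (x , y , z , w) g ∧ (not (adj Γ x y) ∧ not (adj Γ z w)))) _ _))))
        where
        sv≤ : 𝟙 (sv (x , y , z , w) g) ≤ 𝟙 (sv (x , y , z , w) g ∧ (not (adj Γ x y) ∧ not (adj Γ z w))) + (γ x y * a′ z w + γ z w * a′ x y)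
        sv≤ with adj g x y | adj g z w | adj Γ x y | adj Γ z w | (not (adj g x z) ∧ not (adj g y w)) ∧ (not (x == z) ∧ not (y == w))
        ... | false | _     | _     | _     | _     = z≤n
        ... | true  | false | _     | _     | _     = z≤n
        ... | true  | true  | _     | _     | false = z≤n
        ... | true  | true  | true  | _     | true  = s≤s z≤n
        ... | true  | true  | false | true  | true  = s≤s z≤n
        ... | true  | true  | false | false | true  = s≤s z≤n

    bwd : ∀ m g → few m g ≡ true → ∑ Q (λ q → 𝟙 (rv q g)) ≤ m * (n * d)
    bwd m g a = begin
      ∑ Q (λ q → 𝟙 (rv q g))
        ≡⟨ trans (∑Q (λ q → 𝟙 (rv q g))) (∑∑-cong (λ x y → ∑∑-cong (λ z w → trans (𝟙-∧ (adj g x z ∧ B x z) _) (cong (_* a′ y w) (𝟙-∧ (adj g x z) (B x z)))))) ⟩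
      ∑∑ (λ x y → ∑∑ (λ z w → b x z * a′ y w))
        ≡⟨ ∑∑-cong (λ x y → trans (∑-cong V (λ z → trans (∑-*ˡ V (b x z) (a′ y)) (cong (b x z *_) (∑row y)))) (∑-*ʳ V (b x) d)) ⟩
      ∑∑ (λ x y → ∑F (b x) * d)
        ≡⟨ trans (∑-cong V (λ x → ∑F-const {n} (∑F (b x) * d))) (∑-cong V (λ x → x∙yz≈y∙xz n (∑F (b x)) d)) ⟩
      ∑F (λ x → ∑F (b x) * (n * d))
        ≡⟨ ∑-*ʳ V _ (n * d) ⟩
      β g * (n * d)
        ≤⟨ *-monoˡ-≤ (n * d) (≤ᵇ-t⁻ (β g) m (proj₂ (∧-t⁻ {ext g} a))) ⟩
      m * (n * d) ∎
      where
      open ≤-Reasoning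
      reg = proj₁ (∧-t⁻ {isRegular d g} (proj₁ (∧-t⁻ {ext g} a)))
      open Regular d g reg
      a′ b : Fin n → Fin n → ℕ
      a′ x y = 𝟙 (adj g x y)
      b x z = 𝟙 (adj g x z) * 𝟙 (B x z)

  -- The switchings insert an edge xz of `B`. Every pair in `B` offers d choices of y and d of w, up
  -- to `loss`. Backwards, xz must be one of the few edges in `B` and yw any edge.
  few-step : ∀ m → # (few m) * (∣B∣ * (d * d) ∸ loss) ≤ # (few (4 + m)) * ((4 + m) * (n * d))
  few-step m = switching (few m) (few (4 + m)) Q val rv _ _ (λ q g _ → post m q g) (fwd m) (bwd (4 + m))

  few-half : ∀ m → .{{NonZero (n * d)}} → 2 * ((4 + m) * (n * d)) + loss ≤ ∣B∣ * (d * d) → 2 * # (few m) ≤ # (few (4 + m))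
  few-half m H = *-cancelʳ-≤ _ _ ((4 + m) * (n * d)) {{m*n≢0 (4 + m) (n * d)}} (begin
    2 * # (few m) * ((4 + m) * (n * d))    ≡⟨ l (# (few m)) ((4 + m) * (n * d)) ⟩
    # (few m) * (2 * ((4 + m) * (n * d)))  ≤⟨ *-monoʳ-≤ (# (few m)) (m+n≤o⇒m≤o∸n _ H) ⟩
    # (few m) * (∣B∣ * (d * d) ∸ loss)     ≤⟨ few-step m ⟩
    # (few (4 + m)) * ((4 + m) * (n * d)) ∎)
    where
    open ≤-Reasoning
    l : ∀ a b → 2 * a * b ≡ a * (2 * b)
    l = solve-∀

  -- Each round raises the threshold by 4 and at least doubles the count. The hypothesis is
  -- formulated for the last, largest threshold and so serves all rounds.
  lower-tail : ∀ t m → .{{NonZero (n * d)}} → 2 * ((t * 4 + m) * (n * d)) + loss ≤ ∣B∣ * (d * d) → 2 ^ t * # (few m) ≤ # ext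
  lower-tail zero    m H = ≤-trans (≤-reflexive (+-identityʳ _)) (∑-mono-⊆ (allGraphs n) (λ g e → proj₁ (∧-t⁻ {ext g} e)))
  lower-tail (suc t) m H = begin
    2 * 2 ^ t * # (few m)    ≡⟨ l (2 ^ t) (# (few m)) ⟩
    2 ^ t * (2 * # (few m))  ≤⟨ *-monoʳ-≤ (2 ^ t) (few-half m (≤-trans (+-monoˡ-≤ loss (*-monoʳ-≤ 2 (*-monoˡ-≤ (n * d) (+-monoʳ-≤ 4 (m≤n+m m (t * 4)))))) H)) ⟩
    2 ^ t * # (few (4 + m))  ≤⟨ lower-tail t (4 + m) (subst (λ u → 2 * (u * (n * d)) + loss ≤ ∣B∣ * (d * d)) (l′ t m) H) ⟩
    # ext ∎
    where
    open ≤-Reasoning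
    l : ∀ a b → 2 * a * b ≡ a * (2 * b)
    l = solve-∀
    l′ : ∀ t m → suc t * 4 + m ≡ t * 4 + (4 + m)
    l′ = solve-∀

-- Balanced orientations

data Orients {n} : List (Edge n) → List (Edge n) → Set where
  []  : Orients [] []
  _∷_ : ∀ {e o es os} → o ≡ e ⊎ o ≡ swap e → Orients es os → Orients (e ∷ es) (o ∷ os)

outd ind : ∀ {n} → Fin n → List (Edge n) → ℕ
outd v os = ∑ os (λ o → 𝟙 (proj₁ o == v))
ind v os = ∑ os (λ o → 𝟙 (proj₂ o == v))

Balanced : ∀ {n} → List (Edge n) → Set
Balanced os = ∀ v → outd v os ≤ suc (ind v os) × ind v os ≤ suc (outd v os)

Orients-++ : ∀ {n} {r₁ r₂ o₁ o₂ : List (Edge n)} → Orients r₁ o₁ → Orients r₂ o₂ → Orients (r₁ ++ r₂) (o₁ ++ o₂)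
Orients-++ []       q = q
Orients-++ (p ∷ ps) q = p ∷ Orients-++ ps q

Orients-split : ∀ {n} (r₁ : List (Edge n)) {r₂ os} → Orients (r₁ ++ r₂) os →
  ∃[ o₁ ] ∃[ o₂ ] (os ≡ o₁ ++ o₂ × Orients r₁ o₁ × Orients r₂ o₂)
Orients-split []       p = [] , _ , refl , [] , p
Orients-split (e ∷ r₁) (p ∷ ps) with Orients-split r₁ ps
... | o₁ , o₂ , refl , q₁ , q₂ = _ ∷ o₁ , o₂ , refl , p ∷ q₁ , q₂

Avoids : ∀ {n} → Fin n → List (Edge n) → Set
Avoids b es = All (λ e → proj₁ e ≢ b × proj₂ e ≢ b) es

find : ∀ {n} (b : Fin n) (r : List (Edge n)) →
  (∃[ r₁ ] ∃[ e ] ∃[ r₂ ] ∃[ c ] (r ≡ r₁ ++ e ∷ r₂ × (e ≡ (b , c) ⊎ e ≡ (c , b)))) ⊎ Avoids b r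
find b [] = inj₂ []
find b ((x , y) ∷ r) with x F.≟ b | y F.≟ b | find b r
... | yes refl | _        | _ = inj₁ ([] , (b , y) , r , y , refl , inj₁ refl)
... | no _     | yes refl | _ = inj₁ ([] , (x , b) , r , x , refl , inj₂ refl)
... | no _     | no _     | inj₁ (r₁ , e , r₂ , c , refl , q) = inj₁ ((x , y) ∷ r₁ , e , r₂ , c , refl , q)
... | no p     | no q     | inj₂ a = inj₂ ((p , q) ∷ a)

Avoids⇒0 : ∀ {n} {b : Fin n} {es os} → Avoids b es → Orients es os → outd b os ≡ 0 × ind b os ≡ 0
Avoids⇒0 [] [] = refl , refl
Avoids⇒0 {b = b} ((p , q) ∷ a) (inj₁ refl ∷ os) rewrite ==-f⁺ p | ==-f⁺ q = Avoids⇒0 a os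
Avoids⇒0 {b = b} ((p , q) ∷ a) (inj₂ refl ∷ os) rewrite ==-f⁺ p | ==-f⁺ q = Avoids⇒0 a os

shift-balanced : ∀ {o i} c → o ≤ suc i × i ≤ suc o → c + o ≤ suc (c + i) × c + i ≤ suc (c + o)
shift-balanced {o} {i} c (p , q) = ≤-trans (+-monoʳ-≤ c p) (≤-reflexive (+-suc c i)) ,
                                   ≤-trans (+-monoʳ-≤ c q) (≤-reflexive (+-suc c o))

-- Merge two edges ab, bc at a common endpoint into ac, orient the rest, and split again: b gains one edge in and one out.
orientation : ∀ {n} k (es : List (Edge n)) → length es ≤ k → ∃[ os ] (Orients es os × Balanced os)
orientation k       [] h = [] , [] , (λ v → z≤n , z≤n)
orientation {n} (suc k) ((a , b) ∷ r) (s≤s h) with find b r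
... | inj₁ (r₁ , e , r₂ , c , refl , e≡) = result
  where
  len : length ((a , c) ∷ (r₁ ++ r₂)) ≤ k
  len = ≤-trans (≤-reflexive (trans (cong suc (length-++ r₁)) (trans (sym (+-suc (length r₁) _)) (sym (length-++ r₁))))) h
  result : ∃[ os ] (Orients ((a , b) ∷ (r₁ ++ e ∷ r₂)) os × Balanced os)
  result with orientation k ((a , c) ∷ (r₁ ++ r₂)) len
  ... | o ∷ os , o≡ ∷ ors , bal with Orients-split r₁ ors
  ... | o₁ , o₂ , refl , q₁ , q₂ = cases o≡
    where
    through : ∀ (f : Edge n → Bool) x y z m → 𝟙 (f z) + 𝟙 m ≡ 𝟙 (f x) + 𝟙 (f y) →
              ∑ (x ∷ o₁ ++ y ∷ o₂) (λ o → 𝟙 (f o)) ≡ 𝟙 m + ∑ (z ∷ (o₁ ++ o₂)) (λ o → 𝟙 (f o))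
    through f x y z m q = begin
      𝟙 (f x) + ∑ (o₁ ++ y ∷ o₂) F₀     ≡⟨ cong (𝟙 (f x) +_) (∑-++ o₁ (y ∷ o₂) F₀) ⟩
      𝟙 (f x) + (∑ o₁ F₀ + (𝟙 (f y) + ∑ o₂ F₀)) ≡⟨ l (𝟙 (f x)) (∑ o₁ F₀) (𝟙 (f y)) (∑ o₂ F₀) ⟩
      𝟙 (f x) + 𝟙 (f y) + (∑ o₁ F₀ + ∑ o₂ F₀)   ≡⟨ cong₂ _+_ (sym q) (sym (∑-++ o₁ o₂ F₀)) ⟩
      𝟙 (f z) + 𝟙 m + ∑ (o₁ ++ o₂) F₀   ≡⟨ l′ (𝟙 (f z)) (𝟙 m) _ ⟩
      𝟙 m + (𝟙 (f z) + ∑ (o₁ ++ o₂) F₀) ∎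
      where
      open ≡-Reasoning
      F₀ : Edge n → ℕ
      F₀ o = 𝟙 (f o)
      l : ∀ x s y t → x + (s + (y + t)) ≡ x + y + (s + t)
      l = solve-∀
      l′ : ∀ z m s → z + m + s ≡ m + (z + s)
      l′ = solve-∀
    rebalance : ∀ x y → (∀ v → outd v (x ∷ o₁ ++ y ∷ o₂) ≡ 𝟙 (b == v) + outd v (o ∷ (o₁ ++ o₂))) →
                        (∀ v → ind v (x ∷ o₁ ++ y ∷ o₂) ≡ 𝟙 (b == v) + ind v (o ∷ (o₁ ++ o₂))) → Balanced (x ∷ o₁ ++ y ∷ o₂)
    rebalance x y p q v = subst₂ (λ s t → s ≤ suc t × t ≤ suc s) (sym (p v)) (sym (q v)) (shift-balanced (𝟙 (b == v)) (bal v))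
    fwd : e ≡ (b , c) ⊎ e ≡ (c , b) → (b , c) ≡ e ⊎ (b , c) ≡ swap e
    fwd (inj₁ refl) = inj₁ refl
    fwd (inj₂ refl) = inj₂ refl
    bwd : e ≡ (b , c) ⊎ e ≡ (c , b) → (c , b) ≡ e ⊎ (c , b) ≡ swap e
    bwd (inj₁ refl) = inj₂ refl
    bwd (inj₂ refl) = inj₁ refl
    cases : o ≡ (a , c) ⊎ o ≡ (c , a) → ∃[ os ] (Orients ((a , b) ∷ (r₁ ++ e ∷ r₂)) os × Balanced os)
    cases (inj₁ refl) = (a , b) ∷ o₁ ++ (b , c) ∷ o₂ , inj₁ refl ∷ Orients-++ q₁ (fwd e≡ ∷ q₂) ,
      rebalance _ _ (λ v → through (λ o → proj₁ o == v) (a , b) (b , c) (a , c) (b == v) refl)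
                    (λ v → through (λ o → proj₂ o == v) (a , b) (b , c) (a , c) (b == v) (+-comm (𝟙 (c == v)) _))
    cases (inj₂ refl) = (b , a) ∷ o₁ ++ (c , b) ∷ o₂ , inj₂ refl ∷ Orients-++ q₁ (bwd e≡ ∷ q₂) ,
      rebalance _ _ (λ v → through (λ o → proj₁ o == v) (b , a) (c , b) (c , a) (b == v) (+-comm (𝟙 (c == v)) _))
                    (λ v → through (λ o → proj₂ o == v) (b , a) (c , b) (c , a) (b == v) refl)
-- No other edge meets b, so b stays balanced in either direction; the surplus at a decides.
... | inj₂ av with orientation k r h
... | os , ors , bal with a F.≟ b
... | yes refl = (a , b) ∷ os , inj₁ refl ∷ ors , (λ v → shift-balanced (𝟙 (a == v)) (bal v))
... | no a≢b with outd a os ≤? ind a os | Avoids⇒0 av ors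
... | yes p | z₁ , z₂ = (a , b) ∷ os , inj₁ refl ∷ ors , bal′
  where
  bal′ : Balanced ((a , b) ∷ os)
  bal′ v with a F.≟ v | b F.≟ v
  ... | yes refl | yes refl = ⊥-elim (a≢b refl)
  ... | yes refl | no _     = s≤s p , ≤-trans (proj₂ (bal v)) (n≤1+n _)
  ... | no _     | yes refl rewrite z₁ | z₂ = z≤n , ≤-refl
  ... | no _     | no _     = bal v
... | no p | z₁ , z₂ = (b , a) ∷ os , inj₂ refl ∷ ors , bal′
  where
  bal′ : Balanced ((b , a) ∷ os)
  bal′ v with b F.≟ v | a F.≟ v
  ... | yes refl | yes refl = ⊥-elim (a≢b refl)
  ... | yes refl | no _     rewrite z₁ | z₂ = ≤-refl , z≤n
  ... | no _     | yes refl = ≤-trans (proj₁ (bal v)) (n≤1+n _) , s≤s (<⇒≤ (≰⇒> p))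
  ... | no _     | no _     = bal v

-- `own-anti` forbids that both ends own the same edge. Together with `own-inj` it makes pairs of
-- owned edges disjoint across the whole graph, as a pairing strategy requires.
record Owned {n} (g : Graph n) (K : ℕ) : Set where
  field
    own      : Fin n → Fin K → Fin n
    own-adj  : ∀ v i → adj g v (own v i) ≡ true
    own-inj  : ∀ v {i j} → own v i ≡ own v j → i ≡ j
    own-anti : ∀ {u v i j} → own v i ≡ u → own u j ≡ v → ⊥

Unique-map-inj : ∀ {A B : Set} (f : A → B) {xs x y} → Unique (map f xs) → x ∈ xs → y ∈ xs → f x ≡ f y → x ≡ y
Unique-map-inj f u        (here refl) (here refl) e = refl
Unique-map-inj f (u ∷ us) (here refl) (there q)   e = ⊥-elim (All.lookup u (∈-map⁺ f q) e)
Unique-map-inj f (u ∷ us) (there p)   (here refl) e = ⊥-elim (All.lookup u (∈-map⁺ f p) (sym e))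
Unique-map-inj f (u ∷ us) (there p)   (there q)   e = Unique-map-inj f us p q e

lookup-inj : ∀ {A : Set} {xs : List A} → Unique xs → ∀ {i j} → lookup xs i ≡ lookup xs j → i ≡ j
lookup-inj (u ∷ us) {fz}   {fz}   e = refl
lookup-inj (u ∷ us) {fz}   {fs j} e = ⊥-elim (All.lookup u (∈-lookup j) e)
lookup-inj (u ∷ us) {fs i} {fz}   e = ⊥-elim (All.lookup u (∈-lookup i) (sym e))
lookup-inj (u ∷ us) {fs i} {fs j} e = cong fs (lookup-inj us e)

-- Balance gives d = out + in ≤ 2 out + 1, so 2K ≤ d forces K ≤ out at every vertex, which then owns
-- its first K outgoing edges.
owned : ∀ {n} d (g : Graph n) K → isRegular d g ≡ true → 2 * K ≤ d → Owned g K
owned {n} d g K reg hK = record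
  { own      = own
  ; own-adj  = λ v i → adjO (∈outs v i)
  ; own-inj  = λ v e → FP.inject≤-injective (long v) (long v) _ _ (lookup-inj (outs-Unique v) e)
  ; own-anti = λ { {u} {v} {i} {j} refl e → anti v (own v i) (∈outs v i) (subst (λ t → (own v i , t) ∈ os) e (∈outs (own v i) j)) }
  }
  where
  O = orientation (length (edges g)) (edges g) ≤-refl
  os = proj₁ O
  bal = proj₂ (proj₂ O)

  nrm′ : Edge n → Edge n
  nrm′ o = nrm (proj₁ o) (proj₂ o)

  nrm-os : ∀ {es os} → Orients es os → (∀ {e} → e ∈ es → (proj₁ e <F proj₂ e) ≡ true) → map nrm′ os ≡ es
  nrm-os []               h = refl
  nrm-os (inj₁ refl ∷ ps) h = cong₂ _∷_ (nrm-< (h (here refl))) (nrm-os ps (λ m → h (there m)))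
  nrm-os (inj₂ refl ∷ ps) h = cong₂ _∷_ (nrm-> (h (here refl))) (nrm-os ps (λ m → h (there m)))

  norm : map nrm′ os ≡ edges g
  norm = nrm-os (proj₁ (proj₂ O)) (λ {e} m → proj₂ (∈⇒adj g {proj₁ e} {proj₂ e} m))

  uniq : Unique (map nrm′ os)
  uniq = subst Unique (sym norm) (edges-Unique g)

  adjO : ∀ {v u} → (v , u) ∈ os → adj g v u ≡ true
  adjO {v} {u} m = proj₂ (∈-select⁻ (completeEdges n) (Graph.bits g) (complete-Unique n) (subst (nrm v u ∈_) norm (∈-map⁺ nrm′ m)))

  anti : ∀ v u → (v , u) ∈ os → (u , v) ∈ os → ⊥
  anti v u p q with Unique-map-inj nrm′ uniq p q (nrm-sym v u)
  ... | refl = adj⇒≢ g (adjO p) refl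

  outs : Fin n → List (Fin n)
  outs v = map proj₂ (boolFilter (λ o → proj₁ o == v) os)

  ∈-outs : ∀ {v u} → u ∈ outs v → (v , u) ∈ os
  ∈-outs {v} m with ∈-map⁻ proj₂ m
  ... | (a , b) , q , refl with ∈-boolFilter⁻ (λ o → proj₁ o == v) os q
  ... | r , e with ==-t⁻ e
  ... | refl = r

  outs-Unique : ∀ v → Unique (outs v)
  outs-Unique v = go _ (boolFilter-Unique (λ o → proj₁ o == v) os (Unq.map⁻ uniq))
                       (λ {o} m → ==-t⁻ (proj₂ (∈-boolFilter⁻ (λ o → proj₁ o == v) os m)))
    where
    go : ∀ ys → Unique ys → (∀ {o} → o ∈ ys → proj₁ o ≡ v) → Unique (map proj₂ ys)
    go []       []       h = []
    go (y ∷ ys) (u ∷ us) h = All.tabulate (λ {t} m e → hd m e) ∷ go ys us (λ m → h (there m))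
      where
      hd : ∀ {t} → t ∈ map proj₂ ys → proj₂ y ≡ t → ⊥
      hd m e with ∈-map⁻ proj₂ m
      ... | z , q , refl = All.lookup u q (cong₂ _,_ (trans (h (here refl)) (sym (h (there q)))) e)

  degs : ∀ v {es os} → Orients es os → ∑ es (λ e → 𝟙 (proj₁ e == v) + 𝟙 (proj₂ e == v)) ≡ outd v os + ind v os
  degs v [] = refl
  degs v {(a , b) ∷ es} {_ ∷ os} (inj₁ refl ∷ ps) rewrite degs v ps = l (𝟙 (a == v)) (𝟙 (b == v)) (outd v os) (ind v os)
    where
    l : ∀ a b c d → a + b + (c + d) ≡ a + c + (b + d)
    l = solve-∀
  degs v {(a , b) ∷ es} {_ ∷ os} (inj₂ refl ∷ ps) rewrite degs v ps = l (𝟙 (a == v)) (𝟙 (b == v)) (outd v os) (ind v os)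
    where
    l : ∀ a b c d → a + b + (c + d) ≡ b + c + (a + d)
    l = solve-∀

  deg : ∀ v → d ≡ outd v os + ind v os
  deg v = trans (sym (regular⇒degree d g reg v)) (trans (degree-∑ g v)
    (trans (∑-cong-∈ (edges g) (λ { (a , b) m → incident-𝟙 v (adj⇒≢ g (proj₁ (∈⇒adj g m))) })) (degs v (proj₁ (proj₂ O)))))

  long : ∀ v → K ≤ length (outs v)
  long v = ≤-trans (half K (outd v os) (≤-trans hK (≤-trans (≤-reflexive (deg v)) (≤-trans (+-monoʳ-≤ _ (proj₂ (bal v))) (≤-reflexive (l (outd v os)))))))
    (≤-reflexive (sym (trans (length-map proj₂ (boolFilter (λ o → proj₁ o == v) os)) (length-boolFilter _ os))))
    where
    l : ∀ x → x + suc x ≡ suc (2 * x)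
    l = solve-∀
    half : ∀ a b → 2 * a ≤ suc (2 * b) → a ≤ b
    half a b h with a ≤? b
    ... | yes p = p
    ... | no p = ⊥-elim (<-irrefl refl (≤-trans (≤-reflexive (l′ b)) (≤-trans (*-monoʳ-≤ 2 (≰⇒> p)) h)))
      where
      l′ : ∀ b → suc (suc (2 * b)) ≡ 2 * suc b
      l′ = solve-∀

  own : Fin n → Fin K → Fin n
  own v i = lookup (outs v) (F.inject≤ i (long v))

  ∈outs : ∀ v i → (v , own v i) ∈ os
  ∈outs v i = ∈-outs (∈-lookup (F.inject≤ i (long v)))

-- Products of sums

⊗-Unique : ∀ {A B : Set} {xs : List A} {ys : List B} → Unique xs → Unique ys → Unique (xs ⊗ ys)
⊗-Unique {xs = xs} {ys} us vs = Unq.concat⁺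
  (AllP.map⁺ (All.universal (λ x → Unq.map⁺ (λ { refl → refl }) vs) xs))
  (APP.map⁺ (AP.map (λ x≢ {e} → λ { (p , q) → x≢ (trans (sym (fst p)) (fst q)) }) us))
  where
  fst : ∀ {x e} → e ∈ map (x ,_) ys → proj₁ e ≡ x
  fst p with ∈-map⁻ _ p
  ... | _ , _ , refl = refl

∈-⊗ : ∀ {A B : Set} {xs : List A} {ys : List B} {x y} → x ∈ xs → y ∈ ys → (x , y) ∈ xs ⊗ ys
∈-⊗ p q = ∈-concat⁺′ (∈-map⁺ _ q) (∈-map⁺ _ p)

length-⊗ : ∀ {A B : Set} (xs : List A) (ys : List B) → length (xs ⊗ ys) ≡ length xs * length ys
length-⊗ []       ys = refl
length-⊗ (x ∷ xs) ys = trans (length-++ (map (x ,_) ys)) (cong₂ _+_ (length-map _ ys) (length-⊗ xs ys))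

∏ : {A : Set} → List A → (A → ℕ) → ℕ
∏ []       f = 1
∏ (x ∷ xs) f = f x * ∏ xs f

∏-cong : ∀ {A : Set} (xs : List A) {f g : A → ℕ} → (∀ x → f x ≡ g x) → ∏ xs f ≡ ∏ xs g
∏-cong []       h = refl
∏-cong (x ∷ xs) h = cong₂ _*_ (h x) (∏-cong xs h)

∏-++ : ∀ {A : Set} (xs ys : List A) f → ∏ (xs ++ ys) f ≡ ∏ xs f * ∏ ys f
∏-++ []       ys f = sym (+-identityʳ _)
∏-++ (x ∷ xs) ys f rewrite ∏-++ xs ys f = sym (*-assoc (f x) _ _)

∏-map : ∀ {A B : Set} (h : A → B) xs f → ∏ (map h xs) f ≡ ∏ xs (λ x → f (h x))
∏-map h []       f = refl
∏-map h (x ∷ xs) f = cong (f (h x) *_) (∏-map h xs f)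

∏-⊗ : ∀ {A B : Set} (xs : List A) (ys : List B) f → ∏ (xs ⊗ ys) f ≡ ∏ xs (λ x → ∏ ys (λ y → f (x , y)))
∏-⊗ []       ys f = refl
∏-⊗ (x ∷ xs) ys f = trans (∏-++ (map (x ,_) ys) _ f) (cong₂ _*_ (∏-map _ ys f) (∏-⊗ xs ys f))

∏-* : ∀ {A : Set} (xs : List A) c f → ∏ xs (λ x → c * f x) ≡ c ^ length xs * ∏ xs f
∏-* []       c f = refl
∏-* (x ∷ xs) c f rewrite ∏-* xs c f = l c (f x) (c ^ length xs) (∏ xs f)
  where
  l : ∀ a b c d → a * b * (c * d) ≡ a * c * (b * d)
  l = solve-∀

allV : {A : Set} → List A → ∀ m → List (Vec A m)
allV xs zero    = [] ∷ []
allV xs (suc m) = concatMap (λ x → map (x ∷_) (allV xs m)) xs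

∑-allV : ∀ {A : Set} (xs : List A) {m} f → ∑ (allV xs (suc m)) f ≡ ∑ xs (λ x → ∑ (allV xs m) (λ v → f (x ∷ v)))
∑-allV xs {m} f = trans (∑-concatMap _ xs f) (∑-cong xs (λ x → ∑-map (x ∷_) (allV xs m) f))

length-∑ : ∀ {A : Set} (xs : List A) → length xs ≡ ∑ xs (λ _ → 1)
length-∑ []       = refl
length-∑ (x ∷ xs) = cong suc (length-∑ xs)

∏-tabulate : ∀ {A : Set} {m} (h : Fin m → A) f → ∏ (tabulate h) f ≡ ∏ (allFin m) (λ i → f (h i))
∏-tabulate {m = zero}  h f = refl
∏-tabulate {m = suc m} h f = cong (f (h fz) *_)
  (trans (∏-tabulate (λ i → h (fs i)) f) (sym (∏-tabulate fs (λ i → f (h i)))))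

∏F : ∀ {m} → (Fin m → ℕ) → ℕ
∏F {m} f = ∏ (allFin m) f

∏F-suc : ∀ {m} (f : Fin (suc m) → ℕ) → ∏F f ≡ f fz * ∏F (λ i → f (fs i))
∏F-suc {m} f = cong (f fz *_) (∏-tabulate {m = m} fs f)

-- Distributivity; in terms of probability, the coordinates of a uniform vector are independent.
∑-∏ : ∀ {A : Set} (xs : List A) m (f : Fin m → A → ℕ) →
  ∑ (allV xs m) (λ v → ∏F (λ i → f i (V.lookup v i))) ≡ ∏F (λ i → ∑ xs (f i))
∑-∏ xs zero    f = refl
∑-∏ xs (suc m) f = begin
  ∑ (allV xs (suc m)) (λ v → ∏F (λ i → f i (V.lookup v i)))
    ≡⟨ ∑-allV xs (λ v → ∏F (λ i → f i (V.lookup v i))) ⟩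
  ∑ xs (λ x → ∑ (allV xs m) (λ v → ∏F (λ i → f i (V.lookup (x ∷ v) i))))
    ≡⟨ ∑-cong xs (λ x → trans (∑-cong (allV xs m) (λ v → ∏F-suc (λ i → f i (V.lookup (x ∷ v) i)))) (∑-*ˡ (allV xs m) (f fz x) _)) ⟩
  ∑ xs (λ x → f fz x * ∑ (allV xs m) (λ v → ∏F (λ i → f (fs i) (V.lookup v i))))
    ≡⟨ ∑-*ʳ xs (f fz) _ ⟩
  ∑ xs (f fz) * ∑ (allV xs m) (λ v → ∏F (λ i → f (fs i) (V.lookup v i)))
    ≡⟨ cong (∑ xs (f fz) *_) (∑-∏ xs m (λ i → f (fs i))) ⟩
  ∑ xs (f fz) * ∏F (λ i → ∑ xs (f (fs i)))
    ≡⟨ sym (∏F-suc (λ i → ∑ xs (f i))) ⟩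
  ∏F (λ i → ∑ xs (f i)) ∎
  where open ≡-Reasoning

length-allV : ∀ {A : Set} (xs : List A) m → length (allV xs m) ≡ length xs ^ m
length-allV xs zero    = refl
length-allV xs (suc m) = trans (length-∑ (allV xs (suc m))) (trans (∑-allV xs (λ _ → 1))
  (trans (∑-cong xs (λ x → trans (sym (length-∑ (allV xs m))) (length-allV xs m))) (∑-const xs (length xs ^ m))))

count≤any : ∀ {A : Set} {n} (f : A → Fin n) (u : Fin n) {xs} → Unique xs → (∀ {x y} → f x ≡ f y → x ≡ y) →
  ∑ xs (λ x → 𝟙 (f x == u)) ≤ 𝟙 (anyB (λ x → f x == u) xs)
count≤any f u {[]} us inj = z≤n
count≤any f u {x ∷ xs} (h ∷ us) inj with f x F.≟ u
... | no _ = count≤any f u us inj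
... | yes refl = s≤s (≤-reflexive (trans (∑-cong-∈ xs (λ y m → cong 𝟙 (==-f⁺ (λ e → All.lookup h m (sym (inj e)))))) (∑-zero xs)))

-- Random pairs of owned edges

b2f : Bool → Fin 2
b2f false = fz
b2f true  = fs fz

b2f-inj : ∀ {s t} → b2f s ≡ b2f t → s ≡ t
b2f-inj {false} {false} _ = refl
b2f-inj {true}  {true}  _ = refl

Sides : List Bool
Sides = false ∷ true ∷ []

Choices : ℕ → ℕ → Set
Choices n b = Vec (Vec (Fin b × Fin b) 4) n

pick : ∀ {b} → Bool → Fin b × Fin b → Fin b
pick false = proj₁
pick true  = proj₂

-- Every vertex v owns 8 b edges, split into four blocks p with two sides s of b edges each; a choice selects one edge per side.
module Slots (n d b : ℕ) (h16 : 2 * (8 * b) ≤ d) where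

  -- Targets enter sums over `allGraphs` and must be total; irregular graphs get the dummy target
  -- `v`.
  ownG′ : ∀ (g : Graph n) → isRegular d g ≡ true ⊎ isRegular d g ≡ false → Fin n → Fin (8 * b) → Fin n
  ownG′ g (inj₁ r) v i = Owned.own (owned d g (8 * b) r h16) v i
  ownG′ g (inj₂ _) v i = v

  slot : Fin 4 → Bool → Fin b → Fin (8 * b)
  slot p s j = F.combine (F.combine p (b2f s)) j

  slot-inj : ∀ {p p′ s s′ j j′} → slot p s j ≡ slot p′ s′ j′ → p ≡ p′ × (s ≡ s′ × j ≡ j′)
  slot-inj {p} {p′} {s} {s′} {j} {j′} e with FP.combine-injective (F.combine p (b2f s)) j (F.combine p′ (b2f s′)) j′ e
  ... | e₁ , e₂ with FP.combine-injective p (b2f s) p′ (b2f s′) e₁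
  ... | e₃ , e₄ = e₃ , b2f-inj e₄ , e₂

  tgt : Graph n → Fin n → Fin 4 → Bool → Fin b → Fin n
  tgt g v p s j = ownG′ g (bool? (isRegular d g)) v (slot p s j)

  module _ (g : Graph n) (reg : isRegular d g ≡ true) where

    private
      O : Σ (Owned g (8 * b)) λ o → ∀ v i → ownG′ g (bool? (isRegular d g)) v i ≡ Owned.own o v i
      O with bool? (isRegular d g)
      ... | inj₁ r = owned d g (8 * b) r h16 , (λ v i → refl)
      ... | inj₂ f = ⊥-elim (t≢f reg f)
      open Owned (proj₁ O)

    tgt-adj : ∀ v p s j → adj g v (tgt g v p s j) ≡ true
    tgt-adj v p s j = subst (λ u → adj g v u ≡ true) (sym (proj₂ O v _)) (own-adj v _)

    tgt-inj : ∀ v {p p′ s s′ j j′} → tgt g v p s j ≡ tgt g v p′ s′ j′ → p ≡ p′ × (s ≡ s′ × j ≡ j′)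
    tgt-inj v {p} {p′} {s} {s′} {j} {j′} e = slot-inj {p} {p′} {s} {s′} {j} {j′} (own-inj v (trans (sym (proj₂ O v _)) (trans e (proj₂ O v _))))

    tgt-anti : ∀ {u v p p′ s s′ j j′} → tgt g v p s j ≡ u → tgt g u p′ s′ j′ ≡ v → ⊥
    tgt-anti {u} {v} e e′ = own-anti (trans (sym (proj₂ O v _)) e) (trans (sym (proj₂ O u _)) e′)

  SJ : List (Bool × Fin b)
  SJ = Sides ⊗ allFin b

  SJ-Unique : Unique SJ
  SJ-Unique = ⊗-Unique (((λ ()) ∷ []) ∷ [] ∷ []) (allFin-Unique b)

  hits : Graph n → Fin n × Fin 4 → Fin n → Bool
  hits g (v , p) u = anyB (λ sj → tgt g v p (proj₁ sj) (proj₂ sj) == u) SJ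

  Constraint : Set
  Constraint = (Fin n × Fin 4) × Fin n

  sat : List Constraint → Graph n → Bool
  sat C g = allB (λ c → hits g (proj₁ c) (proj₂ c)) C

  edgesC : List Constraint → List (Edge n)
  edgesC = map (λ c → proj₁ (proj₁ c) , proj₂ c)

  hits⁻ : ∀ g σ u → hits g σ u ≡ true → ∃[ s ] ∃[ j ] (tgt g (proj₁ σ) (proj₂ σ) s j ≡ u)
  hits⁻ g (v , p) u h with anyB-t⁻ (λ sj → tgt g v p (proj₁ sj) (proj₂ sj) == u) SJ h
  ... | (s , j) , _ , e = s , j , ==-t⁻ e

  sat-has : ∀ g → isRegular d g ≡ true → ∀ C → sat C g ≡ true → has (edgesC C) g ≡ true
  sat-has g reg C h = allB-t⁺ _ (edgesC C) λ m → helper (∈-map⁻ _ m)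
    where
    helper : ∀ {e} → ∃[ c ] (c ∈ C × e ≡ (proj₁ (proj₁ c) , proj₂ c)) → adj g (proj₁ e) (proj₂ e) ≡ true
    helper (((v , p) , u) , m , refl) with hits⁻ g (v , p) u (allB-t⁻ _ C h m)
    ... | s , j , refl = tgt-adj g reg v p s j

  -- Different slots of one vertex have different targets, and no edge is owned from both ends;
  -- hence different slots never expose the same edge.
  sat-Distinct : ∀ g → isRegular d g ≡ true → ∀ C → Unique (map proj₁ C) → sat C g ≡ true → Distinct (edgesC C)
  sat-Distinct g reg [] us h = []
  sat-Distinct g reg (((v , p) , u) ∷ C) (f ∷ us) h = fresh ∷ sat-Distinct g reg C us (allB-t⁺ _ C (λ m → allB-t⁻ _ (((v , p) , u) ∷ C) h (there m)))
    where
    fresh : nrm v u ∉ nrms (edgesC C)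
    fresh m with ∈-map⁻ _ m
    ... | _ , m₁ , e with ∈-map⁻ _ m₁
    ... | ((v′ , p′) , u′) , m₂ , refl with hits⁻ g (v , p) u (allB-t⁻ _ (((v , p) , u) ∷ C) h (here refl))
                                          | hits⁻ g (v′ , p′) u′ (allB-t⁻ _ (((v , p) , u) ∷ C) h (there m₂))
                                          | nrm-inj {u = v} {u} {v′} {u′} e
    ... | s , j , t | s′ , j′ , t′ | inj₂ (refl , refl) = tgt-anti g reg {u} {v} {p} {p′} {s} {s′} {j} {j′} t t′
    ... | s , j , t | s′ , j′ , t′ | inj₁ (refl , refl) with tgt-inj g reg v {p} {p′} {s} {s′} {j} {j′} (trans t (sym t′))
    ... | refl , _ = All.lookup f (∈-map⁺ proj₁ m₂) refl

  -- The slots of S are exposed one at a time; pointing into U costs each a factor |U| 2d/n by contain-bound.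
  module Config (S U : Fin n → Bool) (1≤d : 1 ≤ d) (d≤ : d ≤ 32 * b) where

    e : Graph n → Fin n × Fin 4 → ℕ
    e g (v , p) = ∑ SJ (λ sj → 𝟙 (U (tgt g v p (proj₁ sj) (proj₂ sj))))

    -- A slot has b² possible pairs of picks. A factor b is split off: b remains for a slot outside
    -- `S`, and for a slot in `S` the number of its 2b edges that end in `U` bounds the share of
    -- pairs of picks touching `U`.
    wgt : Graph n → Fin n × Fin 4 → ℕ
    wgt g σ = if S (proj₁ σ) then e g σ else b

    ∣U∣ : ℕ
    ∣U∣ = ∑F (λ u → 𝟙 (U u))

    e≤ : ∀ g → isRegular d g ≡ true → ∀ σ → e g σ ≤ ∑F (λ u → 𝟙 (U u) * 𝟙 (hits g σ u))
    e≤ g reg σ@(v , p) = begin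
      e g (v , p)
        ≡⟨ ∑-cong SJ (λ sj → sym (∑F-δ (λ u → 𝟙 (U u)) (t sj))) ⟩
      ∑ SJ (λ sj → ∑F (λ u → 𝟙 (t sj == u) * 𝟙 (U u)))
        ≡⟨ ∑-swap SJ (allFin n) _ ⟩
      ∑F (λ u → ∑ SJ (λ sj → 𝟙 (t sj == u) * 𝟙 (U u)))
        ≡⟨ ∑-cong (allFin n) (λ u → trans (∑-*ʳ SJ _ (𝟙 (U u))) (*-comm _ (𝟙 (U u)))) ⟩
      ∑F (λ u → 𝟙 (U u) * ∑ SJ (λ sj → 𝟙 (t sj == u)))
        ≤⟨ ∑-mono (allFin n) (λ u → *-monoʳ-≤ (𝟙 (U u)) (count≤any t u SJ-Unique t-inj)) ⟩
      ∑F (λ u → 𝟙 (U u) * 𝟙 (hits g σ u)) ∎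
      where
      open ≤-Reasoning
      t : Bool × Fin b → Fin n
      t sj = tgt g v p (proj₁ sj) (proj₂ sj)
      t-inj : ∀ {x y} → t x ≡ t y → x ≡ y
      t-inj {s , j} {s′ , j′} q with tgt-inj g reg v {p} {p} {s} {s′} {j} {j′} q
      ... | _ , e₁ , e₂ = cong₂ _,_ e₁ e₂

    W : List (Fin n × Fin 4) → List Constraint → ℕ
    W L C = ∑ (allGraphs n) (λ g → 𝟙 (isRegular d g ∧ sat C g) * ∏ L (wgt g))

    sL : List (Fin n × Fin 4) → ℕ
    sL L = ∑ L (λ σ → 𝟙 (S (proj₁ σ)))

    N : ℕ
    N = # (isRegular {n} d)

    -- `contain-bound` wants distinct edges, but the edges of `C` are only known to be distinct if
    -- some regular graph satisfies `C`. If none does, the left side vanishes; otherwise the witness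
    -- supplies distinctness.
    base : ∀ C → Unique (map proj₁ C) → 2 * (length C * 2 + δ d) ≤ n * d → n ^ length C * # (λ g → isRegular d g ∧ sat C g) ≤ (64 * b) ^ length C * N
    base C us H with # (λ g → isRegular d g ∧ sat C g) in eq
    ... | zero = ≤-trans (≤-reflexive (*-zeroʳ (n ^ length C))) z≤n
    ... | suc m with ∑>0⇒∃ (allGraphs n) (λ g → isRegular d g ∧ sat C g) (subst (0 <_) (sym eq) (s≤s z≤n))
    ... | g , _ , q with ∧-t⁻ {isRegular d g} q
    ... | reg , st = begin
      n ^ length C * suc m
        ≡⟨ cong (n ^ length C *_) (sym eq) ⟩
      n ^ length C * # (λ g → isRegular d g ∧ sat C g)
        ≤⟨ *-monoʳ-≤ (n ^ length C) (∑-mono-⊆ (allGraphs n) (λ g q → let r , s = ∧-t⁻ {isRegular d g} q in ∧-t⁺ r (sat-has g r C s))) ⟩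
      n ^ length C * containing d (edgesC C)
        ≡⟨ cong (λ r → n ^ r * containing d (edgesC C)) (sym len) ⟩
      n ^ length (edgesC C) * containing d (edgesC C)
        ≤⟨ contain-bound d (edgesC C) 1≤d (sat-Distinct g reg C us st) (subst (λ r → 2 * (r * 2 + δ d) ≤ n * d) (sym len) H) ⟩
      (2 * d) ^ length (edgesC C) * N
        ≡⟨ cong (λ r → (2 * d) ^ r * N) len ⟩
      (2 * d) ^ length C * N
        ≤⟨ *-monoˡ-≤ N (^-monoˡ-≤ (length C) (≤-trans (*-monoʳ-≤ 2 d≤) (≤-reflexive (l b)))) ⟩
      (64 * b) ^ length C * N ∎
      where
      open ≤-Reasoning
      len : length (edgesC C) ≡ length C
      len = length-map _ C
      l : ∀ b → 2 * (32 * b) ≡ 64 * b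
      l = solve-∀

    -- `L` holds the slots still weighted, `C` those already exposed with their targets. A slot of
    -- `S` moves from `L` to `C`, which leaves `length C + sL L`, and with it the exponent of n and
    -- the size condition, unchanged.
    bound : ∀ L C → Unique (map proj₁ C) → Unique L → (∀ {σ} → σ ∈ L → σ ∉ map proj₁ C) →
      2 * ((length C + sL L) * 2 + δ d) ≤ n * d →
      n ^ (length C + sL L) * W L C ≤ b ^ length L * (64 * ∣U∣) ^ sL L * (64 * b) ^ length C * N
    bound [] C us ul dis H = begin
      n ^ (length C + 0) * W [] C
        ≡⟨ cong₂ (λ r w → n ^ r * w) (+-identityʳ (length C)) (∑-cong (allGraphs n) (λ g → *-identityʳ (𝟙 (isRegular d g ∧ sat C g)))) ⟩
      n ^ length C * # (λ g → isRegular d g ∧ sat C g)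
        ≤⟨ base C us (subst (λ r → 2 * (r * 2 + δ d) ≤ n * d) (+-identityʳ (length C)) H) ⟩
      (64 * b) ^ length C * N
        ≡⟨ cong (_* N) (sym (+-identityʳ ((64 * b) ^ length C))) ⟩
      1 * 1 * (64 * b) ^ length C * N ∎
      where open ≤-Reasoning
    bound (σ@(v , p) ∷ L) C us (f ∷ ul) dis H = cases (bool? (S v))
      where
      open ≤-Reasoning
      goal : ℕ → Set
      goal r = n ^ (length C + r) * W (σ ∷ L) C ≤ b ^ length (σ ∷ L) * (64 * ∣U∣) ^ r * (64 * b) ^ length C * N
      W≡ : ∀ {t} → S v ≡ t → W (σ ∷ L) C ≡
             ∑ (allGraphs n) (λ g → 𝟙 (isRegular d g ∧ sat C g) * ((if t then e g σ else b) * ∏ L (wgt g)))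
      W≡ refl = refl
      sL≡ : ∀ {t} → S v ≡ t → sL (σ ∷ L) ≡ 𝟙 t + sL L
      sL≡ refl = refl

      skip : S v ≡ false → 2 * ((length C + sL L) * 2 + δ d) ≤ n * d → goal (sL L)
      skip eq H′ = begin
        n ^ (length C + sL L) * W (σ ∷ L) C
          ≡⟨ cong (n ^ (length C + sL L) *_) (trans (W≡ eq) (trans (∑-cong (allGraphs n) (λ g →
               x∙yz≈y∙xz (𝟙 (isRegular d g ∧ sat C g)) b (∏ L (wgt g)))) (∑-*ˡ (allGraphs n) b _))) ⟩
        n ^ (length C + sL L) * (b * W L C)
          ≡⟨ x∙yz≈y∙xz (n ^ (length C + sL L)) b (W L C) ⟩
        b * (n ^ (length C + sL L) * W L C)
          ≤⟨ *-monoʳ-≤ b (bound L C us ul (λ m → dis (there m)) H′) ⟩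
        b * (b ^ length L * (64 * ∣U∣) ^ sL L * (64 * b) ^ length C * N)
          ≡⟨ l₂ b (b ^ length L) ((64 * ∣U∣) ^ sL L) ((64 * b) ^ length C) N ⟩
        b * b ^ length L * (64 * ∣U∣) ^ sL L * (64 * b) ^ length C * N ∎
        where
        l₂ : ∀ a b c d e → a * (b * c * d * e) ≡ a * b * c * d * e
        l₂ = solve-∀

      pt : ∀ g → 𝟙 (isRegular d g ∧ sat C g) * (e g σ * ∏ L (wgt g))
         ≤ ∑F (λ u → 𝟙 (U u) * (𝟙 (isRegular d g ∧ sat ((σ , u) ∷ C) g) * ∏ L (wgt g)))
      pt g = begin
        𝟙 (R ∧ st) * (e g σ * P)
          ≤⟨ 𝟙-*≤ (λ q → *-monoˡ-≤ P (e≤ g (proj₁ (∧-t⁻ {R} q)) σ)) ⟩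
        𝟙 (R ∧ st) * (∑F (λ u → 𝟙 (U u) * 𝟙 (hits g σ u)) * P)
          ≡⟨ trans (cong (𝟙 (R ∧ st) *_) (sym (∑-*ʳ (allFin n) _ P))) (sym (∑-*ˡ (allFin n) (𝟙 (R ∧ st)) _)) ⟩
        ∑F (λ u → 𝟙 (R ∧ st) * (𝟙 (U u) * 𝟙 (hits g σ u) * P))
          ≡⟨ ∑-cong (allFin n) (λ u → trans (l₄ (𝟙 (R ∧ st)) (𝟙 (U u)) (𝟙 (hits g σ u)) P)
               (cong (λ t → 𝟙 (U u) * (t * P)) (bl R st (hits g σ u)))) ⟩
        ∑F (λ u → 𝟙 (U u) * (𝟙 (R ∧ (if hits g σ u then st else false)) * P)) ∎
        where
        R = isRegular d g
        st = sat C g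
        P = ∏ L (wgt g)
        l₄ : ∀ r u h p → r * (u * h * p) ≡ u * (r * h * p)
        l₄ = solve-∀
        bl : ∀ r s h → 𝟙 (r ∧ s) * 𝟙 h ≡ 𝟙 (r ∧ (if h then s else false))
        bl false s h = refl
        bl true  s true  = *-identityʳ _
        bl true  s false = *-zeroʳ (𝟙 s)

      W≤ : S v ≡ true → W (σ ∷ L) C ≤ ∑F (λ u → 𝟙 (U u) * W L ((σ , u) ∷ C))
      W≤ eq = begin
        W (σ ∷ L) C
          ≡⟨ W≡ eq ⟩
        ∑ (allGraphs n) (λ g → 𝟙 (isRegular d g ∧ sat C g) * (e g σ * ∏ L (wgt g)))
          ≤⟨ ∑-mono (allGraphs n) pt ⟩
        ∑ (allGraphs n) (λ g → ∑F (λ u → 𝟙 (U u) * (𝟙 (isRegular d g ∧ sat ((σ , u) ∷ C) g) * ∏ L (wgt g))))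
          ≡⟨ ∑-swap (allGraphs n) (allFin n) _ ⟩
        ∑F (λ u → ∑ (allGraphs n) (λ g → 𝟙 (U u) * (𝟙 (isRegular d g ∧ sat ((σ , u) ∷ C) g) * ∏ L (wgt g))))
          ≡⟨ ∑-cong (allFin n) (λ u → ∑-*ˡ (allGraphs n) (𝟙 (U u)) _) ⟩
        ∑F (λ u → 𝟙 (U u) * W L ((σ , u) ∷ C)) ∎

      take : S v ≡ true → 2 * ((length C + suc (sL L)) * 2 + δ d) ≤ n * d → goal (suc (sL L))
      take eq H′ = begin
        n ^ (length C + suc (sL L)) * W (σ ∷ L) C
          ≤⟨ *-monoʳ-≤ (n ^ (length C + suc (sL L))) (W≤ eq) ⟩
        n ^ (length C + suc (sL L)) * ∑F (λ u → 𝟙 (U u) * W L ((σ , u) ∷ C))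
          ≡⟨ sym (∑-*ˡ (allFin n) (n ^ (length C + suc (sL L))) _) ⟩
        ∑F (λ u → n ^ (length C + suc (sL L)) * (𝟙 (U u) * W L ((σ , u) ∷ C)))
          ≤⟨ ∑-mono (allFin n) each ⟩
        ∑F (λ u → 𝟙 (U u) * M)
          ≡⟨ ∑-*ʳ (allFin n) (λ u → 𝟙 (U u)) M ⟩
        ∣U∣ * M
          ≡⟨ l₃ ∣U∣ (b ^ length L) ((64 * ∣U∣) ^ sL L) b ((64 * b) ^ length C) N 64 ⟩
        b * b ^ length L * (64 * ∣U∣ * (64 * ∣U∣) ^ sL L) * (64 * b) ^ length C * N ∎
        where
        M = b ^ length L * (64 * ∣U∣) ^ sL L * (64 * b * (64 * b) ^ length C) * N
        l₃ : ∀ u x y b z N k → u * (x * y * (k * b * z) * N) ≡ b * x * (k * u * y) * z * N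
        l₃ = solve-∀
        each : ∀ u → n ^ (length C + suc (sL L)) * (𝟙 (U u) * W L ((σ , u) ∷ C)) ≤ 𝟙 (U u) * M
        each u = ≤-trans (≤-reflexive (x∙yz≈y∙xz (n ^ (length C + suc (sL L))) (𝟙 (U u)) _)) (*-monoʳ-≤ (𝟙 (U u))
          (≤-trans (≤-reflexive (cong (λ r → n ^ r * W L ((σ , u) ∷ C)) (+-suc (length C) (sL L))))
            (bound L ((σ , u) ∷ C) (All.tabulate (λ m e → dis (here refl) (subst (_∈ map proj₁ C) (sym e) m)) ∷ us) ul dis′
              (subst (λ r → 2 * (r * 2 + δ d) ≤ n * d) (+-suc (length C) (sL L)) H′))))
          where
          dis′ : ∀ {σ′} → σ′ ∈ L → σ′ ∉ map proj₁ ((σ , u) ∷ C)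
          dis′ m (here refl) = All.lookup f m refl
          dis′ m (there q)   = dis (there m) q

      cases : S v ≡ true ⊎ S v ≡ false → goal (sL (σ ∷ L))
      cases (inj₁ eq) = subst goal (sym (sL≡ eq)) (take eq (subst (λ r → 2 * ((length C + r) * 2 + δ d) ≤ n * d) (sL≡ eq) H))
      cases (inj₂ eq) = subst goal (sym (sL≡ eq)) (skip eq (subst (λ r → 2 * ((length C + r) * 2 + δ d) ≤ n * d) (sL≡ eq) H))

-- Estimates for powers

-- Bernoulli's inequality (1 - 1/(u+1))^v ≥ 1 - v/(u+1), multiplied out, with `w` for u + 1 - v.
bernoulli : ∀ u v w → v + w ≡ suc u → suc u ^ v * w ≤ suc u * u ^ v
bernoulli u zero    w refl = ≤-reflexive (trans (+-identityʳ _) (sym (*-identityʳ _)))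
bernoulli u (suc v) w e = begin
  suc u * suc u ^ v * w     ≡⟨ xy∙z≈y∙xz (suc u) (suc u ^ v) w ⟩
  suc u ^ v * (suc u * w)   ≤⟨ *-monoʳ-≤ (suc u ^ v) step ⟩
  suc u ^ v * (suc w * u)   ≡⟨ sym (*-assoc (suc u ^ v) (suc w) u) ⟩
  suc u ^ v * suc w * u     ≤⟨ *-monoˡ-≤ u (bernoulli u v (suc w) (trans (+-suc v w) e)) ⟩
  suc u * u ^ v * u         ≡⟨ l₂ (suc u) (u ^ v) u ⟩
  suc u * (u * u ^ v) ∎
  where
  open ≤-Reasoning
  l₂ : ∀ a b c → a * b * c ≡ a * (c * b)
  l₂ = solve-∀
  w≤u : w ≤ u
  w≤u = ≤-trans (m≤n+m w v) (≤-reflexive (suc-injective e))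
  step : suc u * w ≤ suc w * u
  step = ≤-trans (+-monoˡ-≤ (u * w) w≤u) (≤-reflexive (cong (u +_) (*-comm u w)))

half-power : ∀ u v → 2 * v ≤ suc u → suc u ^ v ≤ 2 * u ^ v
half-power u v h = *-cancelʳ-≤ _ _ (suc u) (begin
  suc u ^ v * suc u            ≤⟨ *-monoʳ-≤ (suc u ^ v) big ⟩
  suc u ^ v * (2 * w)          ≡⟨ l₁ (suc u ^ v) w ⟩
  2 * (suc u ^ v * w)          ≤⟨ *-monoʳ-≤ 2 (bernoulli u v w (m+[n∸m]≡n v≤)) ⟩
  2 * (suc u * u ^ v)          ≡⟨ l₂ (suc u) (u ^ v) ⟩
  2 * u ^ v * suc u ∎)
  where
  open ≤-Reasoning
  w = suc u ∸ v
  v≤ : v ≤ suc u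
  v≤ = ≤-trans (m≤m+n v _) h
  big : suc u ≤ 2 * w
  big = +-cancelʳ-≤ (2 * v) _ _ (≤-trans (+-monoʳ-≤ (suc u) h)
    (≤-reflexive (trans (cong (λ t → t + t) (sym (m+[n∸m]≡n v≤))) (l₃ v w))))
    where
    l₃ : ∀ v w → v + w + (v + w) ≡ 2 * w + 2 * v
    l₃ = solve-∀
  l₁ : ∀ a b → a * (2 * b) ≡ 2 * (a * b)
  l₁ = solve-∀
  l₂ : ∀ a b → 2 * (a * b) ≡ 2 * b * a
  l₂ = solve-∀

private
  four : ∀ x → 2 * x * (2 * x) ≡ 4 * (x * x)
  four = solve-∀

even⊎odd : ∀ u → ∃[ h ] (u ≡ h + h ⊎ u ≡ suc (h + h))
even⊎odd zero = 0 , inj₁ refl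
even⊎odd (suc u) with even⊎odd u
... | h , inj₁ refl = h , inj₂ refl
... | h , inj₂ refl = suc h , inj₁ (cong suc (sym (+-suc h h)))

-- A substitute for (1 + 1/u)^u ≤ e: `half-power` reaches exponents up to (u+1)/2 only, so the
-- exponent is halved and each half costs a factor 2. For odd u it is padded to u + 1.
suc-power : ∀ u → suc u ^ u ≤ 4 * u ^ u
suc-power u with even⊎odd u
... | h , inj₁ refl = begin
  suc (h + h) ^ (h + h)                        ≡⟨ ^-distribˡ-+-* (suc (h + h)) h h ⟩
  suc (h + h) ^ h * suc (h + h) ^ h            ≤⟨ *-mono-≤ hp hp ⟩
  2 * (h + h) ^ h * (2 * (h + h) ^ h)          ≡⟨ four ((h + h) ^ h) ⟩
  4 * ((h + h) ^ h * (h + h) ^ h)              ≡⟨ cong (4 *_) (sym (^-distribˡ-+-* (h + h) h h)) ⟩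
  4 * (h + h) ^ (h + h) ∎
  where
  open ≤-Reasoning
  hp = half-power (h + h) h (≤-trans (≤-reflexive (cong (h +_) (+-identityʳ h))) (n≤1+n _))
... | h , inj₂ refl = *-cancelʳ-≤ _ _ (suc v) (begin
  suc v ^ v * suc v             ≡⟨ *-comm (suc v ^ v) (suc v) ⟩
  suc v ^ suc v                 ≡⟨ cong (suc v ^_) sv≡ ⟩
  suc v ^ (suc h + suc h)       ≡⟨ ^-distribˡ-+-* (suc v) (suc h) (suc h) ⟩
  suc v ^ suc h * suc v ^ suc h ≤⟨ *-mono-≤ hp hp ⟩
  2 * v ^ suc h * (2 * v ^ suc h) ≡⟨ four (v ^ suc h) ⟩
  4 * (v ^ suc h * v ^ suc h)   ≡⟨ cong (4 *_) (sym (^-distribˡ-+-* v (suc h) (suc h))) ⟩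
  4 * v ^ (suc h + suc h)       ≡⟨ cong (λ t → 4 * v ^ t) (sym sv≡) ⟩
  4 * (v * v ^ v)               ≤⟨ *-monoʳ-≤ 4 (*-monoˡ-≤ (v ^ v) (n≤1+n v)) ⟩
  4 * (suc v * v ^ v)           ≡⟨ l (suc v) (v ^ v) ⟩
  4 * v ^ v * suc v ∎)
  where
  open ≤-Reasoning
  v = suc (h + h)
  sv≡ : suc v ≡ suc h + suc h
  sv≡ = cong suc (sym (+-suc h h))
  hp = half-power v (suc h) (≤-reflexive (trans (cong (suc h +_) (+-identityʳ (suc h))) (sym sv≡)))
  l : ∀ a b → 4 * (a * b) ≡ 4 * b * a
  l = solve-∀

suc-power≤ : ∀ m r → 1 ≤ m → r ≤ m → suc m ^ r ≤ 4 * m ^ r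
suc-power≤ m@(suc _) r _ r≤m = *-cancelʳ-≤ _ _ (m ^ k) {{m^n≢0 m k}} (begin
  suc m ^ r * m ^ k        ≤⟨ *-monoʳ-≤ (suc m ^ r) (^-monoˡ-≤ k (n≤1+n m)) ⟩
  suc m ^ r * suc m ^ k    ≡⟨ sym (^-distribˡ-+-* (suc m) r k) ⟩
  suc m ^ (r + k)          ≡⟨ cong (suc m ^_) (m+[n∸m]≡n r≤m) ⟩
  suc m ^ m                ≤⟨ suc-power m ⟩
  4 * m ^ m                ≡⟨ cong (λ t → 4 * m ^ t) (sym (m+[n∸m]≡n r≤m)) ⟩
  4 * m ^ (r + k)          ≡⟨ cong (4 *_) (^-distribˡ-+-* m r k) ⟩
  4 * (m ^ r * m ^ k)      ≡⟨ sym (*-assoc 4 (m ^ r) (m ^ k)) ⟩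
  4 * m ^ r * m ^ k ∎)
  where
  open ≤-Reasoning
  k = m ∸ r

-- The analogue of (1 + u/n)^n ≤ e^u: raising the base by one unit costs at most a factor 4.
+-power : ∀ n u → 1 ≤ n → (u + n) ^ n ≤ 4 ^ u * n ^ n
+-power n zero    h = ≤-reflexive (sym (+-identityʳ _))
+-power n (suc u) h = begin
  suc (u + n) ^ n           ≤⟨ suc-power≤ (u + n) n (≤-trans h (m≤n+m n u)) (m≤n+m n u) ⟩
  4 * (u + n) ^ n           ≤⟨ *-monoʳ-≤ 4 (+-power n u h) ⟩
  4 * (4 ^ u * n ^ n)       ≡⟨ sym (*-assoc 4 (4 ^ u) (n ^ n)) ⟩
  4 * 4 ^ u * n ^ n ∎
  where open ≤-Reasoning

*-^ : ∀ k a b → (a * b) ^ k ≡ a ^ k * b ^ k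
*-^ zero    a b = refl
*-^ (suc k) a b rewrite *-^ k a b = l a b (a ^ k) (b ^ k)
  where
  l : ∀ a b c d → a * b * (c * d) ≡ a * c * (b * d)
  l = solve-∀

-- Counting vertex sets

at : ∀ {n} → Vec Bool n → Fin n → Bool
at = V.lookup

∑-tabulate : ∀ {A : Set} {m} (h : Fin m → A) f → ∑ (tabulate h) f ≡ ∑ (allFin m) (λ i → f (h i))
∑-tabulate {m = zero}  h f = refl
∑-tabulate {m = suc m} h f = cong (f (h fz) +_)
  (trans (∑-tabulate (λ i → h (fs i)) f) (sym (∑-tabulate fs (λ i → f (h i)))))

wt-at : ∀ {n} (v : Vec Bool n) → wt v ≡ ∑F (λ i → 𝟙 (at v i))
wt-at []      = refl
wt-at (b ∷ v) = cong (𝟙 b +_) (trans (wt-at v) (sym (∑-tabulate fs (λ i → 𝟙 (at (b ∷ v) i)))))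

wt≤ : ∀ {n} (v : Vec Bool n) → wt v ≤ n
wt≤ []      = z≤n
wt≤ (b ∷ v) = +-mono-≤ (𝟙≤1 b) (wt≤ v)

full : ∀ n → Vec Bool n
full n = V.replicate n true

wt-full : ∀ n → wt (full n) ≡ n
wt-full zero    = refl
wt-full (suc n) = cong suc (wt-full n)

⊆-full : ∀ {n} (v : Vec Bool n) → (v ⊆ᵇ full n) ≡ true
⊆-full []      = refl
⊆-full (true ∷ v)  = ⊆-full v
⊆-full (false ∷ v) = ⊆-full v

-- The familiar bound (en/u)^u on a sum of binomial coefficients, with 4 for e: `subset-count`
-- inside the full set with x = u and y = n.
set-count : ∀ n u → 1 ≤ n → u ≤ n → ∑ (allVecs n) (λ v → 𝟙 (wt v ≤ᵇ u)) * u ^ u ≤ (4 * n) ^ u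
set-count n@(suc _) u h u≤n = *-cancelʳ-≤ _ _ (n ^ n) {{m^n≢0 n n}} (begin
  c * u ^ u * n ^ n                 ≡⟨ *-assoc c (u ^ u) (n ^ n) ⟩
  c * (u ^ u * n ^ n)               ≡⟨ cong₂ (λ s t → s * (u ^ u * n ^ t)) c≡ (sym (wt-full n)) ⟩
  ∑ (allVecs n) (λ v → 𝟙 ((v ⊆ᵇ full n) ∧ (wt v ≤ᵇ u))) * (u ^ u * n ^ wt (full n))
                                    ≤⟨ subset-count (full n) u u n u≤n ⟩
  n ^ u * (u + n) ^ wt (full n)     ≡⟨ cong (λ t → n ^ u * (u + n) ^ t) (wt-full n) ⟩
  n ^ u * (u + n) ^ n               ≤⟨ *-monoʳ-≤ (n ^ u) (+-power n u h) ⟩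
  n ^ u * (4 ^ u * n ^ n)           ≡⟨ l (n ^ u) (4 ^ u) (n ^ n) ⟩
  4 ^ u * n ^ u * n ^ n             ≡⟨ cong (_* n ^ n) (sym (*-^ u 4 n)) ⟩
  (4 * n) ^ u * n ^ n ∎)
  where
  open ≤-Reasoning
  c = ∑ (allVecs n) (λ v → 𝟙 (wt v ≤ᵇ u))
  c≡ : c ≡ ∑ (allVecs n) (λ v → 𝟙 ((v ⊆ᵇ full n) ∧ (wt v ≤ᵇ u)))
  c≡ = ∑-cong (allVecs n) (λ v → cong (λ t → 𝟙 (t ∧ (wt v ≤ᵇ u))) (sym (⊆-full v)))
  l : ∀ a b c → a * (b * c) ≡ b * a * c
  l = solve-∀

subsets : ∀ {n} (U : Vec Bool n) → ∑ (allVecs n) (λ S → 𝟙 (S ⊆ᵇ U)) ≡ 2 ^ wt U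
subsets [] = refl
subsets {suc n} (true ∷ U) = trans (∑-allVecs (λ S → 𝟙 (S ⊆ᵇ (true ∷ U))))
  (trans (cong₂ _+_ (subsets U) (subsets U)) (cong (2 ^ wt U +_) (sym (+-identityʳ _))))
subsets {suc n} (false ∷ U) = trans (∑-allVecs (λ S → 𝟙 (S ⊆ᵇ (false ∷ U))))
  (trans (cong (_+ ∑ (allVecs n) (λ S → 𝟙 (S ⊆ᵇ U))) (∑-zero (allVecs n))) (subsets U))

-- Choosing U before S reduces the cost of S to 2^(3s), the number of subsets of U.
pair-count : ∀ n s → 1 ≤ n → 3 * s ≤ n →
  ∑ (allVecs n) (λ S → ∑ (allVecs n) (λ U → 𝟙 ((S ⊆ᵇ U) ∧ (wt U ≤ᵇ 3 * s)))) * (3 * s) ^ (3 * s) ≤ 2 ^ (3 * s) * (4 * n) ^ (3 * s)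
pair-count n s h 3s≤n = begin
  ∑ X (λ S → ∑ X (λ U → 𝟙 ((S ⊆ᵇ U) ∧ (wt U ≤ᵇ 3 * s)))) * q
    ≡⟨ cong (_* q) (trans (∑-swap X X _) (∑-cong X (λ U → trans (∑-cong X (λ S → 𝟙-∧ (S ⊆ᵇ U) _)) (∑-*ʳ X _ _)))) ⟩
  ∑ X (λ U → ∑ X (λ S → 𝟙 (S ⊆ᵇ U)) * 𝟙 (wt U ≤ᵇ 3 * s)) * q
    ≤⟨ *-monoˡ-≤ q (∑-mono X (λ U → ≤-trans (≤-reflexive (trans (cong (_* 𝟙 (wt U ≤ᵇ 3 * s)) (subsets U)) (*-comm (2 ^ wt U) _)))
         (≤-trans (𝟙-*≤ (λ e → ^-monoʳ-≤ 2 (≤ᵇ-t⁻ (wt U) (3 * s) e))) (≤-reflexive (*-comm (𝟙 (wt U ≤ᵇ 3 * s)) _))))) ⟩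
  ∑ X (λ U → 2 ^ (3 * s) * 𝟙 (wt U ≤ᵇ 3 * s)) * q
    ≡⟨ trans (cong (_* q) (∑-*ˡ X (2 ^ (3 * s)) _)) (*-assoc (2 ^ (3 * s)) _ q) ⟩
  2 ^ (3 * s) * (∑ X (λ U → 𝟙 (wt U ≤ᵇ 3 * s)) * q)
    ≤⟨ *-monoʳ-≤ (2 ^ (3 * s)) (set-count n (3 * s) h 3s≤n) ⟩
  2 ^ (3 * s) * (4 * n) ^ (3 * s) ∎
  where
  open ≤-Reasoning
  X = allVecs n
  q = (3 * s) ^ (3 * s)

-- Union bound over the sets that violate expansion

∏-allB : ∀ {A : Set} (p : A → Bool) (f : A → ℕ) xs → (∀ x → 𝟙 (p x) ≤ f x) → 𝟙 (allB p xs) ≤ ∏ xs f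
∏-allB p f []       h = s≤s z≤n
∏-allB p f (x ∷ xs) h with p x | h x
... | true  | q = ≤-trans (≤-reflexive (sym (+-identityʳ _))) (*-mono-≤ q (∏-allB p f xs h))
... | false | q = z≤n

-- Denominators are cleared; the K on the left is what makes the induction go through.
geometric : ∀ r n K (y : ℕ → ℕ) → (∀ i → n * 2 ^ suc i * y i ≤ K) → ∑ (downFrom r) y * n * 2 ^ r + K ≤ K * 2 ^ r
geometric zero    n K y h = ≤-reflexive (sym (*-identityʳ K))
geometric (suc r) n K y h = begin
  (y r + Y) * n * (2 * 2 ^ r) + K          ≡⟨ l₁ (y r) Y n (2 ^ r) K ⟩
  n * (2 * 2 ^ r) * y r + (2 * (Y * n * 2 ^ r) + K) ≤⟨ +-monoˡ-≤ _ (h r) ⟩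
  K + (2 * (Y * n * 2 ^ r) + K)            ≡⟨ l₂ (Y * n * 2 ^ r) K ⟩
  2 * (Y * n * 2 ^ r + K)                  ≤⟨ *-monoʳ-≤ 2 (geometric r n K y h) ⟩
  2 * (K * 2 ^ r)                          ≡⟨ l₃ K (2 ^ r) ⟩
  K * (2 * 2 ^ r) ∎
  where
  open ≤-Reasoning
  Y = ∑ (downFrom r) y
  l₁ : ∀ y Y n p K → (y + Y) * n * (2 * p) + K ≡ n * (2 * p) * y + (2 * (Y * n * p) + K)
  l₁ = solve-∀
  l₂ : ∀ a K → K + (2 * a + K) ≡ 2 * (a + K)
  l₂ = solve-∀
  l₃ : ∀ K p → 2 * (K * p) ≡ K * (2 * p)
  l₃ = solve-∀

s≤2^s : ∀ s → s ≤ 2 ^ s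
s≤2^s zero    = z≤n
s≤2^s (suc s) = ≤-trans (+-mono-≤ (m^n>0 2 s) (s≤2^s s)) (≤-reflexive (cong (2 ^ s +_) (sym (+-identityʳ _))))

-- Why (Cs/n)^s is at most 4C/(n 2^s): one factor Cs/n supplies 1/n, and the other s - 1 are at most
-- 1/4 each, which absorbs both s ≤ 2^s and 2^s.
small-term : ∀ n C s y T → 1 ≤ n → 1 ≤ s → 4 * C * s ≤ n → n ^ s * y ≤ (C * s) ^ s * T → n * 2 ^ s * y ≤ 4 * C * T
small-term n@(suc _) C s@(suc r) y T _ _ h H = *-cancelʳ-≤ _ _ (2 ^ s * n ^ r) {{m*n≢0 (2 ^ s) (n ^ r) {{m^n≢0 2 s}} {{m^n≢0 n r}}}} (begin
  n * 2 ^ s * y * (2 ^ s * n ^ r)              ≡⟨ l₁ n (2 ^ s) y (n ^ r) ⟩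
  2 ^ s * 2 ^ s * (n ^ s * y)                  ≤⟨ *-monoʳ-≤ (2 ^ s * 2 ^ s) H ⟩
  2 ^ s * 2 ^ s * ((C * s) ^ s * T)            ≡⟨ l₂ (2 ^ r) (C * s) ((C * s) ^ r) T ⟩
  4 * (C * s) * T * ((2 ^ r * 2 ^ r) * (C * s) ^ r) ≡⟨ cong (λ t → 4 * (C * s) * T * t) pw ⟩
  4 * (C * s) * T * (4 * C * s) ^ r            ≤⟨ *-mono-≤ (*-monoˡ-≤ T (*-monoʳ-≤ 4 (*-monoʳ-≤ C (s≤2^s s)))) (^-monoˡ-≤ r h) ⟩
  4 * (C * 2 ^ s) * T * n ^ r                  ≡⟨ l₃ C (2 ^ s) T (n ^ r) ⟩
  4 * C * T * (2 ^ s * n ^ r) ∎)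
  where
  open ≤-Reasoning
  l₁ : ∀ n p y q → n * p * y * (p * q) ≡ p * p * (n * q * y)
  l₁ = solve-∀
  l₂ : ∀ p c q T → 2 * p * (2 * p) * (c * q * T) ≡ 4 * c * T * ((p * p) * q)
  l₂ = solve-∀
  l₃ : ∀ C p T q → 4 * (C * p) * T * q ≡ 4 * C * T * (p * q)
  l₃ = solve-∀
  pw : (2 ^ r * 2 ^ r) * (C * s) ^ r ≡ (4 * C * s) ^ r
  pw = trans (cong (_* (C * s) ^ r) (sym (*-^ r 2 2))) (trans (sym (*-^ r 4 (C * s))) (cong (_^ r) (sym (*-assoc 4 C s))))

const-eq′ : ∀ e f k t n s →
  e * (e * (e * 1)) * ((f * n) * ((f * n) * ((f * n) * 1))) * ((k * (t * s)) * ((k * (t * s)) * ((k * (t * s)) * ((k * (t * s)) * 1))))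
  ≡ n * (n * (n * 1)) * ((t * s) * ((t * s) * ((t * s) * 1))) * ((e * e * e * (f * f * f) * (k * k * k * k) * t) * s)
const-eq′ = solve-∀

-- Powers appear unfolded, as `_^_` computes at numerals, and the numerals 2, 4, 64, 3 are
-- variables, which keeps the large constant symbolic.
const-eq : ∀ e f k t n s C → C ≡ e * e * e * (f * f * f) * (k * k * k * k) * t →
  e * (e * (e * 1)) * ((f * n) * ((f * n) * ((f * n) * 1))) * ((k * (t * s)) * ((k * (t * s)) * ((k * (t * s)) * ((k * (t * s)) * 1))))
  ≡ n * (n * (n * 1)) * ((t * s) * ((t * s) * ((t * s) * 1))) * (C * s)
const-eq e f k t n s _ refl = const-eq′ e f k t n s

module Expansion (n d b : ℕ) (h16 : 2 * (8 * b) ≤ d) (1≤d : 1 ≤ d) (d≤ : d ≤ 32 * b)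
                 (C : ℕ) (hC : C ≡ 2 * 2 * 2 * (4 * 4 * 4) * (64 * 64 * 64 * 64) * 3) (n≥ : 8 * d + 8 ≤ n) where

  open Slots n d b h16

  XX : List (Fin b × Fin b)
  XX = allFin b ⊗ allFin b

  Π : List (Choices n b)
  Π = allV (allV XX 4) n

  L : List (Fin n × Fin 4)
  L = allFin n ⊗ allFin 4

  mate : Graph n → Choices n b → Fin n × Fin 4 → Bool → Fin n
  mate g π (v , p) s = tgt g v p s (pick s (V.lookup (V.lookup π v) p))

  -- In the game it is not Maker's decision which edge of a pair he gets. So expansion of S out of U
  -- is endangered as soon as each pair at S has at least one mate in U.
  bad : Graph n → Choices n b → Vec Bool n → Vec Bool n → Bool
  bad g π S U = allB (λ σ → not (at S (proj₁ σ)) ∨ (at U (mate g π σ false) ∨ at U (mate g π σ true))) L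

  N : ℕ
  N = # (isRegular {n} d)

  G : List (Graph n)
  G = allGraphs n

  n>0 : 1 ≤ n
  n>0 = ≤-trans (s≤s z≤n) (≤-trans (m≤n+m 8 (8 * d)) n≥)

  length-L : length L ≡ n * 4
  length-L = trans (length-⊗ (allFin n) (allFin 4)) (cong (_* 4) (length-allFin n))

  length-Π : length Π ≡ b ^ length L * b ^ length L
  length-Π = begin
    length Π             ≡⟨ trans (length-allV (allV XX 4) n) (cong (_^ n) (length-allV XX 4)) ⟩
    (length XX ^ 4) ^ n  ≡⟨ ^-*-assoc (length XX) 4 n ⟩
    length XX ^ (4 * n)  ≡⟨ cong₂ _^_ (trans (length-⊗ (allFin b) (allFin b)) (cong₂ _*_ (length-allFin b) (length-allFin b))) (*-comm 4 n) ⟩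
    (b * b) ^ (n * 4)    ≡⟨ trans (cong ((b * b) ^_) (sym length-L)) (*-^ (length L) b b) ⟩
    b ^ length L * b ^ length L ∎
    where open ≡-Reasoning

  module _ (S U : Vec Bool n) where
    open Config (at S) (at U) 1≤d d≤ hiding (N)

    φ : Graph n → Fin n → Fin 4 → Fin b × Fin b → ℕ
    φ g v p x = if at S v then 𝟙 (at U (tgt g v p false (proj₁ x))) + 𝟙 (at U (tgt g v p true (proj₂ x))) else 1

    ∑φ : ∀ g v p → ∑ XX (φ g v p) ≡ b * wgt g (v , p)
    ∑φ g v p with at S v
    ... | false = trans (∑-const XX 1) (trans (*-identityʳ _) (trans (length-⊗ (allFin b) (allFin b)) (cong₂ _*_ (length-allFin b) (length-allFin b))))
    ... | true = begin
      ∑ XX (λ x → u false (proj₁ x) + u true (proj₂ x))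
        ≡⟨ ∑-⊗ (allFin b) (allFin b) _ ⟩
      ∑F (λ i → ∑F (λ j → u false i + u true j))
        ≡⟨ trans (∑-cong (allFin b) (λ i → ∑-+ (allFin b) (λ _ → u false i) (u true))) (∑-+ (allFin b) _ _) ⟩
      ∑F (λ i → ∑F {b} (λ _ → u false i)) + ∑F {b} (λ _ → ∑F (u true))
        ≡⟨ cong₂ _+_ (trans (∑-cong (allFin b) (λ i → ∑F-const {b} (u false i))) (∑-*ˡ (allFin b) b (u false))) (∑F-const {b} _) ⟩
      b * ∑F (u false) + b * ∑F (u true)
        ≡⟨ sym (*-distribˡ-+ b (∑F (u false)) _) ⟩
      b * (∑F (u false) + ∑F (u true))
        ≡⟨ cong (b *_) (sym (trans (∑-⊗ Sides (allFin b) _) (cong (∑F (u false) +_) (+-identityʳ _)))) ⟩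
      b * e g (v , p) ∎
      where
      open ≡-Reasoning
      u : Bool → Fin b → ℕ
      u s j = 𝟙 (at U (tgt g v p s j))

    -- For fixed `g` the slots are independent, so the sum over choices factors; within a slot of S
    -- the event "one of two mates in U" is bounded by the sum of both, which gives b times `wgt`.
    bad≤ : ∀ g → ∑ Π (λ π → 𝟙 (bad g π S U)) ≤ b ^ length L * ∏ L (wgt g)
    bad≤ g = begin
      ∑ Π (λ π → 𝟙 (bad g π S U))
        ≤⟨ ∑-mono Π (λ π → ∏-allB _ (λ σ → φ g (proj₁ σ) (proj₂ σ) (V.lookup (V.lookup π (proj₁ σ)) (proj₂ σ))) L (λ { (v , p) → pt (at S v) (at U _) (at U _) })) ⟩
      ∑ Π (λ π → ∏ L (λ σ → φ g (proj₁ σ) (proj₂ σ) (V.lookup (V.lookup π (proj₁ σ)) (proj₂ σ))))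
        ≡⟨ ∑-cong Π (λ π → ∏-⊗ (allFin n) (allFin 4) _) ⟩
      ∑ Π (λ π → ∏F (λ v → ∏F (λ p → φ g v p (V.lookup (V.lookup π v) p))))
        ≡⟨ ∑-∏ (allV XX 4) n (λ v w → ∏F (λ p → φ g v p (V.lookup w p))) ⟩
      ∏F (λ v → ∑ (allV XX 4) (λ w → ∏F (λ p → φ g v p (V.lookup w p))))
        ≡⟨ ∏-cong (allFin n) (λ v → trans (∑-∏ XX 4 (φ g v)) (∏-cong (allFin 4) (∑φ g v))) ⟩
      ∏F (λ v → ∏F (λ p → b * wgt g (v , p)))
        ≡⟨ sym (∏-⊗ (allFin n) (allFin 4) _) ⟩
      ∏ L (λ σ → b * wgt g σ)
        ≡⟨ ∏-* L b (wgt g) ⟩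
      b ^ length L * ∏ L (wgt g) ∎
      where
      open ≤-Reasoning
      pt : ∀ s x y → 𝟙 (not s ∨ (x ∨ y)) ≤ (if s then 𝟙 x + 𝟙 y else 1)
      pt false x     y     = s≤s z≤n
      pt true  true  y     = s≤s z≤n
      pt true  false true  = s≤s z≤n
      pt true  false false = z≤n

    X : ℕ
    X = ∑ G (λ g → ∑ Π (λ π → 𝟙 (isRegular d g ∧ bad g π S U)))

    sL≡ : sL L ≡ 4 * wt S
    sL≡ = trans (∑-⊗ (allFin n) (allFin 4) _) (trans (∑-cong (allFin n) (λ v → ∑F-const {4} (𝟙 (at S v))))
      (trans (∑-*ˡ (allFin n) 4 _) (cong (4 *_) (sym (wt-at S)))))

    X-bound : 2 * (4 * wt S * 2 + δ d) ≤ n * d → n ^ (4 * wt S) * X ≤ length Π * (64 * wt U) ^ (4 * wt S) * N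
    X-bound H = begin
      n ^ (4 * wt S) * X
        ≤⟨ *-monoʳ-≤ (n ^ (4 * wt S)) X≤ ⟩
      n ^ (4 * wt S) * (b ^ length L * W L [])
        ≡⟨ x∙yz≈y∙xz (n ^ (4 * wt S)) (b ^ length L) (W L []) ⟩
      b ^ length L * (n ^ (4 * wt S) * W L [])
        ≤⟨ *-monoʳ-≤ (b ^ length L) (subst₂ (λ r u → n ^ r * W L [] ≤ b ^ length L * (64 * u) ^ r * 1 * N) sL≡ (sym (wt-at U))
             (bound L [] [] (⊗-Unique (allFin-Unique n) (allFin-Unique 4)) (λ _ ()) (subst (λ r → 2 * (r * 2 + δ d) ≤ n * d) (sym sL≡) H))) ⟩
      b ^ length L * (b ^ length L * (64 * wt U) ^ (4 * wt S) * 1 * N)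
        ≡⟨ trans (l₂ (b ^ length L) ((64 * wt U) ^ (4 * wt S)) N) (cong (λ t → t * (64 * wt U) ^ (4 * wt S) * N) (sym length-Π)) ⟩
      length Π * (64 * wt U) ^ (4 * wt S) * N ∎
      where
      open ≤-Reasoning
      l₂ : ∀ a b c → a * (a * b * 1 * c) ≡ a * a * b * c
      l₂ = solve-∀
      X≤ : X ≤ b ^ length L * W L []
      X≤ = begin
        X ≡⟨ ∑-cong G (λ g → trans (∑-cong Π (λ π → 𝟙-∧ (isRegular d g) _)) (∑-*ˡ Π (𝟙 (isRegular d g)) _)) ⟩
        ∑ G (λ g → 𝟙 (isRegular d g) * ∑ Π (λ π → 𝟙 (bad g π S U)))
          ≤⟨ ∑-mono G (λ g → *-monoʳ-≤ (𝟙 (isRegular d g)) (bad≤ g)) ⟩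
        ∑ G (λ g → 𝟙 (isRegular d g) * (b ^ length L * ∏ L (wgt g)))
          ≡⟨ ∑-cong G (λ g → trans (x∙yz≈y∙xz (𝟙 (isRegular d g)) (b ^ length L) (∏ L (wgt g)))
               (cong (λ t → b ^ length L * (𝟙 t * ∏ L (wgt g))) (sym (∧-identityʳ (isRegular d g))))) ⟩
        ∑ G (λ g → b ^ length L * (𝟙 (isRegular d g ∧ true) * ∏ L (wgt g)))
          ≡⟨ ∑-*ˡ G (b ^ length L) _ ⟩
        b ^ length L * W L [] ∎

  VS : List (Vec Bool n)
  VS = allVecs n

  T′ : ℕ
  T′ = length Π * N

  cond : ℕ → Vec Bool n → Vec Bool n → Bool
  cond s S U = (wt S ≡ᵇ s) ∧ ((S ⊆ᵇ U) ∧ (wt U ≤ᵇ 3 * s))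

  Y : ℕ → ℕ
  Y s = ∑ VS (λ S → ∑ VS (λ U → 𝟙 (cond s S U) * X S U))

  room : ∀ s → 4 * C * s ≤ n → 32 * s ≤ n
  room s h = ≤-trans (*-monoˡ-≤ s (≤-trans (≤ᵇ-t⁻ 32 (4 * (2 * 2 * 2 * (4 * 4 * 4) * (64 * 64 * 64 * 64) * 3)) refl) (≤-reflexive (cong (4 *_) (sym hC))))) h

  room-d : ∀ s → 32 * s ≤ n → 2 * (4 * s * 2 + δ d) ≤ n * d
  room-d s h = *-cancelˡ-≤ 2 (begin
    2 * (2 * (4 * s * 2 + δ d))        ≡⟨ l₁ s d ⟩
    32 * s + d * (8 * d + 8)           ≤⟨ +-mono-≤ (≤-trans h (≤-trans (≤-reflexive (sym (*-identityʳ n))) (*-monoʳ-≤ n 1≤d))) (*-monoʳ-≤ d n≥) ⟩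
    n * d + d * n                      ≡⟨ l₂ n d ⟩
    2 * (n * d) ∎)
    where
    open ≤-Reasoning
    l₁ : ∀ s d → 2 * (2 * (4 * s * 2 + (d * d + d * d + (1 * d + 1 * d)))) ≡ 32 * s + d * (8 * d + 8)
    l₁ = solve-∀
    l₂ : ∀ n d → n * d + d * n ≡ 2 * (n * d)
    l₂ = solve-∀

  Y-raw : ∀ s → 32 * s ≤ n → n ^ (4 * s) * (3 * s) ^ (3 * s) * Y s ≤ 2 ^ (3 * s) * (4 * n) ^ (3 * s) * (64 * (3 * s)) ^ (4 * s) * T′
  Y-raw s h = begin
    n ^ (4 * s) * q * Y s
      ≡⟨ xy∙z≈xz∙y (n ^ (4 * s)) q (Y s) ⟩
    n ^ (4 * s) * Y s * q
      ≡⟨ cong (_* q) (trans (sym (∑-*ˡ VS (n ^ (4 * s)) _)) (∑-cong VS (λ S → sym (∑-*ˡ VS (n ^ (4 * s)) _)))) ⟩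
    ∑ VS (λ S → ∑ VS (λ U → n ^ (4 * s) * (𝟙 (cond s S U) * X S U))) * q
      ≤⟨ *-monoˡ-≤ q (∑-mono VS (λ S → ∑-mono VS (λ U → pt S U))) ⟩
    ∑ VS (λ S → ∑ VS (λ U → 𝟙 ((S ⊆ᵇ U) ∧ (wt U ≤ᵇ 3 * s)) * M)) * q
      ≡⟨ cong (_* q) (trans (∑-cong VS (λ S → ∑-*ʳ VS _ M)) (∑-*ʳ VS _ M)) ⟩
    ∑ VS (λ S → ∑ VS (λ U → 𝟙 ((S ⊆ᵇ U) ∧ (wt U ≤ᵇ 3 * s)))) * M * q
      ≡⟨ xy∙z≈xz∙y (∑ VS (λ S → ∑ VS (λ U → 𝟙 ((S ⊆ᵇ U) ∧ (wt U ≤ᵇ 3 * s))))) M q ⟩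
    ∑ VS (λ S → ∑ VS (λ U → 𝟙 ((S ⊆ᵇ U) ∧ (wt U ≤ᵇ 3 * s)))) * q * M
      ≤⟨ *-monoˡ-≤ M (pair-count n s n>0 (≤-trans (*-monoˡ-≤ s (≤ᵇ-t⁻ 3 32 refl)) h)) ⟩
    2 ^ (3 * s) * (4 * n) ^ (3 * s) * M
      ≡⟨ l₃ (2 ^ (3 * s) * (4 * n) ^ (3 * s)) (length Π) ((64 * (3 * s)) ^ (4 * s)) N ⟩
    2 ^ (3 * s) * (4 * n) ^ (3 * s) * (64 * (3 * s)) ^ (4 * s) * T′ ∎
    where
    open ≤-Reasoning
    q = (3 * s) ^ (3 * s)
    M = length Π * (64 * (3 * s)) ^ (4 * s) * N
    l₃ : ∀ a b c d → a * (b * c * d) ≡ a * c * (b * d)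
    l₃ = solve-∀
    pt : ∀ S U → n ^ (4 * s) * (𝟙 (cond s S U) * X S U) ≤ 𝟙 ((S ⊆ᵇ U) ∧ (wt U ≤ᵇ 3 * s)) * M
    pt S U = begin
      n ^ (4 * s) * (𝟙 (cond s S U) * X S U)  ≡⟨ x∙yz≈y∙xz (n ^ (4 * s)) (𝟙 (cond s S U)) (X S U) ⟩
      𝟙 (cond s S U) * (n ^ (4 * s) * X S U)  ≤⟨ 𝟙-*≤ one ⟩
      𝟙 (cond s S U) * M                      ≤⟨ *-monoˡ-≤ M (𝟙-mono (λ c → proj₂ (∧-t⁻ {wt S ≡ᵇ s} c))) ⟩
      𝟙 ((S ⊆ᵇ U) ∧ (wt U ≤ᵇ 3 * s)) * M ∎
      where
      one : cond s S U ≡ true → n ^ (4 * s) * X S U ≤ M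
      one c with ∧-t⁻ {wt S ≡ᵇ s} c
      ... | c₁ , c₂ with ≡ᵇ-t⁻ (wt S) s c₁
      ... | refl = ≤-trans (X-bound S U (room-d s h)) (*-monoˡ-≤ N (*-monoʳ-≤ (length Π)
        (^-monoˡ-≤ (4 * s) (*-monoʳ-≤ 64 (≤ᵇ-t⁻ (wt U) (3 * s) (proj₂ (∧-t⁻ {S ⊆ᵇ U} c₂)))))))

  -- Four pairs per vertex pay off here: 4s factors of order s/n against 3s factors of order n/s for
  -- the choice of U leave a surplus (s/n)^s. The common part `Z` is cancelled.
  Y-bound : ∀ s → 1 ≤ s → 32 * s ≤ n → n ^ s * Y s ≤ (C * s) ^ s * T′
  Y-bound s 1≤s h = *-cancelʳ-≤ _ _ (Z ^ s) {{m^n≢0 Z s {{Z≢0}}}} (begin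
    n ^ s * Y s * Z ^ s
      ≡⟨ trans (xy∙z≈xz∙y (n ^ s) (Y s) (Z ^ s)) (cong (_* Y s) (trans (sym (*-^ s n Z)) (trans (cong (_^ s) (l₂ n ((3 * s) ^ 3))) (*-^ s (n ^ 4) ((3 * s) ^ 3))))) ⟩
    (n ^ 4) ^ s * ((3 * s) ^ 3) ^ s * Y s
      ≡⟨ cong₂ (λ a c → a * c * Y s) (^-*-assoc n 4 s) (^-*-assoc (3 * s) 3 s) ⟩
    n ^ (4 * s) * (3 * s) ^ (3 * s) * Y s
      ≤⟨ Y-raw s h ⟩
    2 ^ (3 * s) * (4 * n) ^ (3 * s) * (64 * (3 * s)) ^ (4 * s) * T′
      ≡⟨ cong (_* T′) (cong₂ _*_ (cong₂ _*_ (sym (^-*-assoc 2 3 s)) (sym (^-*-assoc (4 * n) 3 s))) (sym (^-*-assoc (64 * (3 * s)) 4 s))) ⟩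
    (2 ^ 3) ^ s * ((4 * n) ^ 3) ^ s * ((64 * (3 * s)) ^ 4) ^ s * T′
      ≡⟨ cong (_* T′) (trans (cong (_* ((64 * (3 * s)) ^ 4) ^ s) (sym (*-^ s (2 ^ 3) ((4 * n) ^ 3)))) (sym (*-^ s (2 ^ 3 * (4 * n) ^ 3) ((64 * (3 * s)) ^ 4)))) ⟩
    (2 ^ 3 * (4 * n) ^ 3 * (64 * (3 * s)) ^ 4) ^ s * T′
      ≡⟨ cong (λ t → t ^ s * T′) (const-eq 2 4 64 3 n s C hC) ⟩
    (Z * (C * s)) ^ s * T′
      ≡⟨ trans (cong (_* T′) (*-^ s Z (C * s))) (l₃ (Z ^ s) ((C * s) ^ s) T′) ⟩
    (C * s) ^ s * T′ * Z ^ s ∎)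
    where
    open ≤-Reasoning
    Z = n ^ 3 * (3 * s) ^ 3
    Z≢0 : NonZero Z
    Z≢0 = m*n≢0 (n ^ 3) ((3 * s) ^ 3) {{m^n≢0 n 3 {{>-nonZero n>0}}}} {{m^n≢0 (3 * s) 3 {{m*n≢0 3 s {{_}} {{>-nonZero 1≤s}}}}}}
    l₂ : ∀ n q → n * (n * (n * (n * 1)) * q) ≡ n * (n * (n * (n * 1))) * q
    l₂ = solve-∀
    l₃ : ∀ a b c → a * b * c ≡ b * c * a
    l₃ = solve-∀

  violates : Graph n → Choices n b → Vec Bool n × Vec Bool n → Bool
  violates g π (S , U) = ((1 ≤ᵇ wt S) ∧ (4 * C * wt S ≤ᵇ n)) ∧ (((S ⊆ᵇ U) ∧ (wt U ≤ᵇ 3 * wt S)) ∧ bad g π S U)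

  isBad : Graph n → Choices n b → Bool
  isBad g π = anyB (violates g π) (VS ⊗ VS)

  allBad : Graph n → Bool
  allBad g = allB (isBad g) Π

  -- The index is shifted by one because only nonempty sets count; the indicator restricts to the
  -- sizes for which expansion is claimed.
  y : ℕ → ℕ
  y i = 𝟙 (4 * C * suc i ≤ᵇ n) * Y (suc i)

  y-bound : ∀ i → n * 2 ^ suc i * y i ≤ 4 * C * T′
  y-bound i with 4 * C * suc i ≤ᵇ n in eq
  ... | false = ≤-trans (≤-reflexive (*-zeroʳ (n * 2 ^ suc i))) z≤n
  ... | true  = ≤-trans (≤-reflexive (cong (n * 2 ^ suc i *_) (+-identityʳ (Y (suc i)))))
    (small-term n C (suc i) (Y (suc i)) T′ n>0 (s≤s z≤n) h (Y-bound (suc i) (s≤s z≤n) (room (suc i) h)))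
    where h = ≤ᵇ-t⁻ (4 * C * suc i) n eq

  total : ∑ G (λ g → ∑ Π (λ π → 𝟙 (isRegular d g ∧ isBad g π))) ≤ ∑ (downFrom n) y
  total = begin
    ∑ G (λ g → ∑ Π (λ π → 𝟙 (isRegular d g ∧ isBad g π)))
      ≤⟨ ∑-mono G (λ g → ∑-mono Π (λ π → pt g π)) ⟩
    ∑ G (λ g → ∑ Π (λ π → ∑ D (λ i → ∑ VS (λ S → ∑ VS (λ U → w i S U * r g π S U)))))
      ≡⟨ ∑-cong G (λ g → trans (∑-swap Π D _) (∑-cong D (λ i → trans (∑-swap Π VS _) (∑-cong VS (λ S → ∑-swap Π VS _))))) ⟩
    ∑ G (λ g → ∑ D (λ i → ∑ VS (λ S → ∑ VS (λ U → ∑ Π (λ π → w i S U * r g π S U)))))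
      ≡⟨ trans (∑-swap G D _) (∑-cong D (λ i → trans (∑-swap G VS _) (∑-cong VS (λ S → ∑-swap G VS _)))) ⟩
    ∑ D (λ i → ∑ VS (λ S → ∑ VS (λ U → ∑ G (λ g → ∑ Π (λ π → w i S U * r g π S U)))))
      ≡⟨ ∑-cong D (λ i → trans (∑-cong VS (λ S → trans (∑-cong VS (λ U → trans (trans (∑-cong G (λ g → ∑-*ˡ Π (w i S U) _)) (∑-*ˡ G (w i S U) _))
           (*-assoc (𝟙 (4 * C * suc i ≤ᵇ n)) (𝟙 (cond (suc i) S U)) (X S U)))) (∑-*ˡ VS (𝟙 (4 * C * suc i ≤ᵇ n)) _))) (∑-*ˡ VS (𝟙 (4 * C * suc i ≤ᵇ n)) _)) ⟩
    ∑ (downFrom n) y ∎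
    where
    open ≤-Reasoning
    D = downFrom n
    w : ℕ → Vec Bool n → Vec Bool n → ℕ
    w i S U = 𝟙 (4 * C * suc i ≤ᵇ n) * 𝟙 (cond (suc i) S U)
    r : Graph n → Choices n b → Vec Bool n → Vec Bool n → ℕ
    r g π S U = 𝟙 (isRegular d g ∧ bad g π S U)
    pt : ∀ g π → 𝟙 (isRegular d g ∧ isBad g π) ≤ ∑ D (λ i → ∑ VS (λ S → ∑ VS (λ U → w i S U * r g π S U)))
    pt g π = 𝟙-bound λ q → let reg , ib = ∧-t⁻ {isRegular d g} q
                               (S , U) , _ , v = anyB-t⁻ (violates g π) (VS ⊗ VS) ib
                           in term reg S U v
      where
      term : isRegular d g ≡ true → ∀ S U → violates g π (S , U) ≡ true → 1 ≤ ∑ D (λ i → ∑ VS (λ S → ∑ VS (λ U → w i S U * r g π S U)))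
      term reg S U v with ∧-t⁻ {(1 ≤ᵇ wt S) ∧ (4 * C * wt S ≤ᵇ n)} v
      ... | v₁ , v₂ with ∧-t⁻ {1 ≤ᵇ wt S} v₁ | ∧-t⁻ {(S ⊆ᵇ U) ∧ (wt U ≤ᵇ 3 * wt S)} v₂
      ... | v₃ , v₄ | v₅ , v₆ = go (wt S) refl (≤ᵇ-t⁻ 1 (wt S) v₃)
        where
        go : ∀ s → wt S ≡ s → 1 ≤ s → 1 ≤ ∑ D (λ i → ∑ VS (λ S → ∑ VS (λ U → w i S U * r g π S U)))
        go (suc i) e _ = begin
          1 ≡⟨ sym (cong₂ _*_ (cong₂ _*_ (cong 𝟙 (trans (cong (λ t → 4 * C * t ≤ᵇ n) (sym e)) v₄))
                 (cong 𝟙 (∧-t⁺ (≡ᵇ-t⁺ e) (subst (λ t → (S ⊆ᵇ U) ∧ (wt U ≤ᵇ 3 * t) ≡ true) e v₅)))) (cong 𝟙 (∧-t⁺ reg v₆))) ⟩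
          w i S U * r g π S U
            ≤⟨ ∈⇒≤∑ (λ U → w i S U * r g π S U) (∈-allVecs U) ⟩
          ∑ VS (λ U → w i S U * r g π S U)
            ≤⟨ ∈⇒≤∑ (λ S → ∑ VS (λ U → w i S U * r g π S U)) (∈-allVecs S) ⟩
          ∑ VS (λ S → ∑ VS (λ U → w i S U * r g π S U))
            ≤⟨ ∈⇒≤∑ (λ i → ∑ VS (λ S → ∑ VS (λ U → w i S U * r g π S U))) (∈-downFrom⁺ (≤-trans (≤-reflexive (sym e)) (wt≤ S))) ⟩
          ∑ D (λ i → ∑ VS (λ S → ∑ VS (λ U → w i S U * r g π S U))) ∎

  Π≢0 : NonZero (length Π)
  Π≢0 = subst NonZero (sym length-Π) (m*n≢0 (b ^ length L) (b ^ length L) {{p}} {{p}})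
    where
    nz : ∀ b → d ≤ 32 * b → NonZero b
    nz zero    q = ⊥-elim (<-irrefl refl (≤-trans 1≤d (≤-trans q (≤-reflexive (*-zeroʳ 32)))))
    nz (suc b) q = _
    p : NonZero (b ^ length L)
    p = m^n≢0 b (length L) {{nz b d≤}}

  -- Markov's inequality: a graph without a good choice is counted `length Π` times in `total`. The
  -- geometric series leaves a proportion of at most 4C/n.
  allBad-bound : # (λ g → isRegular d g ∧ allBad g) * n ≤ 4 * C * N
  allBad-bound = *-cancelʳ-≤ _ _ (length Π) {{Π≢0}} (begin
    A * n * length Π
      ≡⟨ xy∙z≈xz∙y A n (length Π) ⟩
    A * length Π * n
      ≤⟨ *-monoˡ-≤ n step ⟩
    ∑ (downFrom n) y * n
      ≤⟨ *-cancelʳ-≤ _ _ (2 ^ n) {{m^n≢0 2 n}} (≤-trans (m≤m+n _ (4 * C * T′)) (geometric n n (4 * C * T′) y y-bound)) ⟩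
    4 * C * T′
      ≡⟨ l₂ (4 * C) (length Π) N ⟩
    4 * C * N * length Π ∎)
    where
    open ≤-Reasoning
    A = # (λ g → isRegular d g ∧ allBad g)
    l₂ : ∀ a b c → a * (b * c) ≡ a * c * b
    l₂ = solve-∀
    step : A * length Π ≤ ∑ (downFrom n) y
    step = begin
      A * length Π
        ≡⟨ trans (sym (∑-*ʳ G _ (length Π))) (∑-cong G (λ g → trans (*-comm (𝟙 (isRegular d g ∧ allBad g)) (length Π)) (sym (∑-const Π _)))) ⟩
      ∑ G (λ g → ∑ Π (λ π → 𝟙 (isRegular d g ∧ allBad g)))
        ≤⟨ ∑-mono G (λ g → ∑-mono-∈ Π (λ π m → 𝟙-mono (λ q → let r , s = ∧-t⁻ {isRegular d g} q in ∧-t⁺ r (allB-t⁻ (isBad g) Π s m)))) ⟩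
      ∑ G (λ g → ∑ Π (λ π → 𝟙 (isRegular d g ∧ isBad g π)))
        ≤⟨ total ⟩
      ∑ (downFrom n) y ∎

-- The game: pairing strategy combined with the Erdős–Selfridge potential

module _ {A : Set} where

  ∑-─ : ∀ {xs : List A} {x} (p : x ∈ xs) (f : A → ℕ) → ∑ xs f ≡ f x + ∑ (xs ─ p) f
  ∑-─ (here refl) f = refl
  ∑-─ {y ∷ xs} {x} (there p) f = trans (cong (f y +_) (∑-─ p f)) (l (f y) (f x) _)
    where
    l : ∀ a b c → a + (b + c) ≡ b + (a + c)
    l = solve-∀

  ∈-─⁻ : ∀ {xs : List A} {x y} (p : x ∈ xs) → y ∈ (xs ─ p) → y ∈ xs
  ∈-─⁻ (here refl) q         = there q
  ∈-─⁻ (there p)   (here e)  = here e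
  ∈-─⁻ (there p)   (there q) = there (∈-─⁻ p q)

  ∈-─⁺ : ∀ {xs : List A} {x y} (p : x ∈ xs) → y ∈ xs → y ≢ x → y ∈ (xs ─ p)
  ∈-─⁺ (here refl) (here refl) h = ⊥-elim (h refl)
  ∈-─⁺ (here refl) (there q)   h = q
  ∈-─⁺ (there p)   (here e)    h = here e
  ∈-─⁺ (there p)   (there q)   h = there (∈-─⁺ p q h)

  Unique-─ : ∀ {xs : List A} {x} (p : x ∈ xs) → Unique xs → Unique (xs ─ p)
  Unique-─ (here refl) (u ∷ us) = us
  Unique-─ (there p)   (u ∷ us) = All.tabulate (λ q → All.lookup u (∈-─⁻ p q)) ∷ Unique-─ p us

  length-─ : ∀ {xs : List A} {x} (p : x ∈ xs) → length xs ≡ suc (length (xs ─ p))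
  length-─ (here refl) = refl
  length-─ (there p)   = cong suc (length-─ p)

  argmax : ∀ (a : A → ℕ) x xs → ∃[ e ] (e ∈ (x ∷ xs) × (∀ {f} → f ∈ (x ∷ xs) → a f ≤ a e))
  argmax a x [] = x , here refl , λ { (here refl) → ≤-refl }
  argmax a x (y ∷ xs) with argmax a y xs
  ... | e , m , h with a x ≤? a e
  ... | yes p = e , there m , λ { (here refl) → p ; (there q) → h q }
  ... | no p  = x , here refl , λ { (here refl) → ≤-refl ; (there q) → ≤-trans (h q) (<⇒≤ (≰⇒> p)) }

module Game {n : ℕ} (E₀ : List (Edge n)) {Key : Set} (K : List Key) (e : Key → Bool → Edge n)
            {I : Set} (is : List I) (A : I → Edge n → Bool)
            (e-inj : ∀ {k k′ s s′} → e k s ≡ e k′ s′ → k ≡ k′ × s ≡ s′)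
            (A-off : ∀ i k s → A i (e k s) ≡ false) where

  Good : List (Edge n) → Set
  Good mk = (∀ {f} → f ∈ mk → f ∈ E₀)
          × (∀ {k} → k ∈ K → ∃[ s ] (e k s ∈ mk))
          × (∀ {i} → i ∈ is → ∃[ f ] (f ∈ mk × A i f ≡ true))

  -- The Erdős-Selfridge weight 2^(-r) of a set with r remaining edges, scaled by 2^(length rem) to
  -- be integral. A potential below 1 thus reads `Φ mk rem < 2 ^ length rem`, and every claimed edge
  -- changes the scale by 2.
  w : I → List (Edge n) → ℕ
  w i rem = 2 ^ ∑ rem (λ f → 𝟙 (not (A i f)))

  unhit : I → List (Edge n) → Bool
  unhit i mk = allB (λ f → not (A i f)) mk

  Φ : List (Edge n) → List (Edge n) → ℕ
  Φ mk rem = ∑ is (λ i → 𝟙 (unhit i mk) * w i rem)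

  α : Edge n → List (Edge n) → List (Edge n) → ℕ
  α f mk rem = ∑ is (λ i → 𝟙 (A i f) * (𝟙 (unhit i mk) * w i rem))

  w-─ : ∀ i {rem f} (p : f ∈ rem) → w i rem ≡ 2 ^ 𝟙 (not (A i f)) * w i (rem ─ p)
  w-─ i {rem} {f} p = trans (cong (2 ^_) (∑-─ p (λ f → 𝟙 (not (A i f))))) (^-distribˡ-+-* 2 (𝟙 (not (A i f))) _)

  -- Relative to the scale, sets containing f double their weight and the others keep it; `α` is the
  -- weight of the former.
  breaker-Φ : ∀ mk {rem f} (p : f ∈ rem) → 2 * Φ mk (rem ─ p) ≡ Φ mk rem + α f mk rem
  breaker-Φ mk {rem} {f} p = trans (sym (∑-*ˡ is 2 _)) (trans (∑-cong is pt) (∑-+ is _ _))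
    where
    pt : ∀ i → 2 * (𝟙 (unhit i mk) * w i (rem ─ p)) ≡ 𝟙 (unhit i mk) * w i rem + 𝟙 (A i f) * (𝟙 (unhit i mk) * w i rem)
    pt i rewrite w-─ i p with A i f
    ... | true  = l (𝟙 (unhit i mk)) (w i (rem ─ p))
      where
      l : ∀ u w → 2 * (u * w) ≡ u * (1 * w) + 1 * (u * (1 * w))
      l = solve-∀
    ... | false = l (𝟙 (unhit i mk)) (w i (rem ─ p))
      where
      l : ∀ u w → 2 * (u * w) ≡ u * (2 * w) + 0
      l = solve-∀

  maker-Φ : ∀ mk {rem f} (p : f ∈ rem) → 2 * Φ (f ∷ mk) (rem ─ p) + α f mk rem ≡ Φ mk rem
  maker-Φ mk {rem} {f} p = trans (cong (_+ α f mk rem) (sym (∑-*ˡ is 2 _))) (trans (sym (∑-+ is _ _)) (∑-cong is pt))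
    where
    pt : ∀ i → 2 * (𝟙 (unhit i (f ∷ mk)) * w i (rem ─ p)) + 𝟙 (A i f) * (𝟙 (unhit i mk) * w i rem) ≡ 𝟙 (unhit i mk) * w i rem
    pt i rewrite w-─ i p with A i f
    ... | true  = +-identityʳ _
    ... | false = l (𝟙 (unhit i mk)) (w i (rem ─ p))
      where
      l : ∀ u w → 2 * (u * w) + 0 ≡ u * (2 * w)
      l = solve-∀

  maker-α : ∀ mk {rem f} (p : f ∈ rem) f′ → 2 * α f′ (f ∷ mk) (rem ─ p) ≤ α f′ mk rem
  maker-α mk {rem} {f} p f′ = ≤-trans (≤-reflexive (sym (∑-*ˡ is 2 _))) (∑-mono is pt)
    where
    pt : ∀ i → 2 * (𝟙 (A i f′) * (𝟙 (unhit i (f ∷ mk)) * w i (rem ─ p))) ≤ 𝟙 (A i f′) * (𝟙 (unhit i mk) * w i rem)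
    pt i rewrite w-─ i p with A i f
    ... | true  = ≤-trans (≤-reflexive (cong (2 *_) (*-zeroʳ (𝟙 (A i f′))))) z≤n
    ... | false = ≤-reflexive (l (𝟙 (A i f′)) (𝟙 (unhit i mk)) (w i (rem ─ p)))
      where
      l : ∀ a u w → 2 * (a * (u * w)) ≡ a * (u * (2 * w))
      l = solve-∀

  breaker-α : ∀ mk {rem f} (p : f ∈ rem) f′ → (∀ i → A i f ≡ false) → 2 * α f′ mk (rem ─ p) ≡ α f′ mk rem
  breaker-α mk {rem} {f} p f′ off = trans (sym (∑-*ˡ is 2 _)) (∑-cong is pt)
    where
    pt : ∀ i → 2 * (𝟙 (A i f′) * (𝟙 (unhit i mk) * w i (rem ─ p))) ≡ 𝟙 (A i f′) * (𝟙 (unhit i mk) * w i rem)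
    pt i rewrite w-─ i p | off i = l (𝟙 (A i f′)) (𝟙 (unhit i mk)) (w i (rem ─ p))
      where
      l : ∀ a u w → 2 * (a * (u * w)) ≡ a * (u * (2 * w))
      l = solve-∀

  α-off : ∀ mk rem f → (∀ i → A i f ≡ false) → α f mk rem ≡ 0
  α-off mk rem f off = trans (∑-cong is (λ i → cong (λ t → 𝟙 t * (𝟙 (unhit i mk) * w i rem)) (off i))) (∑-zero is)

  α≤Φ : ∀ f mk rem → α f mk rem ≤ Φ mk rem
  α≤Φ f mk rem = ∑-mono is (λ i → ≤-trans (*-monoˡ-≤ (𝟙 (unhit i mk) * w i rem) (𝟙≤1 (A i f))) (≤-reflexive (+-identityʳ _)))

  Intact : List (Edge n) → List (Edge n) → Set
  Intact mk rem = ∀ {k} → k ∈ K → (∃[ s ] (e k s ∈ mk)) ⊎ (∀ s → e k s ∈ rem)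

  -- `pots` says that the potential stays below 1 whatever Breaker claims next. `pot` is what
  -- remains of this at the end, when no edge is left to instantiate `pots`.
  record BState (mk rem : List (Edge n)) : Set where
    field
      uniq   : Unique rem
      inMk   : ∀ {f} → f ∈ mk → f ∈ E₀
      inRem  : ∀ {f} → f ∈ rem → f ∈ E₀
      intact : Intact mk rem
      pot    : Φ mk rem < 2 ^ length rem
      pots   : ∀ {f} → f ∈ rem → Φ mk rem + α f mk rem < 2 ^ length rem

  module _ (win : ∀ {mk} → Good mk → HasHamCycle n mk) where

    finish : ∀ {mk} → (∀ {f} → f ∈ mk → f ∈ E₀) → Intact mk [] → Φ mk [] < 1 → HasHamCycle n mk
    finish {mk} h int pt = win (h , pr , ht)
      where
      pr : ∀ {k} → k ∈ K → ∃[ s ] (e k s ∈ mk)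
      pr m with int m
      ... | inj₁ q = q
      ... | inj₂ q with q true
      ... | ()
      ht : ∀ {i} → i ∈ is → ∃[ f ] (f ∈ mk × A i f ≡ true)
      ht {i} m with unhit i mk in eq
      ... | false = let f , q , z = allB-f⁻ _ mk eq in f , q , not-f⁻ z
      ... | true = ⊥-elim (<-irrefl refl (≤-trans (s≤s (≤-trans (≤-reflexive (sym (trans (cong (λ t → 𝟙 t * 1) eq) refl)))
                     (∈⇒≤∑ (λ i → 𝟙 (unhit i mk) * w i []) m))) pt))

    halve : ∀ {a b} → 2 * a < 2 * b → a < b
    halve {a} {b} h = *-cancelˡ-< 2 a b h

    find-mate : ∀ (f : Edge n) (rem : List (Edge n)) (ks : List Key) →
      (∃[ k ] ∃[ s ] (f ≡ e k s × e k (not s) ∈ rem)) ⊎ (∀ {k} → k ∈ ks → ∀ s → f ≡ e k s → e k (not s) ∉ rem)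
    find-mate f rem [] = inj₂ (λ ())
    find-mate f rem (k ∷ ks) with find-mate f rem ks | try false | try true
      where
      try : ∀ s → (f ≡ e k s × e k (not s) ∈ rem) ⊎ (f ≡ e k s → e k (not s) ∉ rem)
      try s with f ≟E e k s | bool? (e k (not s) ∈E rem)
      ... | yes p | inj₁ q = inj₁ (p , ∈E-t⁻ q)
      ... | _     | inj₂ q = inj₂ (λ _ m → t≢f (∈E-t⁺ m) q)
      ... | no p  | inj₁ q = inj₂ (λ r _ → p r)
    ... | inj₁ r | _      | _      = inj₁ r
    ... | inj₂ r | inj₁ q | _      = inj₁ (k , false , q)
    ... | inj₂ r | inj₂ _ | inj₁ q = inj₁ (k , true , q)
    ... | inj₂ r | inj₂ a | inj₂ b = inj₂ λ { (here refl) false → a ; (here refl) true → b ; (there m) → r m }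

    winB : ∀ c mk rem → length rem ≤ c → BState mk rem → MakerWinsB mk rem
    winM : ∀ c mk rem → length rem ≤ c → Unique rem → (∀ {f} → f ∈ mk → f ∈ E₀) → (∀ {f} → f ∈ rem → f ∈ E₀) →
           Intact mk rem → Φ mk rem < 2 ^ length rem → MakerWinsM mk rem

    winB c       mk []          le S = endB (finish (BState.inMk S) (BState.intact S) (BState.pot S))
    winB (suc c) mk rem@(_ ∷ _) le S = moveB respond
      where
      open BState S
      respond : ∀ {f} (p : f ∈ rem) → MakerWinsM mk (rem ─ p)
      respond {f} p with find-mate f (rem ─ p) K
      -- No mate of Breaker's edge is free, so every untouched pair survives his move and Maker may
      -- spend his own move on the potential.
      ... | inj₂ none = winM c mk rem₁ le₁ (Unique-─ p uniq) inMk (λ m → inRem (∈-─⁻ p m)) int₁ pot₁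
        where
        rem₁ = rem ─ p
        le₁ : length rem₁ ≤ c
        le₁ = ≤-pred (≤-trans (≤-reflexive (sym (length-─ p))) le)
        pot₁ : Φ mk rem₁ < 2 ^ length rem₁
        pot₁ = halve (subst₂ _<_ (sym (breaker-Φ mk p)) (cong (2 ^_) (length-─ p)) (pots p))
        int₁ : Intact mk rem₁
        int₁ {k} m with intact m
        ... | inj₁ q = inj₁ q
        ... | inj₂ q = inj₂ (λ s → ∈-─⁺ p (q s) (neq s))
          where
          neq : ∀ s → e k s ≢ f
          neq s refl = none m s refl (∈-─⁺ p (q (not s)) (λ z → ne s (proj₂ (e-inj z))))
            where
            ne : ∀ s → not s ≢ s
            ne true  ()
            ne false ()
      -- The answer inside the pair is free of charge: both edges lie outside every `A i`, so no
      -- weight is lost or doubled and only the scale changes, by 4.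
      ... | inj₁ (k , s , refl , p′) = moveM p′ (winB c (f′ ∷ mk) rem₂ le₂ record
              { uniq = Unique-─ p′ (Unique-─ p uniq)
              ; inMk = λ { (here refl) → inRem (∈-─⁻ p (p′)) ; (there m) → inMk m }
              ; inRem = λ m → inRem (∈-─⁻ p (∈-─⁻ p′ m))
              ; intact = int₂
              ; pot = halve (halve (subst₂ _<_ (sym Φ₂) (trans (cong (2 ^_) len) refl) pot))
              ; pots = λ {g} m → halve (halve (subst₂ _<_ refl (cong (2 ^_) len)
                  (≤-trans (s≤s (pots≤ g)) (pots (∈-─⁻ p (∈-─⁻ p′ m))))))
              })
        where
        rem₁ = rem ─ p
        rem₂ = rem₁ ─ p′
        f′ = e k (not s)
        offf : ∀ i → A i f ≡ false
        offf i = A-off i k s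
        offf′ : ∀ i → A i f′ ≡ false
        offf′ i = A-off i k (not s)
        len : length rem ≡ suc (suc (length rem₂))
        len = trans (length-─ p) (cong suc (length-─ p′))
        le₂ : length rem₂ ≤ c
        le₂ = ≤-trans (n≤1+n _) (≤-pred (≤-trans (≤-reflexive (sym len)) le))
        Φ₂ : 2 * (2 * Φ (f′ ∷ mk) rem₂) ≡ Φ mk rem
        Φ₂ = trans (cong (2 *_) (trans (trans (sym (+-identityʳ _)) (cong (2 * Φ (f′ ∷ mk) rem₂ +_) (sym (α-off mk rem₁ f′ offf′)))) (maker-Φ mk p′)))
             (trans (breaker-Φ mk p) (trans (cong (Φ mk rem +_) (α-off mk rem f offf)) (+-identityʳ _)))
        pots≤ : ∀ g → 2 * (2 * (Φ (f′ ∷ mk) rem₂ + α g (f′ ∷ mk) rem₂)) ≤ Φ mk rem + α g mk rem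
        pots≤ g = ≤-trans (≤-reflexive (l (Φ (f′ ∷ mk) rem₂) (α g (f′ ∷ mk) rem₂)))
          (+-mono-≤ (≤-reflexive Φ₂) (≤-trans (*-monoʳ-≤ 2 (maker-α mk p′ g)) (≤-reflexive (breaker-α mk p g offf))))
          where
          l : ∀ a b → 2 * (2 * (a + b)) ≡ 2 * (2 * a) + 2 * (2 * b)
          l = solve-∀
        int₂ : Intact (f′ ∷ mk) rem₂
        int₂ {k′} m with intact m
        ... | inj₁ (s′ , q) = inj₁ (s′ , there q)
        ... | inj₂ q with e k′ (not s) ≟E f′
        ... | yes z = inj₁ (not s , here z)
        ... | no z = inj₂ (λ s′ → ∈-─⁺ p′ (∈-─⁺ p (q s′) (λ y → diff y)) (λ y → diff y))
          where
          diff : ∀ {s′ s″} → e k′ s′ ≡ e k s″ → ⊥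
          diff y with e-inj y
          ... | refl , _ = z refl

    winM c       mk []            le u hm hr int pt = endM (finish hm int pt)
    winM (suc c) mk rem@(x ∷ xs) le u hm hr int pt with argmax (λ f → α f mk rem) x xs
    -- The most dangerous edge is taken: any reply g of Breaker adds at most the weight that
    -- removing the sets through f has just saved.
    ... | f , p , mx = moveM p (winB c (f ∷ mk) rem₂ (≤-pred (≤-trans (≤-reflexive (sym (length-─ p))) le)) record
              { uniq = Unique-─ p u
              ; inMk = λ { (here refl) → hr p ; (there m) → hm m }
              ; inRem = λ m → hr (∈-─⁻ p m)
              ; intact = int₂
              ; pot = halve (≤-trans (s≤s (≤-trans (m≤m+n _ (α f mk rem)) (≤-reflexive (maker-Φ mk p)))) bound)
              ; pots = λ {g} m → halve (≤-trans (s≤s (≤-trans (≤-reflexive (*-distribˡ-+ 2 (Φ (f ∷ mk) rem₂) _))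
                    (≤-trans (+-monoʳ-≤ (2 * Φ (f ∷ mk) rem₂) (≤-trans (maker-α mk p g) (mx (∈-─⁻ p m)))) (≤-reflexive (maker-Φ mk p))))) bound)
              })
      where
      rem₂ = rem ─ p
      bound : Φ mk rem < 2 * 2 ^ length rem₂
      bound = subst (λ t → Φ mk rem < 2 ^ t) (length-─ p) pt
      int₂ : Intact (f ∷ mk) rem₂
      int₂ {k} m with int m
      ... | inj₁ (s , q) = inj₁ (s , there q)
      ... | inj₂ q with e k false ≟E f | e k true ≟E f
      ... | yes z | _     = inj₁ (false , here z)
      ... | no _  | yes z = inj₁ (true , here z)
      ... | no z₀ | no z₁ = inj₂ λ { false → ∈-─⁺ p (q false) z₀ ; true → ∈-─⁺ p (q true) z₁ }

    -- The factor 2 in the hypothesis pays for Breaker's opening move, which can at most double the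
    -- potential.
    maker-wins : Unique E₀ → (∀ {k} → k ∈ K → ∀ s → e k s ∈ E₀) →
      2 * ∑ is (λ i → w i E₀) < 2 ^ length E₀ → MakerWinsB [] E₀
    maker-wins u pe h = winB (length E₀) [] E₀ ≤-refl record
      { uniq = u ; inMk = λ () ; inRem = id ; intact = λ m → inj₂ (pe m)
      ; pot = ≤-trans (s≤s (≤-trans (≤-reflexive Φ≡) (m≤m+n _ _))) h
      ; pots = λ {f} m → ≤-trans (s≤s (≤-trans (+-monoʳ-≤ (Φ [] E₀) (α≤Φ f [] E₀)) (≤-reflexive (trans (cong₂ _+_ Φ≡ Φ≡) (cong (∑ is (λ i → w i E₀) +_) (sym (+-identityʳ _))))))) h
      }
      where
      Φ≡ : Φ [] E₀ ≡ ∑ is (λ i → w i E₀)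
      Φ≡ = ∑-cong is (λ i → +-identityʳ _)

-- Paths and rotations

Unique-resp-↭ : ∀ {A : Set} {xs ys : List A} → xs ↭ ys → Unique xs → Unique ys
Unique-resp-↭ Perm.refl         us = us
Unique-resp-↭ (Perm.prep x p)   (u ∷ us) = All-resp-↭ p u ∷ Unique-resp-↭ p us
Unique-resp-↭ (Perm.swap x y p) ((h ∷ u) ∷ v ∷ us) = ((h ∘ sym) ∷ All-resp-↭ p v) ∷ All-resp-↭ p u ∷ Unique-resp-↭ p us
Unique-resp-↭ (Perm.trans p q)  us = Unique-resp-↭ q (Unique-resp-↭ p us)

ʳ++↭++ : ∀ {A : Set} (xs ys : List A) → xs ʳ++ ys ↭ xs ++ ys
ʳ++↭++ xs ys = ↭-sym (++↭ʳ++ xs ys)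

module _ {n : ℕ} where

  headIs lastIs : Fin n → List (Fin n) → Bool
  headIs a []      = false
  headIs a (x ∷ _) = x == a
  lastIs a []          = false
  lastIs a (x ∷ [])    = x == a
  lastIs a (x ∷ y ∷ r) = lastIs a (y ∷ r)

  linked : (Fin n → Fin n → Bool) → List (Fin n) → Bool
  linked R []          = true
  linked R (x ∷ [])    = true
  linked R (x ∷ y ∷ r) = R x y ∧ linked R (y ∷ r)

  uniqueB : List (Fin n) → Bool
  uniqueB []       = true
  uniqueB (x ∷ xs) = not (x ∈F xs) ∧ uniqueB xs

  uniqueB⁻ : ∀ xs → uniqueB xs ≡ true → Unique xs
  uniqueB⁻ []       h = []
  uniqueB⁻ (x ∷ xs) h with ∧-t⁻ {not (x ∈F xs)} h
  ... | h₁ , h₂ = All.tabulate (λ m e → t≢f (∈F-t⁺ (subst (_∈ xs) (sym e) m)) (not-t⁻ h₁)) ∷ uniqueB⁻ xs h₂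

  uniqueB⁺ : ∀ xs → Unique xs → uniqueB xs ≡ true
  uniqueB⁺ []       h = refl
  uniqueB⁺ (x ∷ xs) (u ∷ us) = ∧-t⁺ (not-t⁺ (¬t⇒f (λ e → All.lookup u (∈F-t⁻ {x = x} {xs} e) refl))) (uniqueB⁺ xs us)

  allLists : ℕ → List (List (Fin n))
  allLists zero    = [] ∷ []
  allLists (suc ℓ) = concatMap (λ x → map (x ∷_) (allLists ℓ)) (allFin n)

  ∈-allLists : ∀ Q → Q ∈ allLists (length Q)
  ∈-allLists []      = here refl
  ∈-allLists (x ∷ Q) = ∈-concat⁺′ (∈-map⁺ (x ∷_) (∈-allLists Q)) (∈-map⁺ _ (∈-allFin x))

  length-allLists : ∀ ℓ Q → Q ∈ allLists ℓ → length Q ≡ ℓ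
  length-allLists zero    Q (here refl) = refl
  length-allLists (suc ℓ) Q m with ∈-concat⁻′ (map (λ x → map (x ∷_) (allLists ℓ)) (allFin n)) m
  ... | xs , q , r with ∈-map⁻ _ r
  ... | k , _ , refl with ∈-map⁻ (k ∷_) q
  ... | Q′ , s , refl = cong suc (length-allLists ℓ Q′ s)

  record Path (R : Fin n → Fin n → Bool) (ℓ : ℕ) (Q : List (Fin n)) : Set where
    constructor mkPath
    field
      uniq : Unique Q
      lnk  : linked R Q ≡ true
      len  : length Q ≡ ℓ

  pathOf : (Fin n → Fin n → Bool) → List (Fin n) → Bool
  pathOf R Q = uniqueB Q ∧ linked R Q

  hasPath : (Fin n → Fin n → Bool) → ℕ → Bool
  hasPath R ℓ = anyB (pathOf R) (allLists ℓ)

  hasPath⁺ : ∀ {R ℓ Q} → Path R ℓ Q → hasPath R ℓ ≡ true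
  hasPath⁺ {R} {Q = Q} (mkPath u l refl) = anyB-t⁺ (pathOf R) (∈-allLists Q) (∧-t⁺ (uniqueB⁺ Q u) l)

  hasPath⁻ : ∀ {R ℓ} → hasPath R ℓ ≡ true → ∃[ Q ] Path R ℓ Q
  hasPath⁻ {R} {ℓ} h with anyB-t⁻ (pathOf R) (allLists ℓ) h
  ... | Q , m , q with ∧-t⁻ {uniqueB Q} q
  ... | u , l = Q , mkPath (uniqueB⁻ Q u) l (length-allLists ℓ Q m)

  -- Boolean, by enumeration of all lists, so that the pairs can be counted and used as a target set
  -- fixed before the game. It admits every path on ℓ vertices, so it is determined by `R` and ℓ
  -- alone.
  joins : (Fin n → Fin n → Bool) → ℕ → Fin n → Fin n → Bool
  joins R ℓ b a = anyB (λ Q → pathOf R Q ∧ (headIs b Q ∧ lastIs a Q)) (allLists ℓ)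

  joins⁺ : ∀ {R ℓ Q b a} → Path R ℓ Q → headIs b Q ≡ true → lastIs a Q ≡ true → joins R ℓ b a ≡ true
  joins⁺ {R} {Q = Q} {b} {a} (mkPath u l refl) h k =
    anyB-t⁺ (λ Q → pathOf R Q ∧ (headIs b Q ∧ lastIs a Q)) (∈-allLists Q) (∧-t⁺ (∧-t⁺ (uniqueB⁺ Q u) l) (∧-t⁺ h k))

  joins⁻ : ∀ {R ℓ b a} → joins R ℓ b a ≡ true → ∃[ Q ] (Path R ℓ Q × (headIs b Q ≡ true × lastIs a Q ≡ true))
  joins⁻ {R} {ℓ} {b} {a} h with anyB-t⁻ (λ Q → pathOf R Q ∧ (headIs b Q ∧ lastIs a Q)) (allLists ℓ) h
  ... | Q , m , q with ∧-t⁻ {pathOf R Q} q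
  ... | q₁ , q₂ with ∧-t⁻ {uniqueB Q} q₁
  ... | u , l = Q , mkPath (uniqueB⁻ Q u) l (length-allLists ℓ Q m) , ∧-t⁻ {headIs b Q} q₂

  data Cs : List (Fin n) → Fin n → Fin n → Set where
    here  : ∀ {u v r} → Cs (u ∷ v ∷ r) u v
    there : ∀ {x r u v} → Cs r u v → Cs (x ∷ r) u v

  Cs-∈ˡ : ∀ {Q u v} → Cs Q u v → u ∈ Q
  Cs-∈ˡ here      = here refl
  Cs-∈ˡ (there c) = there (Cs-∈ˡ c)

  Cs-∈ʳ : ∀ {x Q u v} → Cs (x ∷ Q) u v → v ∈ Q
  Cs-∈ʳ here = here refl
  Cs-∈ʳ {Q = _ ∷ _} (there c) = there (Cs-∈ʳ c)

  ∉-head : ∀ {x : Fin n} {Q} → Unique (x ∷ Q) → x ∉ Q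
  ∉-head (u ∷ _) m = All.lookup u m refl

  pred-unique : ∀ {Q u u′ y} → Unique Q → Cs Q u y → Cs Q u′ y → u ≡ u′
  pred-unique us       here      here       = refl
  pred-unique (u ∷ us) here      (there c′) = ⊥-elim (∉-head us (Cs-∈ʳ c′))
  pred-unique (u ∷ us) (there c) here       = ⊥-elim (∉-head us (Cs-∈ʳ c))
  pred-unique (u ∷ us) (there c) (there c′) = pred-unique us c c′

  succ-unique : ∀ {Q y v v′} → Unique Q → Cs Q y v → Cs Q y v′ → v ≡ v′
  succ-unique us       here      here       = refl
  succ-unique us       here      (there c′) = ⊥-elim (∉-head us (Cs-∈ˡ c′))
  succ-unique us       (there c) here       = ⊥-elim (∉-head us (Cs-∈ˡ c))
  succ-unique (u ∷ us) (there c) (there c′) = succ-unique us c c′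

  no-2-cycle : ∀ {Q u v} → Unique Q → Cs Q u v → Cs Q v u → ⊥
  no-2-cycle us       here      c′         = ∉-head us (Cs-∈ʳ c′)
  no-2-cycle us       (there c) here       = ∉-head us (there (Cs-∈ʳ c))
  no-2-cycle (u ∷ us) (there c) (there c′) = no-2-cycle us c c′

  last-∈ : ∀ {y} Q → lastIs y Q ≡ true → y ∈ Q
  last-∈ (x ∷ [])    e = here (sym (==-t⁻ e))
  last-∈ (x ∷ z ∷ r) e = there (last-∈ (z ∷ r) e)

  last-no-succ : ∀ {Q y v} → Unique Q → lastIs y Q ≡ true → Cs Q y v → ⊥
  last-no-succ {x ∷ z ∷ r} us e here = ∉-head us (last-∈ (z ∷ r) e)
  last-no-succ {x ∷ z ∷ r} (u ∷ us) e (there c) = last-no-succ us e c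

  cons-pred : ∀ x {P y} → y ∈ P → ∃[ u ] Cs (x ∷ P) u y
  cons-pred x (here refl) = x , here
  cons-pred x {z ∷ P} (there m) = let u , c = cons-pred z m in u , there c

  has-pred : ∀ {P y} → y ∈ P → headIs y P ≡ false → ∃[ u ] Cs P u y
  has-pred {x ∷ P} (here refl) h = ⊥-elim (t≢f (==-refl x) h)
  has-pred {x ∷ P} (there m)   h = cons-pred x m

  has-succ : ∀ {P y} → y ∈ P → lastIs y P ≡ false → ∃[ v ] Cs P y v
  has-succ {x ∷ []}    (here refl) h = ⊥-elim (t≢f (==-refl x) h)
  has-succ {x ∷ z ∷ P} (here refl) h = z , here
  has-succ {x ∷ z ∷ P} (there m)   h with has-succ m h
  ... | v , c = v , there c

  Cs-ʳ++ˡ : ∀ xs {ys u v} → Cs ys u v → Cs (xs ʳ++ ys) u v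
  Cs-ʳ++ˡ []       c = c
  Cs-ʳ++ˡ (x ∷ xs) c = Cs-ʳ++ˡ xs (there c)

  Cs-ʳ++ʳ : ∀ {xs ys u v} → Cs xs u v → Cs (xs ʳ++ ys) v u
  Cs-ʳ++ʳ {x ∷ x′ ∷ xs} here = Cs-ʳ++ˡ xs here
  Cs-ʳ++ʳ (there c) = Cs-ʳ++ʳ c

  Cs-++ : ∀ X {y C u v} → Cs (X ++ y ∷ C) u v → Cs X u v ⊎ ((lastIs u X ≡ true × v ≡ y) ⊎ Cs (y ∷ C) u v)
  Cs-++ []          c = inj₂ (inj₂ c)
  Cs-++ (x ∷ [])    here = inj₂ (inj₁ (==-refl x , refl))
  Cs-++ (x ∷ [])    (there c) = inj₂ (inj₂ c)
  Cs-++ (x ∷ z ∷ X) here = inj₁ here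
  Cs-++ (x ∷ z ∷ X) (there c) with Cs-++ (z ∷ X) c
  ... | inj₁ d = inj₁ (there d)
  ... | inj₂ d = inj₂ d

  Cs-join : ∀ X {y C z} → lastIs z X ≡ true → Cs (X ++ y ∷ C) z y
  Cs-join (x ∷ [])    e with ==-t⁻ e
  ... | refl = here
  Cs-join (x ∷ x′ ∷ X) e = there (Cs-join (x′ ∷ X) e)

  last-exists : ∀ x X → ∃[ z ] (lastIs z (x ∷ X) ≡ true)
  last-exists x []      = x , ==-refl x
  last-exists x (y ∷ X) = last-exists y X

  head-ʳ++ : ∀ X {Z z} → lastIs z X ≡ true → headIs z (X ʳ++ Z) ≡ true
  head-ʳ++ X {Z} {z} e = go X Z e
    where
    go : ∀ X Z → lastIs z X ≡ true → headIs z (X ʳ++ Z) ≡ true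
    go (x ∷ [])    Z e = e
    go (x ∷ y ∷ X) Z e = go (y ∷ X) (x ∷ Z) e

  last-++ : ∀ X {y C} a → lastIs a (X ++ y ∷ C) ≡ lastIs a (y ∷ C)
  last-++ []          a = refl
  last-++ (x ∷ [])    a = refl
  last-++ (x ∷ z ∷ X) a = last-++ (z ∷ X) a

  last-ʳ++ : ∀ X {y C} a → lastIs a (X ʳ++ (y ∷ C)) ≡ lastIs a (y ∷ C)
  last-ʳ++ []      a = refl
  last-ʳ++ (x ∷ X) a = last-ʳ++ X a

  split-at : ∀ {y} {Q : List (Fin n)} → y ∈ Q → ∃[ X ] ∃[ C ] (Q ≡ X ++ y ∷ C)
  split-at (here refl) = [] , _ , refl
  split-at (there {x} m) with split-at m
  ... | X , C , refl = x ∷ X , C , refl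

  linked-++⁻ˡ : ∀ R X {Z} → linked R (X ++ Z) ≡ true → linked R X ≡ true
  linked-++⁻ˡ R []          h = refl
  linked-++⁻ˡ R (x ∷ [])    h = refl
  linked-++⁻ˡ R (x ∷ z ∷ X) h = ∧-t⁺ (proj₁ (∧-t⁻ {R x z} h)) (linked-++⁻ˡ R (z ∷ X) (proj₂ (∧-t⁻ {R x z} h)))

  linked-++⁻ʳ : ∀ R X {Z} → linked R (X ++ Z) ≡ true → linked R Z ≡ true
  linked-++⁻ʳ R []          h = h
  linked-++⁻ʳ R (x ∷ [])    {[]} h = refl
  linked-++⁻ʳ R (x ∷ [])    {z ∷ Z} h = proj₂ (∧-t⁻ {R x z} h)
  linked-++⁻ʳ R (x ∷ z ∷ X) h = linked-++⁻ʳ R (z ∷ X) (proj₂ (∧-t⁻ {R x z} h))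

  module Sym (R : Fin n → Fin n → Bool) (R-sym : ∀ {x y} → R x y ≡ true → R y x ≡ true) where

    linked-ʳ++ : ∀ x X Z → linked R (x ∷ X) ≡ true → linked R (x ∷ Z) ≡ true → linked R ((x ∷ X) ʳ++ Z) ≡ true
    linked-ʳ++ x []      Z h k = k
    linked-ʳ++ x (y ∷ X) Z h k with ∧-t⁻ {R x y} h
    ... | h₁ , h₂ = linked-ʳ++ y X (x ∷ Z) h₂ (∧-t⁺ (R-sym h₁) k)

    reverse-path : ∀ {ℓ Q b a} → Path R ℓ Q → headIs b Q ≡ true → lastIs a Q ≡ true →
      ∃[ Q′ ] (Path R ℓ Q′ × (headIs a Q′ ≡ true × lastIs b Q′ ≡ true))
    reverse-path {Q = x ∷ Q} {b} (mkPath u l refl) h k = (x ∷ Q) ʳ++ [] ,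
      mkPath (Unique-resp-↭ (↭-sym p) u) (linked-ʳ++ x Q [] l refl) (↭-length p) , head-ʳ++ (x ∷ Q) k , trans (last-ʳ++ Q b) h
      where
      p : (x ∷ Q) ʳ++ [] ↭ x ∷ Q
      p = subst ((x ∷ Q) ʳ++ [] ↭_) (LP.++-identityʳ (x ∷ Q)) (ʳ++↭++ (x ∷ Q) [])

    -- The head is the moving end. With pivot y the path x ... z y ... becomes z ... x y ..., and
    -- the last vertex stays fixed.
    data Rot (P : List (Fin n)) : List (Fin n) → Set where
      start  : Rot P P
      rotate : ∀ {x X y C} → Rot P (x ∷ X ++ y ∷ C) → R x y ≡ true → Rot P ((x ∷ X) ʳ++ (y ∷ C))

    module Rotations {ℓ} {P : List (Fin n)} {a : Fin n} (path : Path R ℓ P) (end : lastIs a P ≡ true) where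

      End : Fin n → Set
      End u = ∃[ Q ] (Rot P Q × headIs u Q ≡ true)

      Rot-↭ : ∀ {Q} → Rot P Q → Q ↭ P
      Rot-↭ start = ↭-refl
      Rot-↭ (rotate {x} {X} {y} {C} r _) = ↭-trans (ʳ++↭++ (x ∷ X) (y ∷ C)) (Rot-↭ r)

      Rot-unique : ∀ {Q} → Rot P Q → Unique Q
      Rot-unique r = Unique-resp-↭ (↭-sym (Rot-↭ r)) (Path.uniq path)

      Rot-linked : ∀ {Q} → Rot P Q → linked R Q ≡ true
      Rot-linked start = Path.lnk path
      Rot-linked (rotate {x} {X} {y} {C} r e) = linked-ʳ++ x X (y ∷ C)
        (linked-++⁻ˡ R (x ∷ X) (Rot-linked r)) (∧-t⁺ e (linked-++⁻ʳ R (x ∷ X) (Rot-linked r)))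

      Rot-path : ∀ {Q} → Rot P Q → Path R ℓ Q
      Rot-path r = mkPath (Rot-unique r) (Rot-linked r) (trans (↭-length (Rot-↭ r)) (Path.len path))

      Rot-last : ∀ {Q} → Rot P Q → lastIs a Q ≡ true
      Rot-last start = end
      Rot-last (rotate {x} {X} {y} {C} r _) = trans (last-ʳ++ (x ∷ X) a) (trans (sym (last-++ (x ∷ X) a)) (Rot-last r))

      -- An edge of P can only be lost by a rotation that makes one of its ends an endpoint.
      Rot-edges : ∀ {Q} → Rot P Q → ∀ {u v} → Cs P u v → (Cs Q u v ⊎ Cs Q v u) ⊎ (End u ⊎ End v)
      Rot-edges start c = inj₁ (inj₁ c)
      Rot-edges (rotate {x} {X} {y} {C} r e) c with Rot-edges r c
      ... | inj₂ E = inj₂ E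
      ... | inj₁ (inj₁ c′) with Cs-++ (x ∷ X) c′
      ... | inj₁ d = inj₁ (inj₂ (Cs-ʳ++ʳ d))
      ... | inj₂ (inj₂ d) = inj₁ (inj₁ (Cs-ʳ++ˡ (x ∷ X) d))
      ... | inj₂ (inj₁ (k , refl)) = inj₂ (inj₁ (_ , rotate {x = x} {X} {y} {C} r e , head-ʳ++ (x ∷ X) k))
      Rot-edges (rotate {x} {X} {y} {C} r e) c | inj₁ (inj₂ c′) with Cs-++ (x ∷ X) c′
      ... | inj₁ d = inj₁ (inj₁ (Cs-ʳ++ʳ d))
      ... | inj₂ (inj₂ d) = inj₁ (inj₂ (Cs-ʳ++ˡ (x ∷ X) d))
      ... | inj₂ (inj₁ (k , refl)) = inj₂ (inj₂ (_ , rotate {x = x} {X} {y} {C} r e , head-ʳ++ (x ∷ X) k))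

      module _ (maximal : ∀ {Q x y} → Path R ℓ Q → headIs x Q ≡ true → R x y ≡ true → y ∈ Q) where

        -- Pósa's lemma. If the edges of `P` at y survive in Q, the predecessor z of y in Q is one
        -- of its neighbours on `P`, and the rotation with pivot y turns z into an end. If one of
        -- them was lost, `Rot-edges` makes its other endpoint an end.
        neighbour : ∀ {x y} → End x → R x y ≡ true → ¬ End y → ∃[ w ] (End w × (Cs P w y ⊎ Cs P y w))
        neighbour {x} {y} (Q , r , hd) e ¬y with split-at (maximal (Rot-path r) hd e)
        ... | [] , C , refl = ⊥-elim (¬y (Q , r , ==-refl y))
        ... | x′ ∷ X , C , refl with ==-t⁻ hd
        ... | refl = goal
          where
          us = Rot-unique r
          uP = Path.uniq path
          Z = last-exists x X
          z = proj₁ Z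
          Ez : End z
          Ez = _ , rotate {x = x} {X} {y} {C} r e , head-ʳ++ (x ∷ X) (proj₂ Z)
          zy : Cs (x ∷ X ++ y ∷ C) z y
          zy = Cs-join (x ∷ X) (proj₂ Z)
          y∈P : y ∈ P
          y∈P = ∈-resp-↭ (Rot-↭ r) (maximal (Rot-path r) hd e)
          not-head : headIs y P ≡ false
          not-head = ¬t⇒f (λ h → ¬y (P , start , h))
          goal : ∃[ w ] (End w × (Cs P w y ⊎ Cs P y w))
          goal with has-pred y∈P not-head
          ... | u , uy with Rot-edges r uy
          ... | inj₂ (inj₁ Eu) = u , Eu , inj₁ uy
          ... | inj₂ (inj₂ Ey) = ⊥-elim (¬y Ey)
          ... | inj₁ (inj₁ c) = u , subst End (pred-unique us zy c) Ez , inj₁ uy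
          -- In Q the vertex u comes after y. Then y is not the common last vertex, so it has a
          -- second neighbour v on `P`, and v has to be the predecessor z.
          ... | inj₁ (inj₂ c) with has-succ y∈P (¬t⇒f (λ h → last-no-succ us (lastQ h) c))
            where
            last-same : ∀ {a b} Q → lastIs a Q ≡ true → lastIs b Q ≡ true → a ≡ b
            last-same (q ∷ [])     p p′ = trans (sym (==-t⁻ p)) (==-t⁻ p′)
            last-same (q ∷ q′ ∷ Q) p p′ = last-same (q′ ∷ Q) p p′
            lastQ : lastIs y P ≡ true → lastIs y (x ∷ X ++ y ∷ C) ≡ true
            lastQ h with last-same P h end
            ... | refl = Rot-last r
          ... | v , yv with Rot-edges r yv
          ... | inj₂ (inj₁ Ey) = ⊥-elim (¬y Ey)
          ... | inj₂ (inj₂ Ev) = v , Ev , inj₂ yv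
          ... | inj₁ (inj₂ c′) = v , subst End (pred-unique us zy c′) Ez , inj₂ yv
          ... | inj₁ (inj₁ c′) with succ-unique us c c′
          ... | refl = ⊥-elim (no-2-cycle uP uy yv)

  -- Many pairs of ends of paths

  cover : (Fin n → Bool) → List (Fin n) → List (Fin n)
  cover e []          = []
  cover e (x ∷ [])    = []
  cover e (x ∷ y ∷ r) = (if e x then y ∷ [] else []) ++ ((if e y then x ∷ [] else []) ++ cover e (y ∷ r))

  cover-length : ∀ e P → length (cover e P) ≤ 2 * ∑ P (λ x → 𝟙 (e x))
  cover-length e P = ≤-trans (m≤m+n _ _) (go P)
    where
    hd : List (Fin n) → ℕ
    hd []      = 0
    hd (x ∷ _) = 𝟙 (e x)
    opt : ∀ b (z : Fin n) → length (if b then z ∷ [] else []) ≡ 𝟙 b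
    opt true  z = refl
    opt false z = refl
    -- Each marked vertex has two units for its two neighbours. The head has used at most one; the
    -- other is kept for the vertex that the induction puts in front.
    go : ∀ P → length (cover e P) + hd P ≤ 2 * ∑ P (λ x → 𝟙 (e x))
    go []          = z≤n
    go (x ∷ [])    = ≤-trans (m≤m+n (𝟙 (e x)) 0) (m≤m+n _ _)
    go (x ∷ y ∷ r) = begin
      length (cover e (x ∷ y ∷ r)) + 𝟙 (e x)
        ≡⟨ cong (_+ 𝟙 (e x)) (trans (length-++ (if e x then y ∷ [] else [])) (cong₂ _+_ (opt (e x) y)
             (trans (length-++ (if e y then x ∷ [] else [])) (cong (_+ length (cover e (y ∷ r))) (opt (e y) x))))) ⟩
      𝟙 (e x) + (𝟙 (e y) + length (cover e (y ∷ r))) + 𝟙 (e x)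
        ≡⟨ l (𝟙 (e x)) (𝟙 (e y)) (length (cover e (y ∷ r))) ⟩
      2 * 𝟙 (e x) + (length (cover e (y ∷ r)) + 𝟙 (e y))
        ≤⟨ +-monoʳ-≤ (2 * 𝟙 (e x)) (go (y ∷ r)) ⟩
      2 * 𝟙 (e x) + 2 * ∑ (y ∷ r) (λ x → 𝟙 (e x))
        ≡⟨ sym (*-distribˡ-+ 2 (𝟙 (e x)) _) ⟩
      2 * ∑ (x ∷ y ∷ r) (λ x → 𝟙 (e x)) ∎
      where
      open ≤-Reasoning
      l : ∀ a b c → a + (b + c) + a ≡ 2 * a + (c + b)
      l = solve-∀

  ∈-coverʳ : ∀ e {P w y} → Cs P w y → e w ≡ true → y ∈ cover e P
  ∈-coverʳ e {x ∷ y ∷ r} here h rewrite h = here refl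
  ∈-coverʳ e {x ∷ y ∷ r} (there c) h = ∈-++⁺ʳ (if e x then y ∷ [] else []) (∈-++⁺ʳ (if e y then x ∷ [] else []) (∈-coverʳ e c h))

  ∈-coverˡ : ∀ e {P w y} → Cs P y w → e w ≡ true → y ∈ cover e P
  ∈-coverˡ e {x ∷ y ∷ r} here h = ∈-++⁺ʳ (if e x then y ∷ [] else []) (∈-++⁺ˡ (subst (λ b → x ∈ (if b then x ∷ [] else [])) (sym h) (here refl)))
  ∈-coverˡ e {x ∷ y ∷ r} (there c) h = ∈-++⁺ʳ (if e x then y ∷ [] else []) (∈-++⁺ʳ (if e y then x ∷ [] else []) (∈-coverˡ e c h))

  ∑-unique≤ : ∀ {P : List (Fin n)} (e : Fin n → Bool) → Unique P → ∑ P (λ x → 𝟙 (e x)) ≤ ∑F (λ x → 𝟙 (e x))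
  ∑-unique≤ {P} e u = begin
    ∑ P (λ x → 𝟙 (e x))                                  ≡⟨ ∑-cong P (λ x → sym (∑F-δ (λ y → 𝟙 (e y)) x)) ⟩
    ∑ P (λ x → ∑F (λ y → 𝟙 (x == y) * 𝟙 (e y)))          ≡⟨ ∑-swap P (allFin n) _ ⟩
    ∑F (λ y → ∑ P (λ x → 𝟙 (x == y) * 𝟙 (e y)))          ≤⟨ ∑-mono (allFin n) pt ⟩
    ∑F (λ y → 𝟙 (e y)) ∎
    where
    open ≤-Reasoning
    pt : ∀ y → ∑ P (λ x → 𝟙 (x == y) * 𝟙 (e y)) ≤ 𝟙 (e y)
    pt y = ≤-trans (≤-reflexive (∑-cong P (λ x → cong (λ t → 𝟙 t * 𝟙 (e y)) (==-sym x y)))) (Delta.∑-δ≤ F._≟_ (λ _ → 𝟙 (e y)) y u)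

-- Being an end quantifies over rotation sequences of any length and comes without a decision
-- procedure. The conclusion of `many-ends` is a decidable inequality, so it may be derived under a
-- double negation.
¬¬-decide : ∀ {n} (P : Fin n → Set) → ¬ ¬ (∀ i → Dec (P i))
¬¬-decide {zero}  P k = k (λ ())
¬¬-decide {suc n} P k = ¬¬-decide (λ i → P (fs i)) λ f →
  k (λ { fz → no (λ p → k (λ { fz → yes p ; (fs i) → f i })) ; (fs i) → f i })

tab : ∀ {n} → (Fin n → Bool) → Vec Bool n
tab = V.tabulate

-- With U = S ∪ N(S): every set S with D|S| ≤ n has more than 2|S| neighbours outside S.
Expands : ∀ {n} → ℕ → (Fin n → Fin n → Bool) → Set
Expands {n} D R = ∀ (S U : Fin n → Bool) → 1 ≤ ∑F (λ x → 𝟙 (S x)) → D * ∑F (λ x → 𝟙 (S x)) ≤ n →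
  (∀ x → S x ≡ true → U x ≡ true) → ∑F (λ x → 𝟙 (U x)) ≤ 3 * ∑F (λ x → 𝟙 (S x)) →
  ∃[ v ] ∃[ m ] (S v ≡ true × (R v m ≡ true × U m ≡ false))

module Posa {n D : ℕ} (R : Fin n → Fin n → Bool) (R-sym : ∀ {x y} → R x y ≡ true → R y x ≡ true)
            (expands : Expands D R) {ℓ : ℕ}
            (maximal : ∀ {Q x y} → Path R ℓ Q → headIs x Q ≡ true → R x y ≡ true → y ∈ Q) where
  open Sym R R-sym

  -- The s ends and their neighbours on `P` are at most s + 2s vertices, exactly the bound in
  -- `Expands`. By `neighbour` no edge leaves the ends for a vertex outside this set, so D s ≤ n is
  -- impossible.
  many-ends : ∀ {P a} → Path R ℓ P → lastIs a P ≡ true → n < D * ∑F (λ b → 𝟙 (joins R ℓ b a))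
  many-ends {P} {a} path end = decidable-stable (n <? _) λ neg → ¬¬-decide End λ dec → neg (main dec)
    where
    open Rotations path end
    module _ (dec : ∀ u → Dec (End u)) where
      e : Fin n → Bool
      e u = ⌊ dec u ⌋
      e⁺ : ∀ {u} → End u → e u ≡ true
      e⁺ {u} = ⌊⌋-t⁺ {d = dec u}
      e⁻ : ∀ {u} → e u ≡ true → End u
      e⁻ {u} = ⌊⌋-t⁻ {d = dec u}
      s = ∑F (λ u → 𝟙 (e u))
      s≤ : s ≤ ∑F (λ b → 𝟙 (joins R ℓ b a))
      s≤ = ∑-mono-⊆ (allFin n) λ u h → let Q , r , hd = e⁻ h in joins⁺ (Rot-path r) hd (Rot-last r)
      1≤s : 1 ≤ s
      1≤s = first P end start
        where
        first : ∀ Q → lastIs a Q ≡ true → Rot P Q → 1 ≤ s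
        first (x ∷ Q) _ r = ≤-trans (≤-reflexive (cong 𝟙 (sym (e⁺ (_ , r , ==-refl x))))) (∈⇒≤∑ (λ u → 𝟙 (e u)) (∈-allFin x))
      U : Fin n → Bool
      U u = e u ∨ (u ∈F cover e P)
      U≤ : ∑F (λ u → 𝟙 (U u)) ≤ 3 * s
      U≤ = begin
        ∑F (λ u → 𝟙 (U u))                               ≤⟨ ∑-mono (allFin n) (λ u → or (e u) (u ∈F cover e P)) ⟩
        ∑F (λ u → 𝟙 (e u) + 𝟙 (u ∈F cover e P))          ≡⟨ ∑-+ (allFin n) _ _ ⟩
        s + ∑F (λ u → 𝟙 (u ∈F cover e P))                ≤⟨ +-monoʳ-≤ s (Delta.∑-∈ᵇ≤ F._≟_ (cover e P) (allFin-Unique n)) ⟩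
        s + length (cover e P)                           ≤⟨ +-monoʳ-≤ s (≤-trans (cover-length e P) (*-monoʳ-≤ 2 (∑-unique≤ e (Path.uniq path)))) ⟩
        s + 2 * s                                        ≡⟨⟩
        3 * s ∎
        where
        open ≤-Reasoning
        or : ∀ a b → 𝟙 (a ∨ b) ≤ 𝟙 a + 𝟙 b
        or true  b = s≤s z≤n
        or false b = ≤-refl
      main : n < D * ∑F (λ b → 𝟙 (joins R ℓ b a))
      main with D * s ≤? n
      ... | no h = ≤-trans (≰⇒> h) (*-monoʳ-≤ D s≤)
      ... | yes h with expands e U 1≤s h (λ x q → ∨-t⁺ˡ q) U≤
      ... | v , m , ev , vm , um = ⊥-elim (contra (bool? (e m)))
        where
        contra : e m ≡ true ⊎ e m ≡ false → ⊥
        contra (inj₁ q) = t≢f (∨-t⁺ˡ q) um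
        contra (inj₂ q) with neighbour maximal (e⁻ ev) vm (λ E → t≢f (e⁺ E) q)
        ... | w , Ew , inj₁ c = t≢f (∨-t⁺ʳ {e m} (∈F-t⁺ (∈-coverʳ e c (e⁺ Ew)))) um
        ... | w , Ew , inj₂ c = t≢f (∨-t⁺ʳ {e m} (∈F-t⁺ (∈-coverˡ e c (e⁺ Ew)))) um

  -- Each of more than n/D moving ends becomes, after reversal, the fixed end of a path with more
  -- than n/D moving ends of its own.
  many-pairs : ∀ {P} → Path R ℓ P → 1 ≤ length P → n * n ≤ D * D * ∑∑ (λ b a → 𝟙 (joins R ℓ b a))
  many-pairs {x ∷ P} path _ with last-exists x P
  ... | a , end = begin
    n * n
      ≤⟨ *-monoˡ-≤ n (<⇒≤ (many-ends path end)) ⟩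
    D * ∑F (λ u → 𝟙 (joins R ℓ u a)) * n
      ≡⟨ trans (*-assoc D _ n) (cong (D *_) (sym (∑-*ʳ (allFin n) _ n))) ⟩
    D * ∑F (λ u → 𝟙 (joins R ℓ u a) * n)
      ≤⟨ *-monoʳ-≤ D (∑-mono (allFin n) (λ u → ≤-trans (𝟙-*≤ (λ q → more u q)) (≤-trans (*-monoˡ-≤ _ (𝟙≤1 (joins R ℓ u a))) (≤-reflexive (+-identityʳ _))))) ⟩
    D * ∑F (λ u → D * ∑F (λ b → 𝟙 (joins R ℓ b u)))
      ≡⟨ trans (cong (D *_) (∑-*ˡ (allFin n) D _)) (sym (*-assoc D D _)) ⟩
    D * D * ∑F (λ u → ∑F (λ b → 𝟙 (joins R ℓ b u)))
      ≡⟨ cong (D * D *_) (∑-swap (allFin n) (allFin n) _) ⟩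
    D * D * ∑∑ (λ b a → 𝟙 (joins R ℓ b a)) ∎
    where
    open ≤-Reasoning
    more : ∀ u → joins R ℓ u a ≡ true → n ≤ D * ∑F (λ b → 𝟙 (joins R ℓ b u))
    more u q with joins⁻ q
    ... | Q , pQ , hQ , lQ with reverse-path pQ hQ lQ
    ... | Q′ , pQ′ , _ , lQ′ = <⇒≤ (many-ends pQ′ lQ′)

-- From expansion and boosters to a Hamilton cycle

unique-↭ : ∀ {A : Set} {xs ys : List A} → Unique xs → Unique ys →
  (∀ {x} → x ∈ xs → x ∈ ys) → (∀ {x} → x ∈ ys → x ∈ xs) → xs ↭ ys
unique-↭ {xs = []} {[]}     us vs f g = ↭-refl
unique-↭ {xs = []} {y ∷ ys} us vs f g with g (here refl)
... | ()
unique-↭ {A} {xs = x ∷ xs} {ys} (u ∷ us) vs f g with ∈-∃++ (f (here refl))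
... | A₁ , B₁ , refl = ↭-trans (Perm.prep x (unique-↭ us vs′ f′ g′)) (↭-sym sh)
  where
  sh : A₁ ++ x ∷ B₁ ↭ x ∷ (A₁ ++ B₁)
  sh = shift x A₁ B₁
  vs″ : Unique (x ∷ (A₁ ++ B₁))
  vs″ = Unique-resp-↭ sh vs
  tail : ∀ {x : A} {xs} → Unique (x ∷ xs) → Unique xs
  tail (_ ∷ us) = us
  hd : ∀ {x : A} {xs} → Unique (x ∷ xs) → x ∉ xs
  hd (u ∷ _) m = All.lookup u m refl
  vs′ : Unique (A₁ ++ B₁)
  vs′ = tail vs″
  f′ : ∀ {z} → z ∈ xs → z ∈ A₁ ++ B₁
  f′ m with ∈-resp-↭ sh (f (there m))
  ... | here refl = ⊥-elim (All.lookup u m refl)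
  ... | there q   = q
  g′ : ∀ {z} → z ∈ A₁ ++ B₁ → z ∈ xs
  g′ m with g (∈-resp-↭ (↭-sym sh) (there m))
  ... | here refl = ⊥-elim (hd vs″ m)
  ... | there q   = q

unique-length≤ : ∀ {n} {Q : List (Fin n)} → Unique Q → length Q ≤ n
unique-length≤ {n} {Q} u = begin
  length Q                        ≡⟨ sym (trans (∑-const Q 1) (*-identityʳ _)) ⟩
  ∑ Q (λ _ → 𝟙 true)              ≤⟨ ∑-unique≤ (λ _ → true) u ⟩
  ∑F {n} (λ _ → 1)                ≡⟨ trans (∑F-const {n} 1) (*-identityʳ n) ⟩
  n ∎
  where open ≤-Reasoning

-- What the finished game provides: `RM` is Maker's graph and `R₁` its part from the pairs. The path
-- to be closed is known only afterwards, so `gather` quantifies over it and returns a graph `R`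
-- between `R₁` and `RM`, containing the path, whose boosters Maker has hit.
record Boosted {n} (D : ℕ) (RM R₁ : Fin n → Fin n → Bool) : Set where
  field
    RM-sym : ∀ {x y} → RM x y ≡ true → RM y x ≡ true
    R₁⊆RM  : ∀ {x y} → R₁ x y ≡ true → RM x y ≡ true
    R₁-exp : Expands D R₁
    cuts   : ∀ (S : Fin n → Bool) → n * n ≤ D * D * ∑∑ (λ u v → 𝟙 (S u ∧ not (S v))) →
             ∃[ u ] ∃[ v ] (RM u v ≡ true × (S u ≡ true × S v ≡ false))
    gather : ∀ Q → linked RM Q ≡ true → length Q ≤ n → Σ (Fin n → Fin n → Bool) λ R →
             (∀ {x y} → R x y ≡ true → R y x ≡ true)
             × (∀ {x y} → R₁ x y ≡ true → R x y ≡ true)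
             × (∀ {x y} → R x y ≡ true → RM x y ≡ true)
             × linked R Q ≡ true
             × (n * n ≤ D * D * ∑∑ (λ b a → 𝟙 (joins R (length Q) b a)) →
                ∃[ u ] ∃[ v ] (RM u v ≡ true × joins R (length Q) u v ≡ true))

linked-mono : ∀ {n} {R R′ : Fin n → Fin n → Bool} → (∀ {x y} → R x y ≡ true → R′ x y ≡ true) →
  ∀ Q → linked R Q ≡ true → linked R′ Q ≡ true
linked-mono h []          l = refl
linked-mono h (x ∷ [])    l = refl
linked-mono {R = R} h (x ∷ y ∷ Q) l = ∧-t⁺ (h (proj₁ (∧-t⁻ {R x y} l))) (linked-mono h (y ∷ Q) (proj₂ (∧-t⁻ {R x y} l)))

linked-++⁺ : ∀ {n} (R : Fin n → Fin n → Bool) x X y Y {z} → lastIs z (x ∷ X) ≡ true → R z y ≡ true →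
  linked R (x ∷ X) ≡ true → linked R (y ∷ Y) ≡ true → linked R ((x ∷ X) ++ (y ∷ Y)) ≡ true
linked-++⁺ R x []       y Y z e l k with ==-t⁻ z
... | refl = ∧-t⁺ e k
linked-++⁺ R x (x′ ∷ X) y Y z e l k = ∧-t⁺ (proj₁ (∧-t⁻ {R x x′} l)) (linked-++⁺ R x′ X y Y z e (proj₂ (∧-t⁻ {R x x′} l)) k)

module Closing {n : ℕ} (n≥3 : 3 ≤ n) (D : ℕ) {RM R₁ : Fin n → Fin n → Bool} (bst : Boosted D RM R₁)
               (mk : List (Edge n)) (RM⇒Adj : ∀ {x y} → RM x y ≡ true → Adj mk x y) where
  open Boosted bst

  walk : ∀ x Q {z y} → linked RM (x ∷ Q) ≡ true → lastIs z (x ∷ Q) ≡ true → RM z y ≡ true → Walk mk (x ∷ Q ++ [ y ])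
  walk x []       l k e with ==-t⁻ k
  ... | refl = RM⇒Adj e , tt
  walk x (x′ ∷ Q) l k e = RM⇒Adj (proj₁ (∧-t⁻ {RM x x′} l)) , walk x′ Q (proj₂ (∧-t⁻ {RM x x′} l)) k e

  -- A small `S`, or a small complement, is left by expansion with U the set itself. If both have
  -- more than n/D vertices, the cut is dense enough to be one of the targets of the game.
  leaving : ∀ (S : Fin n → Bool) → 1 ≤ ∑F (λ x → 𝟙 (S x)) → 1 ≤ ∑F (λ x → 𝟙 (not (S x))) →
    ∃[ u ] ∃[ v ] (RM u v ≡ true × (S u ≡ true × S v ≡ false))
  leaving S s≥1 o≥1 with D * ∑F (λ x → 𝟙 (S x)) ≤? n | D * ∑F (λ x → 𝟙 (not (S x))) ≤? n
  ... | yes h | _ with R₁-exp S S s≥1 h (λ x q → q) (m≤m+n _ _)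
  ... | v , m , sv , vm , sm = v , m , R₁⊆RM vm , sv , sm
  leaving S s≥1 o≥1 | no _ | yes h with R₁-exp (λ x → not (S x)) (λ x → not (S x)) o≥1 h (λ x q → q) (m≤m+n _ _)
  ... | v , m , sv , vm , sm = m , v , RM-sym (R₁⊆RM vm) , not-f⁻ sm , not-t⁻ sv
  leaving S s≥1 o≥1 | no h | no h′ = cuts S (begin
    n * n ≤⟨ *-mono-≤ (<⇒≤ (≰⇒> h)) (<⇒≤ (≰⇒> h′)) ⟩
    D * s * (D * o) ≡⟨ l D s o ⟩
    D * D * (s * o) ≡⟨ cong (D * D *_) (sym so) ⟩
    D * D * ∑∑ (λ u v → 𝟙 (S u ∧ not (S v))) ∎)
    where
    open ≤-Reasoning
    s = ∑F (λ x → 𝟙 (S x))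
    o = ∑F (λ x → 𝟙 (not (S x)))
    l : ∀ a b c → a * b * (a * c) ≡ a * a * (b * c)
    l = solve-∀
    so : ∑∑ (λ u v → 𝟙 (S u ∧ not (S v))) ≡ s * o
    so = trans (∑∑-cong (λ u v → 𝟙-∧ (S u) _)) (trans (∑-cong (allFin n) (λ u → ∑-*ˡ (allFin n) (𝟙 (S u)) _)) (∑-*ʳ (allFin n) _ o))

  -- The edge zx makes the path a cycle; it is cut open at u, and the outside vertex v is put in
  -- front.
  extend : ∀ x Q {ℓ z u v} → Path RM ℓ (x ∷ Q) → lastIs z (x ∷ Q) ≡ true → RM z x ≡ true →
    u ∈ (x ∷ Q) → v ∉ (x ∷ Q) → RM u v ≡ true → ∃[ Q′ ] Path RM (suc ℓ) Q′
  extend x Q {z = z} {u} {v} (mkPath us l refl) k e m v∉ uv with split-at m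
  ... | [] , C , refl = v ∷ x ∷ Q , mkPath (All.tabulate (λ q eq → v∉ (subst (_∈ (x ∷ Q)) (sym eq) q)) ∷ us) (∧-t⁺ (RM-sym uv) l) refl
  ... | x′ ∷ X , C , refl = v ∷ (u ∷ C) ++ (x ∷ X) ,
      mkPath (All.tabulate (λ q eq → v∉ (∈-resp-↭ pm (subst (_∈ ((u ∷ C) ++ (x ∷ X))) (sym eq) q))) ∷ Unique-resp-↭ (↭-sym pm) us)
             (∧-t⁺ (RM-sym uv) (linked-++⁺ RM u C x X (trans (sym (last-++ (x ∷ X) z)) k) e
                (linked-++⁻ʳ RM (x ∷ X) l) (linked-++⁻ˡ RM (x ∷ X) l)))
             (cong suc (↭-length pm))
      where
      pm : (u ∷ C) ++ (x ∷ X) ↭ (x ∷ X) ++ (u ∷ C)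
      pm = ++-comm (u ∷ C) (x ∷ X)

  step : ∀ ℓ {Q} → 1 ≤ ℓ → Path RM ℓ Q → HasHamCycle n mk ⊎ (∃[ Q′ ] Path RM (suc ℓ) Q′)
  step ℓ {Q} ℓ≥1 path with bool? (hasPath RM (suc ℓ))
  ... | inj₁ h = inj₂ (hasPath⁻ h)
  ... | inj₂ h with Path.len path
  ... | refl with gather Q (Path.lnk path) (unique-length≤ (Path.uniq path))
  ... | R , R-sym , R₁⊆R , R⊆RM , lR , hit = closing (hit (many-pairs (mkPath (Path.uniq path) lR refl) ℓ≥1))
    where
    -- Longer paths were excluded in `RM`, but rotations take place in the smaller `R`; an extension
    -- in `R` would be one in `RM`.
    maximal : ∀ {Q′ x y} → Path R ℓ Q′ → headIs x Q′ ≡ true → R x y ≡ true → y ∈ Q′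
    maximal {q ∷ Q′} {x} {y} (mkPath u l e) hd xy with ==-t⁻ hd | bool? (y ∈F (q ∷ Q′))
    ... | refl | inj₁ m = ∈F-t⁻ m
    ... | refl | inj₂ m = ⊥-elim (t≢f (hasPath⁺ {R = RM} {Q = y ∷ q ∷ Q′}
            (mkPath (All.tabulate (λ r eq → t≢f (∈F-t⁺ (subst (_∈ (q ∷ Q′)) (sym eq) r)) m) ∷ u)
                    (∧-t⁺ (RM-sym (R⊆RM xy)) (linked-mono R⊆RM (q ∷ Q′) l)) (cong suc e))) h)
    R-exp : Expands D R
    R-exp S U h₁ h₂ h₃ h₄ = let v , m , p , q , r = R₁-exp S U h₁ h₂ h₃ h₄ in v , m , p , R₁⊆R q , r
    open Posa {n} {D} R R-sym R-exp {ℓ} maximal using (many-pairs)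
    closing : ∃[ u ] ∃[ v ] (RM u v ≡ true × joins R ℓ u v ≡ true) → HasHamCycle n mk ⊎ (∃[ Q′ ] Path RM (suc ℓ) Q′)
    closing (u , v , uv , j) with joins⁻ j
    ... | x ∷ Q′ , mkPath us l e , hd , ls with ==-t⁻ hd
    ... | refl with bool? (allB (λ y → y ∈F (x ∷ Q′)) (allFin n))
    ... | inj₁ all = inj₁ (n≥3 , x , Q′ ,
            unique-↭ us (allFin-Unique n) (λ {y} _ → ∈-allFin y) (λ {y} m → ∈F-t⁻ (allB-t⁻ _ (allFin n) all m)) ,
            walk x Q′ (linked-mono R⊆RM (x ∷ Q′) l) ls (RM-sym uv))
    ... | inj₂ some with allB-f⁻ _ (allFin n) some
    ... | y , _ , y∉ with leaving (λ t → t ∈F (x ∷ Q′))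
           (≤-trans (≤-reflexive (cong 𝟙 (sym (∈F-t⁺ {x = x} {x ∷ Q′} (here refl))))) (∈⇒≤∑ (λ t → 𝟙 (t ∈F (x ∷ Q′))) (∈-allFin x)))
           (≤-trans (≤-reflexive (cong (λ t → 𝟙 (not t)) (sym y∉))) (∈⇒≤∑ (λ t → 𝟙 (not (t ∈F (x ∷ Q′)))) (∈-allFin y)))
    ... | a , b , ab , a∈ , b∉ = inj₂ (extend x Q′ (mkPath us (linked-mono R⊆RM (x ∷ Q′) l) e) ls (RM-sym uv)
            (∈F-t⁻ a∈) (λ m → t≢f (∈F-t⁺ m) b∉) ab)

  hamilton-from : ∀ c ℓ {Q} → 1 ≤ ℓ → suc n ≤ c + ℓ → Path RM ℓ Q → HasHamCycle n mk
  hamilton-from zero    ℓ h₁ h₂ path = ⊥-elim (<-irrefl refl (≤-trans h₂ (≤-trans (≤-reflexive (sym (Path.len path))) (unique-length≤ (Path.uniq path)))))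
  hamilton-from (suc c) ℓ h₁ h₂ path with step ℓ h₁ path
  ... | inj₁ H = H
  ... | inj₂ (Q′ , path′) = hamilton-from c (suc ℓ) (s≤s z≤n) (≤-trans h₂ (≤-reflexive (sym (+-suc c ℓ)))) path′

  hamilton : HasHamCycle n mk
  hamilton = hamilton-from n 1 (s≤s z≤n) (≤-reflexive (+-comm 1 n)) (mkPath {Q = v ∷ []} ([] ∷ []) refl refl)
    where
    v : Fin n
    v = F.fromℕ< {0} (≤-trans (s≤s z≤n) n≥3)

-- Maker's strategy on a typical graph

at-tab : ∀ {n} (S : Fin n → Bool) x → at (tab S) x ≡ S x
at-tab S x = VP.lookup∘tabulate S x

wt-tab : ∀ {n} (S : Fin n → Bool) → wt (tab S) ≡ ∑F (λ x → 𝟙 (S x))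
wt-tab {n} S = trans (wt-at (tab S)) (∑-cong (allFin n) (λ x → cong 𝟙 (at-tab S x)))

⊆ᵇ-at : ∀ {n} (v w : Vec Bool n) → (∀ i → at v i ≡ true → at w i ≡ true) → (v ⊆ᵇ w) ≡ true
⊆ᵇ-at []          []      h = refl
⊆ᵇ-at (true ∷ v)  (b ∷ w) h = ∧-t⁺ (h fz refl) (⊆ᵇ-at v w (λ i → h (fs i)))
⊆ᵇ-at (false ∷ v) (b ∷ w) h = ⊆ᵇ-at v w (λ i → h (fs i))

Index : ℕ → Set
Index n = Graph n × (ℕ ⊎ Vec Bool n)

Js : ∀ n → List (ℕ ⊎ Vec Bool n)
Js n = map inj₁ (upTo (suc n)) ++ map inj₂ (allVecs n)

-- The pairs that help Maker: ends of Γ-paths with ℓ vertices, or pairs crossing a cut.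
target : ∀ {n} → Index n → Fin n → Fin n → Bool
target (Γ , inj₁ ℓ) b a = joins (adj Γ) ℓ b a
target (Γ , inj₂ S) u v = at S u ∧ not (at S v)

∣_∣ₜ : ∀ {n} → Index n → ℕ
∣ i ∣ₜ = ∑∑ (λ x z → 𝟙 (target i x z))

-- 9n = 8n + n: the 4n pairs have 8n edges, and a path has fewer than n more.
sparse : ∀ {n} → Graph n → Graph n → Bool
sparse {n} g Γ = (Graph.bits Γ ⊆ᵇ Graph.bits g) ∧ (wt (Graph.bits Γ) ≤ᵇ 9 * n)

dense : ∀ {n} → ℕ → Index n → Bool
dense {n} D i = n * n ≤ᵇ D * D * ∣ i ∣ₜ

relevant : ∀ {n} → ℕ → Graph n → Index n → Bool
relevant D g i = sparse g (proj₁ i) ∧ dense D i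

indices : ∀ {n} → ℕ → Graph n → List (Index n)
indices {n} D g = boolFilter (relevant D g) (allGraphs n ⊗ Js n)

βof : ∀ {n} → Graph n → Index n → ℕ
βof g i = ∑∑ (λ x z → 𝟙 (adj g x z) * 𝟙 (target i x z))

pathEdges : ∀ {n} → List (Fin n) → List (Edge n)
pathEdges []          = []
pathEdges (x ∷ [])    = []
pathEdges (x ∷ y ∷ r) = nrm x y ∷ pathEdges (y ∷ r)

length-pathEdges : ∀ {n} (Q : List (Fin n)) → length (pathEdges Q) ≤ length Q
length-pathEdges []          = z≤n
length-pathEdges (x ∷ [])    = z≤n
length-pathEdges (x ∷ y ∷ r) = s≤s (length-pathEdges (y ∷ r))

module Strategy (n d b : ℕ) (h16 : 2 * (8 * b) ≤ d) (1≤d : 1 ≤ d) (d≤ : d ≤ 32 * b)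
                (C : ℕ) (hC : C ≡ 2 * 2 * 2 * (4 * 4 * 4) * (64 * 64 * 64 * 64) * 3) (n≥ : 8 * d + 8 ≤ n)
                (g : Graph n) (reg : isRegular d g ≡ true) (π : Choices n b)
                (goodπ : Expansion.isBad n d b h16 1≤d d≤ C hC n≥ g π ≡ false) where

  open Slots n d b h16
  open Expansion n d b h16 1≤d d≤ C hC n≥ using (L; length-L; mate; bad; violates)

  D : ℕ
  D = 4 * C

  E₀ : List (Edge n)
  E₀ = edges g

  pair : Fin n × Fin 4 → Bool → Edge n
  pair σ s = nrm (proj₁ σ) (mate g π σ s)

  pair-inj : ∀ {k k′ s s′} → pair k s ≡ pair k′ s′ → k ≡ k′ × s ≡ s′
  pair-inj {v , p} {v′ , p′} {s} {s′} e with nrm-inj {u = v} {mate g π (v , p) s} {v′} {mate g π (v′ , p′) s′} e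
  ... | inj₁ (refl , q) = let a , b , _ = tgt-inj g reg v {p} {p′} {s} {s′} q in cong (v ,_) a , b
  ... | inj₂ (q , r) = ⊥-elim (tgt-anti g reg {v′} {v} {p} {p′} {s} {s′} r (sym q))

  pair-∈ : ∀ σ s → pair σ s ∈ E₀
  pair-∈ (v , p) s = adj⇒∈ g (tgt-adj g reg v p s _)

  pairs : List (Edge n)
  pairs = map (λ k → pair (proj₁ k) (proj₂ k)) (L ⊗ Sides)

  pair-∈-pairs : ∀ σ s → pair σ s ∈ pairs
  pair-∈-pairs (v , p) s = ∈-map⁺ (λ k → pair (proj₁ k) (proj₂ k)) (∈-⊗ (∈-⊗ (∈-allFin v) (∈-allFin p)) (side s))
    where
    side : ∀ s → s ∈ Sides
    side false = here refl
    side true  = there (here refl)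

  length-pairs : length pairs ≡ 8 * n
  length-pairs = trans (length-map _ (L ⊗ Sides)) (trans (length-⊗ L Sides) (trans (cong (_* 2) length-L) (l n)))
    where
    l : ∀ n → n * 4 * 2 ≡ 8 * n
    l = solve-∀

  crosses : Index n → Edge n → Bool
  crosses i (a , c) = target i a c ∨ target i c a

  -- Edges of the pairs are removed from the boosters, so that the answers inside pairs do not
  -- interfere with the potential.
  A : Index n → Edge n → Bool
  A i f = crosses i f ∧ not (f ∈E pairs)

  A-off : ∀ i k s → A i (pair k s) ≡ false
  A-off i k s = ¬t⇒f (λ e → t≢f (∈E-t⁺ (pair-∈-pairs k s)) (not-t⁻ (proj₂ (∧-t⁻ {crosses i (pair k s)} e))))

  open Game E₀ L pair (indices D g) A (λ {k} {k′} {s} {s′} → pair-inj {k} {k′} {s} {s′}) A-off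

  module _ {mk : List (Edge n)} (good : Good mk) where

    RM R₁ : Fin n → Fin n → Bool
    P₁ : List (Edge n)
    RM u v = nrm u v ∈E mk
    P₁ = boolFilter (_∈E mk) pairs
    R₁ u v = nrm u v ∈E P₁

    mk⊆ : ∀ {f} → f ∈ mk → f ∈ E₀
    mk⊆ = proj₁ good

    P₁⊆ : ∀ {f} → f ∈ P₁ → f ∈ mk
    P₁⊆ {f} m = ∈E-t⁻ (proj₂ (∈-boolFilter⁻ (_∈E mk) pairs m))

    edge⇒adj : ∀ {f} → f ∈ E₀ → f ∈ completeEdges n × lk g f ≡ true
    edge⇒adj m = ∈-select⁻ (completeEdges n) (Graph.bits g) (complete-Unique n) m

    nrm-edge : ∀ {f} → f ∈ E₀ → nrm (proj₁ f) (proj₂ f) ≡ f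
    nrm-edge {a , c} m = nrm-< (proj₂ (∈⇒adj g {a} {c} m))

    hit : ∀ {i} → i ∈ indices D g → ∃[ u ] ∃[ v ] (RM u v ≡ true × target i u v ≡ true)
    hit {i} m with proj₂ (proj₂ good) m
    ... | (a , c) , f∈ , q with ∨-t⁻ {target i a c} (proj₁ (∧-t⁻ {crosses i (a , c)} q))
    ... | inj₁ t = a , c , ∈E-t⁺ (subst (_∈ mk) (sym (nrm-edge (mk⊆ f∈))) f∈) , t
    ... | inj₂ t = c , a , ∈E-t⁺ (subst (_∈ mk) (sym (trans (nrm-sym c a) (nrm-edge (mk⊆ f∈)))) f∈) , t

    index-∈ : ∀ Γ j → sparse g Γ ≡ true → dense D (Γ , j) ≡ true → j ∈ Js n → (Γ , j) ∈ indices D g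
    index-∈ Γ j s h m = ∈-boolFilter⁺ (relevant D g) (allGraphs n ⊗ Js n) (∈-⊗ (∈-allGraphs Γ) m) (∧-t⁺ s h)

    -- Since the choice is good, some slot of S has both mates outside U, and Maker owns the edge to
    -- one of them, whichever it is.
    expands : Expands D R₁
    expands S U s≥1 small S⊆U U≤ with bool? (bad g π (tab S) (tab U))
    ... | inj₁ q = ⊥-elim (t≢f (anyB-t⁺ (violates g π) (∈-⊗ (∈-allVecs (tab S)) (∈-allVecs (tab U)))
            (∧-t⁺ (∧-t⁺ (≤ᵇ-t⁺ (subst (1 ≤_) (sym (wt-tab S)) s≥1)) (≤ᵇ-t⁺ (subst (λ t → 4 * C * t ≤ n) (sym (wt-tab S)) small)))
                  (∧-t⁺ (∧-t⁺ (⊆ᵇ-at (tab S) (tab U) (λ i e → trans (at-tab U i) (S⊆U i (trans (sym (at-tab S i)) e))))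
                              (≤ᵇ-t⁺ (subst₂ (λ s u → u ≤ 3 * s) (sym (wt-tab S)) (sym (wt-tab U)) U≤))) q))) goodπ)
    ... | inj₂ q with allB-f⁻ _ L q
    ... | σ@(v , p) , m , f with proj₁ (proj₂ good) {σ} m
    ... | s , e∈ = v , mate g π σ s , trans (sym (at-tab S v)) (fst f) ,
                   ∈E-t⁺ (∈-boolFilter⁺ (_∈E mk) pairs (pair-∈-pairs σ s) (∈E-t⁺ e∈)) ,
                   trans (sym (at-tab U _)) (snd s f)
      where
      fst : ∀ {a b} → not a ∨ b ≡ false → a ≡ true
      fst {true} _ = refl
      or-f : ∀ a b c → not a ∨ (b ∨ c) ≡ false → b ≡ false × c ≡ false
      or-f true false false _ = refl , refl
      snd : ∀ s → not (at (tab S) v) ∨ (at (tab U) (mate g π σ false) ∨ at (tab U) (mate g π σ true)) ≡ false →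
            at (tab U) (mate g π σ s) ≡ false
      snd false f = proj₁ (or-f (at (tab S) v) (at (tab U) (mate g π σ false)) _ f)
      snd true  f = proj₂ (or-f (at (tab S) v) (at (tab U) (mate g π σ false)) _ f)

    collect : List (Edge n) → Graph n
    collect Es = graph (mkV (completeEdges n) (_∈E Es))

    collect-sparse : ∀ Es → (∀ {f} → f ∈ Es → f ∈ mk) → length Es ≤ 9 * n → sparse g (collect Es) ≡ true
    collect-sparse Es sub le = ∧-t⁺
      (mkV-⊆ᵇ (completeEdges n) (_∈E Es) (Graph.bits g) (complete-Unique n) (λ f _ q → proj₂ (edge⇒adj (mk⊆ (sub (∈E-t⁻ q))))))
      (≤ᵇ-t⁺ (≤-trans (≤-reflexive (wt-mkV {n} (completeEdges n) (_∈E Es))) (≤-trans (∑-∈E≤ Es (complete-Unique n)) le)))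

    collect-adj⁺ : ∀ Es → (∀ {f} → f ∈ Es → f ∈ mk) → ∀ {x y} → nrm x y ∈ Es → adj (collect Es) x y ≡ true
    collect-adj⁺ Es sub {x} {y} m = trans (look-mkV (completeEdges n) (_∈E Es) (nrm x y) (proj₁ (edge⇒adj (mk⊆ (sub m))))) (∈E-t⁺ m)

    collect-adj⁻ : ∀ Es {x y} → adj (collect Es) x y ≡ true → nrm x y ∈ Es
    collect-adj⁻ Es {x} {y} a = ∈E-t⁻ (trans (sym (look-mkV (completeEdges n) (_∈E Es) (nrm x y) (nrm-∈ (adj⇒≢ (collect Es) a)))) a)

    ∈-upTo-suc : ∀ {ℓ} → ℓ ≤ n → ℓ ∈ upTo (suc n)
    ∈-upTo-suc le = ∈-upTo⁺ (s≤s le)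

    boosted : Boosted D RM R₁
    boosted = record
      { RM-sym = λ {x} {y} → subst (λ f → f ∈E mk ≡ true) (nrm-sym x y)
      ; R₁⊆RM  = λ e → ∈E-t⁺ (P₁⊆ (∈E-t⁻ e))
      ; R₁-exp = expands
      ; cuts   = cuts
      ; gather = gather
      }
      where
      cuts : ∀ (S : Fin n → Bool) → n * n ≤ D * D * ∑∑ (λ u v → 𝟙 (S u ∧ not (S v))) →
             ∃[ u ] ∃[ v ] (RM u v ≡ true × (S u ≡ true × S v ≡ false))
      -- The target of a cut does not involve the subgraph; the empty graph completes the index.
      cuts S h with hit (index-∈ (collect []) (inj₂ (tab S)) (collect-sparse [] (λ ()) z≤n)
                 (≤ᵇ-t⁺ (subst (λ t → n * n ≤ D * D * t) (∑∑-cong (λ u v → cong₂ (λ a c → 𝟙 (a ∧ not c)) (sym (at-tab S u)) (sym (at-tab S v)))) h))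
                 (∈-++⁺ʳ (map inj₁ (upTo (suc n))) (∈-map⁺ inj₂ (∈-allVecs (tab S)))))
      ... | u , v , uv , t with ∧-t⁻ {at (tab S) u} t
      ... | su , sv = u , v , uv , trans (sym (at-tab S u)) su , trans (sym (at-tab S v)) (not-t⁻ sv)
      gather : ∀ Q → linked RM Q ≡ true → length Q ≤ n → Σ (Fin n → Fin n → Bool) λ R →
             (∀ {x y} → R x y ≡ true → R y x ≡ true)
             × (∀ {x y} → R₁ x y ≡ true → R x y ≡ true)
             × (∀ {x y} → R x y ≡ true → RM x y ≡ true)
             × linked R Q ≡ true
             × (n * n ≤ D * D * ∑∑ (λ b a → 𝟙 (joins R (length Q) b a)) →
                ∃[ u ] ∃[ v ] (RM u v ≡ true × joins R (length Q) u v ≡ true))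
      gather Q l le = adj Γ , (λ {x} {y} e → trans (adj-sym Γ y x) e) ,
          (λ {x} {y} e → collect-adj⁺ Es sub {x} {y} (∈-++⁺ˡ {xs = P₁} (∈E-t⁻ {x = nrm x y} {P₁} e))) ,
          (λ e → ∈E-t⁺ (sub (collect-adj⁻ Es e))) ,
          lnk Q (λ m → ∈-++⁺ʳ P₁ m) ,
          (λ h → hit (index-∈ Γ (inj₁ (length Q)) (collect-sparse Es sub len) (≤ᵇ-t⁺ h)
                   (∈-++⁺ˡ (∈-map⁺ inj₁ (∈-upTo-suc le)))))
        where
        Es : List (Edge n)
        Es = P₁ ++ pathEdges Q
        Γ = collect Es
        path⊆ : ∀ Q → linked RM Q ≡ true → ∀ {f} → f ∈ pathEdges Q → f ∈ mk
        path⊆ (x ∷ y ∷ r) l (here refl) = ∈E-t⁻ (proj₁ (∧-t⁻ {RM x y} l))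
        path⊆ (x ∷ y ∷ r) l (there m)   = path⊆ (y ∷ r) (proj₂ (∧-t⁻ {RM x y} l)) m
        sub : ∀ {f} → f ∈ Es → f ∈ mk
        sub m with ∈-++⁻ P₁ m
        ... | inj₁ q = P₁⊆ q
        ... | inj₂ q = path⊆ Q l q
        lnk : ∀ Q → (∀ {f} → f ∈ pathEdges Q → f ∈ Es) → linked (adj Γ) Q ≡ true
        lnk []          h = refl
        lnk (x ∷ [])    h = refl
        lnk (x ∷ y ∷ r) h = ∧-t⁺ (collect-adj⁺ Es sub {x} {y} (h (here refl))) (lnk (y ∷ r) (λ m → h (there m)))
        len : length Es ≤ 9 * n
        len = begin
          length Es                              ≡⟨ length-++ P₁ ⟩
          length P₁ + length (pathEdges Q)       ≤⟨ +-mono-≤ (≤-trans (≤-reflexive (length-boolFilter _ pairs)) (≤-trans (∑-≤const pairs 1 (λ f → 𝟙≤1 (f ∈E mk))) (≤-reflexive (*-identityʳ _))))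
                                                             (≤-trans (length-pathEdges Q) le) ⟩
          length pairs + n                       ≡⟨ trans (cong (_+ n) length-pairs) (l′ n) ⟩
          9 * n ∎
          where
          open ≤-Reasoning
          l′ : ∀ n → 8 * n + n ≡ 9 * n
          l′ = solve-∀

    RM⇒Adj : ∀ {x y} → RM x y ≡ true → Adj mk x y
    RM⇒Adj {x} {y} e with x <F y | ∈E-t⁻ {x = nrm x y} {mk} e
    ... | true  | m = inj₁ m
    ... | false | m = inj₂ m

    wins : HasHamCycle n mk
    wins = Closing.hamilton (≤-trans (≤ᵇ-t⁻ 3 8 refl) (≤-trans (m≤n+m 8 (8 * d)) n≥)) D boosted mk RM⇒Adj

  module _ (t : ℕ) (boosters : ∀ {i} → i ∈ indices D g → 4 * t < βof g i)
           (few-indices : 2 * length (indices D g) * 2 ^ (8 * n) < 2 ^ (2 * t)) where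

    -- `βof` counts ordered pairs, so an edge contributes up to 2; removing the 8n edges of the
    -- pairs costs the last summand.
    A-many : ∀ {i} → i ∈ indices D g → 2 * t ≤ ∑ E₀ (λ f → 𝟙 (A i f)) + 8 * n
    A-many {i} m = *-cancelˡ-≤ 2 (begin
      2 * (2 * t)                           ≡⟨ sym (*-assoc 2 2 t) ⟩
      4 * t                                 ≤⟨ <⇒≤ (boosters m) ⟩
      βof g i                               ≡⟨ ∑-adj g (λ x z → 𝟙 (target i x z)) ⟩
      ∑ E₀ (λ f → 𝟙 (target i (proj₁ f) (proj₂ f)) + 𝟙 (target i (proj₂ f) (proj₁ f)))
                                            ≤⟨ ∑-mono E₀ (λ { (a , c) → pt (target i a c) (target i c a) ((a , c) ∈E pairs) }) ⟩
      ∑ E₀ (λ f → 2 * (𝟙 (A i f) + 𝟙 (f ∈E pairs)))  ≡⟨ trans (∑-*ˡ E₀ 2 _) (cong (2 *_) (∑-+ E₀ _ _)) ⟩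
      2 * (∑ E₀ (λ f → 𝟙 (A i f)) + ∑ E₀ (λ f → 𝟙 (f ∈E pairs)))
                                            ≤⟨ *-monoʳ-≤ 2 (+-monoʳ-≤ (∑ E₀ (λ f → 𝟙 (A i f))) (≤-trans (∑-∈E≤ pairs (edges-Unique g)) (≤-reflexive length-pairs))) ⟩
      2 * (∑ E₀ (λ f → 𝟙 (A i f)) + 8 * n) ∎)
      where
      open ≤-Reasoning
      pt : ∀ x y p → 𝟙 x + 𝟙 y ≤ 2 * (𝟙 ((x ∨ y) ∧ not p) + 𝟙 p)
      pt true  true  true  = ≤-refl
      pt true  true  false = ≤-refl
      pt true  false true  = s≤s z≤n
      pt true  false false = s≤s z≤n
      pt false true  true  = s≤s z≤n
      pt false true  false = s≤s z≤n
      pt false false p     = z≤n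

    erdős-selfridge : 2 * ∑ (indices D g) (λ i → w i E₀) < 2 ^ length E₀
    erdős-selfridge = *-cancelʳ-< (2 ^ (2 * t)) _ _ (begin-strict
      2 * ∑ is (λ i → w i E₀) * 2 ^ (2 * t)                ≡⟨ trans (*-assoc 2 (∑ is (λ i → w i E₀)) (2 ^ (2 * t))) (cong (2 *_) (sym (∑-*ʳ is (λ i → w i E₀) (2 ^ (2 * t))))) ⟩
      2 * ∑ is (λ i → w i E₀ * 2 ^ (2 * t))                ≤⟨ *-monoʳ-≤ 2 (∑-mono-∈ is (λ i m → each i m)) ⟩
      2 * ∑ is (λ _ → 2 ^ (8 * n) * 2 ^ length E₀)         ≡⟨ cong (2 *_) (∑-const is (2 ^ (8 * n) * 2 ^ length E₀)) ⟩
      2 * (length is * (2 ^ (8 * n) * 2 ^ length E₀))      ≡⟨ l (length is) (2 ^ (8 * n)) (2 ^ length E₀) ⟩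
      2 ^ length E₀ * (2 * length is * 2 ^ (8 * n))        <⟨ *-monoʳ-< (2 ^ length E₀) {{m^n≢0 2 (length E₀)}} few-indices ⟩
      2 ^ length E₀ * 2 ^ (2 * t) ∎)
      where
      open ≤-Reasoning
      is = indices D g
      l : ∀ a b c → 2 * (a * (b * c)) ≡ c * (2 * a * b)
      l = solve-∀
      each : ∀ i → i ∈ is → w i E₀ * 2 ^ (2 * t) ≤ 2 ^ (8 * n) * 2 ^ length E₀
      each i m = begin
        2 ^ x * 2 ^ (2 * t)        ≤⟨ *-monoʳ-≤ (2 ^ x) (^-monoʳ-≤ 2 (A-many m)) ⟩
        2 ^ x * 2 ^ (y + 8 * n)    ≡⟨ sym (^-distribˡ-+-* 2 x (y + 8 * n)) ⟩
        2 ^ (x + (y + 8 * n))      ≡⟨ cong (2 ^_) (trans (l₂ x y (8 * n)) (cong (8 * n +_) tot)) ⟩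
        2 ^ (8 * n + length E₀)    ≡⟨ ^-distribˡ-+-* 2 (8 * n) (length E₀) ⟩
        2 ^ (8 * n) * 2 ^ length E₀ ∎
        where
        x = ∑ E₀ (λ f → 𝟙 (not (A i f)))
        y = ∑ E₀ (λ f → 𝟙 (A i f))
        l₂ : ∀ x y z → x + (y + z) ≡ z + (y + x)
        l₂ = solve-∀
        tot : y + x ≡ length E₀
        tot = trans (sym (∑-+ E₀ _ _)) (trans (∑-cong E₀ (λ f → 𝟙-not (A i f))) (sym (length-∑ E₀)))

    maker-wins-g : MakerWinsHam g
    maker-wins-g = maker-wins wins (edges-Unique g) (λ {k} _ s → pair-∈ k s) erdős-selfridge

-- Every sparse subgraph of a typical graph has many boosters

-- The exponent is covered by r blocks of length q, each contributing (1 + 1/q)^q ≤ 4.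
power-blocks : ∀ q r W → 1 ≤ q → W ≤ r * q → suc q ^ W ≤ 4 ^ r * q ^ W
power-blocks q@(suc _) r W _ h = *-cancelʳ-≤ _ _ (q ^ k) {{m^n≢0 q k}} (begin
  suc q ^ W * q ^ k        ≤⟨ *-monoʳ-≤ (suc q ^ W) (^-monoˡ-≤ k (n≤1+n q)) ⟩
  suc q ^ W * suc q ^ k    ≡⟨ sym (^-distribˡ-+-* (suc q) W k) ⟩
  suc q ^ (W + k)          ≡⟨ cong (suc q ^_) Wk ⟩
  suc q ^ (q * r)          ≡⟨ sym (^-*-assoc (suc q) q r) ⟩
  (suc q ^ q) ^ r          ≤⟨ ^-monoˡ-≤ r (suc-power q) ⟩
  (4 * q ^ q) ^ r          ≡⟨ *-^ r 4 (q ^ q) ⟩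
  4 ^ r * (q ^ q) ^ r      ≡⟨ cong (4 ^ r *_) (trans (^-*-assoc q q r) (cong (q ^_) (sym Wk))) ⟩
  4 ^ r * q ^ (W + k)      ≡⟨ cong (4 ^ r *_) (^-distribˡ-+-* q W k) ⟩
  4 ^ r * (q ^ W * q ^ k)  ≡⟨ sym (*-assoc (4 ^ r) (q ^ W) (q ^ k)) ⟩
  4 ^ r * q ^ W * q ^ k ∎)
  where
  open ≤-Reasoning
  k = r * q ∸ W
  Wk : W + k ≡ q * r
  Wk = trans (m+[n∸m]≡n h) (*-comm r q)

∑-allGraphs : ∀ n (f : Graph n → ℕ) → ∑ (allGraphs n) f ≡ ∑ (allVecs _) (λ v → f (graph v))
∑-allGraphs n f = ∑-map graph (allVecs _) f

module Boosters (n d D τ q r : ℕ) (n≥1 : 1 ≤ n) (d≥1 : 1 ≤ d) (D≥1 : 1 ≤ D) (q≥1 : 1 ≤ q)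
                (δ≤ : δ d ≤ n) (tails : D * D * (16 * τ + 37) ≤ d) (wts : n * d ≤ 2 * (r * q)) where

  t : ℕ
  t = τ * n

  G : List (Graph n)
  G = allGraphs n

  I : List (Index n)
  I = G ⊗ Js n

  N : ℕ
  N = # (isRegular {n} d)

  poor : Graph n → Bool
  poor g = anyB (λ i → βof g i ≤ᵇ 4 * t) (indices D g)

  light : Graph n → Bool
  light Γ = wt (Graph.bits Γ) ≤ᵇ 9 * n

  Kmax : ℕ
  Kmax = q ^ (9 * n) * 4 ^ r

  -- `subset-count` with x = 1 and y = q: a large q makes (1 + 1/q)^(nd/2) small at the price
  -- q^(9n), whose exponent does not grow with d.
  K-bound : ∀ g → isRegular d g ≡ true → ∑ G (λ Γ → 𝟙 (sparse g Γ)) ≤ Kmax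
  K-bound g reg = *-cancelʳ-≤ _ _ (q ^ W) {{m^n≢0 q W {{>-nonZero q≥1}}}} (begin
    ∑ G (λ Γ → 𝟙 (sparse g Γ)) * q ^ W
      ≡⟨ cong₂ _*_ (∑-allGraphs n _) (sym (trans (cong (_* q ^ W) (^-zeroˡ (9 * n))) (+-identityʳ _))) ⟩
    ∑ (allVecs _) (λ v → 𝟙 ((v ⊆ᵇ Graph.bits g) ∧ (wt v ≤ᵇ 9 * n))) * (1 ^ (9 * n) * q ^ W)
      ≤⟨ subset-count (Graph.bits g) (9 * n) 1 q q≥1 ⟩
    q ^ (9 * n) * suc q ^ W
      ≤⟨ *-monoʳ-≤ (q ^ (9 * n)) (power-blocks q r W q≥1 W≤) ⟩
    q ^ (9 * n) * (4 ^ r * q ^ W)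
      ≡⟨ sym (*-assoc (q ^ (9 * n)) (4 ^ r) (q ^ W)) ⟩
    Kmax * q ^ W ∎)
    where
    open ≤-Reasoning
    W = wt (Graph.bits g)
    W≤ : W ≤ r * q
    W≤ = *-cancelˡ-≤ 2 (≤-trans (≤-reflexive (trans (sym (wt-adj g)) (Regular.∑all d g reg))) wts)

  indices-bound : ∀ g → isRegular d g ≡ true → length (indices D g) ≤ length (Js n) * Kmax
  indices-bound g reg = begin
    length (indices D g)
      ≡⟨ trans (length-boolFilter (relevant D g) I) (∑-⊗ G (Js n) _) ⟩
    ∑ G (λ Γ → ∑ (Js n) (λ j → 𝟙 (relevant D g (Γ , j))))
      ≤⟨ ∑-mono G (λ Γ → ∑-≤const (Js n) (𝟙 (sparse g Γ)) (λ j → 𝟙-mono (λ e → proj₁ (∧-t⁻ {sparse g Γ} e)))) ⟩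
    ∑ G (λ Γ → length (Js n) * 𝟙 (sparse g Γ))
      ≡⟨ ∑-*ˡ G (length (Js n)) _ ⟩
    length (Js n) * ∑ G (λ Γ → 𝟙 (sparse g Γ))
      ≤⟨ *-monoʳ-≤ (length (Js n)) (K-bound g reg) ⟩
    length (Js n) * Kmax ∎
    where open ≤-Reasoning

  poorFor : Index n → Graph n → Bool
  poorFor i = LowerTail.few d (proj₁ i) (target i) (4 * t)

  -- `ext` is the same for every set of pairs, so an empty one is supplied.
  extends : Graph n → Graph n → Bool
  extends Γ = LowerTail.ext d Γ (λ _ _ → false)

  -- The t rounds raise the threshold from 4t to 8t, which gives 16τ after doubling. `loss`
  -- contributes 4 · 9 = 36 for the edges of `Γ` and 1 for `δ d ≤ n`; hence 37.
  tail-bound : ∀ Γ j → light Γ ∧ dense D (Γ , j) ≡ true → 2 ^ t * # (poorFor (Γ , j)) ≤ # (extends Γ)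
  tail-bound Γ j h = lower-tail t (4 * t) {{m*n≢0 n d {{>-nonZero n≥1}} {{>-nonZero d≥1}}}} room
    where
    open LowerTail d Γ (target (Γ , j))
    open ≤-Reasoning
    h′ = ∧-t⁻ {light Γ} h
    W = wt (Graph.bits Γ)
    W≤ : W ≤ 9 * n
    W≤ = ≤ᵇ-t⁻ W (9 * n) (proj₁ h′)
    dn : n * n ≤ D * D * ∣B∣
    dn = ≤ᵇ-t⁻ (n * n) (D * D * ∣ (Γ , j) ∣ₜ) (proj₂ h′)
    DD≢0 : NonZero (D * D)
    DD≢0 = m*n≢0 D D {{>-nonZero D≥1}} {{>-nonZero D≥1}}
    l₁ : ∀ τ n w δ d → 2 * ((τ * n * 4 + 4 * (τ * n)) * (n * d)) + (2 * w + 2 * w + δ) * (n * d) ≡ (16 * (τ * n) + (4 * w + δ)) * (n * d)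
    l₁ = solve-∀
    l₂ : ∀ τ n d → (16 * (τ * n) + (4 * (9 * n) + n)) * (n * d) ≡ (16 * τ + 37) * (n * (n * d))
    l₂ = solve-∀
    l₃ : ∀ d n → d * (n * (n * d)) ≡ n * n * (d * d)
    l₃ = solve-∀
    room : 2 * ((t * 4 + 4 * t) * (n * d)) + loss ≤ ∣B∣ * (d * d)
    room = *-cancelˡ-≤ (D * D) {{DD≢0}} (begin
      D * D * (2 * ((t * 4 + 4 * t) * (n * d)) + loss)
        ≡⟨ cong (D * D *_) (l₁ τ n W (δ d) d) ⟩
      D * D * ((16 * (τ * n) + (4 * W + δ d)) * (n * d))
        ≤⟨ *-monoʳ-≤ (D * D) (*-monoˡ-≤ (n * d) (+-monoʳ-≤ (16 * (τ * n)) (+-mono-≤ (*-monoʳ-≤ 4 W≤) δ≤))) ⟩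
      D * D * ((16 * (τ * n) + (4 * (9 * n) + n)) * (n * d))
        ≡⟨ trans (cong (D * D *_) (l₂ τ n d)) (sym (*-assoc (D * D) (16 * τ + 37) (n * (n * d)))) ⟩
      D * D * (16 * τ + 37) * (n * (n * d))
        ≤⟨ *-monoˡ-≤ (n * (n * d)) tails ⟩
      d * (n * (n * d))
        ≡⟨ l₃ d n ⟩
      n * n * (d * d)
        ≤⟨ *-monoˡ-≤ (d * d) dn ⟩
      D * D * ∣B∣ * (d * d)
        ≡⟨ *-assoc (D * D) ∣B∣ (d * d) ⟩
      D * D * (∣B∣ * (d * d)) ∎)

  -- A union bound over all sparse graphs on [n] would be hopeless. Because `tail-bound` compares
  -- with the graphs containing `Γ`, exchanging the sums leaves only the number of sparse subgraphs
  -- of one regular graph, which is at most `Kmax`.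
  poor-bound : 2 ^ t * # (λ g → isRegular d g ∧ poor g) ≤ length (Js n) * Kmax * N
  poor-bound = begin
    2 ^ t * # (λ g → isRegular d g ∧ poor g)
      ≤⟨ *-monoʳ-≤ (2 ^ t) (≤-trans (∑-mono G pt) (≤-reflexive (trans (∑-swap G I _) (∑-cong I (λ i → ∑-*ˡ G (c i) _))))) ⟩
    2 ^ t * ∑ I (λ i → c i * # (poorFor i))
      ≡⟨ trans (sym (∑-*ˡ I (2 ^ t) _)) (∑-cong I (λ i → x∙yz≈y∙xz (2 ^ t) (c i) (# (poorFor i)))) ⟩
    ∑ I (λ i → c i * (2 ^ t * # (poorFor i)))
      ≤⟨ ∑-mono I (λ { (Γ , j) → ≤-trans (𝟙-*≤ (tail-bound Γ j)) (*-monoˡ-≤ (# (extends Γ)) (𝟙-mono (λ e → proj₁ (∧-t⁻ {light Γ} e)))) }) ⟩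
    ∑ I (λ i → 𝟙 (light (proj₁ i)) * # (extends (proj₁ i)))
      ≡⟨ trans (∑-⊗ G (Js n) _) (trans (∑-cong G (λ Γ → ∑-const (Js n) _)) (∑-*ˡ G (length (Js n)) _)) ⟩
    length (Js n) * ∑ G (λ Γ → 𝟙 (light Γ) * # (extends Γ))
      ≡⟨ cong (length (Js n) *_) (trans (∑-cong G (λ Γ → sym (∑-*ˡ G (𝟙 (light Γ)) _))) (∑-swap G G _)) ⟩
    length (Js n) * ∑ G (λ g → ∑ G (λ Γ → 𝟙 (light Γ) * 𝟙 (extends Γ g)))
      ≤⟨ *-monoʳ-≤ (length (Js n)) (∑-mono G (λ g → ≤-trans (≤-reflexive (rearr g)) (𝟙-*≤ (K-bound g)))) ⟩
    length (Js n) * ∑ G (λ g → 𝟙 (isRegular d g) * Kmax)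
      ≡⟨ cong (length (Js n) *_) (trans (∑-*ʳ G _ Kmax) (*-comm N Kmax)) ⟩
    length (Js n) * (Kmax * N)
      ≡⟨ sym (*-assoc (length (Js n)) Kmax N) ⟩
    length (Js n) * Kmax * N ∎
    where
    open ≤-Reasoning
    c : Index n → ℕ
    c i = 𝟙 (light (proj₁ i) ∧ dense D i)
    rearr : ∀ g → ∑ G (λ Γ → 𝟙 (light Γ) * 𝟙 (extends Γ g)) ≡ 𝟙 (isRegular d g) * ∑ G (λ Γ → 𝟙 (sparse g Γ))
    rearr g = trans (∑-cong G (λ Γ → bl (light Γ) (isRegular d g) (Graph.bits Γ ⊆ᵇ Graph.bits g))) (∑-*ˡ G (𝟙 (isRegular d g)) _)
      where
      bl : ∀ a b c → 𝟙 a * 𝟙 (b ∧ c) ≡ 𝟙 b * 𝟙 (c ∧ a)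
      bl true  true  true  = refl
      bl true  true  false = refl
      bl true  false c     = refl
      bl false true  true  = refl
      bl false true  false = refl
      bl false false c     = refl
    pt : ∀ g → 𝟙 (isRegular d g ∧ poor g) ≤ ∑ I (λ i → c i * 𝟙 (poorFor i g))
    pt g = 𝟙-bound λ e → found (proj₁ (∧-t⁻ {isRegular d g} e)) (anyB-t⁻ _ (indices D g) (proj₂ (∧-t⁻ {isRegular d g} e)))
      where
      found : isRegular d g ≡ true → ∃[ i ] (i ∈ indices D g × (βof g i ≤ᵇ 4 * t) ≡ true) → 1 ≤ ∑ I (λ i → c i * 𝟙 (poorFor i g))
      found reg (i , m , b) with ∈-boolFilter⁻ (relevant D g) I m
      ... | m′ , rel with ∧-t⁻ {sparse g (proj₁ i)} rel
      ... | sp , dn with ∧-t⁻ {Graph.bits (proj₁ i) ⊆ᵇ Graph.bits g} sp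
      ... | sub , lt = ≤-trans (≤-reflexive (sym (cong₂ _*_ (cong 𝟙 (∧-t⁺ lt dn)) (cong 𝟙 (∧-t⁺ (∧-t⁺ reg sub) b)))))
                         (∈⇒≤∑ (λ i → c i * 𝟙 (poorFor i g)) m′)

length-Js : ∀ n → length (Js n) ≤ 2 ^ (1 + n)
length-Js n = begin
  length (Js n)                            ≡⟨ length-++ (map inj₁ (upTo (suc n))) ⟩
  length (map inj₁ (upTo (suc n))) + length (map inj₂ (allVecs n))
    ≡⟨ cong₂ _+_ (trans (length-map inj₁ (upTo (suc n))) (length-upTo (suc n))) (trans (length-map inj₂ (allVecs n)) (length-allVecs n)) ⟩
  suc n + 2 ^ n                            ≤⟨ +-monoˡ-≤ (2 ^ n) (n<2^n n) ⟩
  2 ^ n + 2 ^ n                            ≡⟨ cong (2 ^ n +_) (sym (+-identityʳ _)) ⟩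
  2 ^ (1 + n) ∎
  where
  open ≤-Reasoning
  n<2^n : ∀ n → suc n ≤ 2 ^ n
  n<2^n zero    = ≤-refl
  n<2^n (suc n) = ≤-trans (+-mono-≤ (m^n>0 2 n) (n<2^n n)) (≤-reflexive (cong (2 ^ n +_) (sym (+-identityʳ _))))

-- Combining the bounds

module Parameters (C : ℕ) (hC : C ≡ 2 * 2 * 2 * (4 * 4 * 4) * (64 * 64 * 64 * 64) * 3)
                  (q : ℕ) (hq : q ≡ 16 * (53 * (4 * C * (4 * C)))) where

  -- q is so large that (1 + 1/q)^(nd/2), the entropy of sparse subgraphs, is negligible against 2^t.
  D d₀ : ℕ
  D = 4 * C
  d₀ = q * (9 * q + 12)

  C≥1 : 1 ≤ C
  C≥1 = subst (1 ≤_) (sym hC) (≤ᵇ-t⁻ 1 (2 * 2 * 2 * (4 * 4 * 4) * (64 * 64 * 64 * 64) * 3) refl)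

  D≥1 : 1 ≤ D
  D≥1 = ≤-trans C≥1 (m≤m+n C _)

  DD≥1 : 1 ≤ D * D
  DD≥1 = *-mono-≤ D≥1 D≥1

  q≥16 : 16 ≤ q
  q≥16 = subst (16 ≤_) (sym hq) (big (4 * C * (4 * C)) DD≥1)
    where
    big : ∀ x → 1 ≤ x → 16 ≤ 16 * (53 * x)
    big x h = ≤-trans (≤-reflexive (sym (*-identityʳ 16))) (*-monoʳ-≤ 16 {1} {53 * x} (≤-trans h (m≤m+n x (52 * x))))

  q≥1 : 1 ≤ q
  q≥1 = ≤-trans (s≤s z≤n) q≥16

  instance
    q≢0 : NonZero q
    q≢0 = >-nonZero q≥1

  d₀>0 : 0 < d₀
  d₀>0 = *-mono-≤ q≥1 (≤-trans (s≤s z≤n) (m≤n+m 12 (9 * q)))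

  module _ (d : ℕ) (d≥ : d₀ ≤ d) (k : ℕ) where

    -- Four blocks with two sides use 8b owned edges, about d/2, whence the 16. `ρ * n` counts the
    -- blocks of q exponents in nd/2 up to a constant, and the 16 in `τ` dwarfs the 3 of `exponent`.
    b ρ τ : ℕ
    b = d / 16
    ρ = d / q
    τ = 16 * ρ

    16≤d : 16 ≤ d
    16≤d = ≤-trans q≥16 (≤-trans (≤-trans (≤-reflexive (sym (*-identityʳ q))) (*-monoʳ-≤ q (≤-trans (s≤s z≤n) (m≤n+m 12 (9 * q))))) d≥)

    d≥1 : 1 ≤ d
    d≥1 = ≤-trans (s≤s z≤n) 16≤d

    division : ∀ m → .{{_ : NonZero m}} → m ≤ d → d / m * m ≤ d × d ≤ 2 * (d / m * m)
    division m h = ≤-trans (m≤n+m _ (d % m)) (≤-reflexive (sym (m≡m%n+[m/n]*n d m))) , upper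
      where
      c = d / m
      lt : d < m + c * m
      lt = ≤-trans (s≤s (≤-reflexive (m≡m%n+[m/n]*n d m))) (+-monoˡ-≤ (c * m) (m%n<n d m))
      c≥1 : 1 ≤ c
      c≥1 with c in eq
      ... | suc _ = s≤s z≤n
      ... | zero  = ⊥-elim (<-irrefl refl (≤-trans lt (≤-trans (≤-reflexive (trans (cong (λ z → m + z * m) eq) (+-identityʳ m))) h)))
      upper : d ≤ 2 * (c * m)
      upper = ≤-trans (<⇒≤ lt) (≤-trans (+-monoˡ-≤ (c * m) (≤-trans (≤-reflexive (sym (+-identityʳ m))) (*-monoˡ-≤ m c≥1)))
                (≤-reflexive (cong (c * m +_) (sym (+-identityʳ (c * m))))))

    q≤d : q ≤ d
    q≤d = ≤-trans (≤-trans (≤-reflexive (sym (*-identityʳ q))) (*-monoʳ-≤ q (≤-trans (s≤s z≤n) (m≤n+m 12 (9 * q))))) d≥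

    h16 : 2 * (8 * b) ≤ d
    h16 = ≤-trans (≤-reflexive (l b)) (proj₁ (division 16 16≤d))
      where
      l : ∀ b → 2 * (8 * b) ≡ b * 16
      l = solve-∀

    d≤ : d ≤ 32 * b
    d≤ = ≤-trans (proj₂ (division 16 16≤d)) (≤-reflexive (l b))
      where
      l : ∀ b → 2 * (b * 16) ≡ 32 * b
      l = solve-∀

    ρ≥ : 9 * q + 12 ≤ ρ
    ρ≥ = ≮⇒≥ (λ h → <-irrefl refl (begin-strict
      d                      ≡⟨ m≡m%n+[m/n]*n d q ⟩
      d % q + ρ * q          <⟨ +-monoˡ-< (ρ * q) (m%n<n d q) ⟩
      suc ρ * q              ≤⟨ *-monoˡ-≤ q h ⟩
      (9 * q + 12) * q       ≡⟨ *-comm (9 * q + 12) q ⟩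
      d₀                     ≤⟨ d≥ ⟩
      d ∎))
      where open ≤-Reasoning

    tails : D * D * (16 * τ + 37) ≤ d
    tails = begin
      D * D * (16 * (16 * ρ) + 37)   ≤⟨ *-monoʳ-≤ (D * D) (+-monoʳ-≤ (16 * (16 * ρ)) (≤-trans (≤-reflexive (sym (*-identityʳ 37))) (*-monoʳ-≤ 37 ρ≥1))) ⟩
      -- Needed is 16 · 16 + 37 = 293 times D²; q provides 16 · 53 = 848.
      D * D * (16 * (16 * ρ) + 37 * ρ) ≤⟨ *-monoʳ-≤ (D * D) (≤-trans (≤-reflexive (l₁ ρ)) (*-monoˡ-≤ ρ (≤ᵇ-t⁻ 293 848 refl))) ⟩
      D * D * (848 * ρ)              ≡⟨ trans (l₂ ρ (D * D)) (cong (ρ *_) (sym hq)) ⟩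
      ρ * q                          ≤⟨ proj₁ (division q q≤d) ⟩
      d ∎
      where
      open ≤-Reasoning
      ρ≥1 : 1 ≤ ρ
      ρ≥1 = ≤-trans (≤-trans (s≤s z≤n) (m≤n+m 12 (9 * q))) ρ≥
      l₁ : ∀ ρ → 16 * (16 * ρ) + 37 * ρ ≡ 293 * ρ
      l₁ = solve-∀
      l₂ : ∀ ρ x → x * (848 * ρ) ≡ ρ * (16 * (53 * x))
      l₂ = solve-∀

    -- `8 * d + 8` and `δ d` leave room for switchings. The summands with k push 2k times each of
    -- the two exceptional classes below the number of regular graphs.
    N₀ : ℕ
    N₀ = 8 * d + 8 + δ d + 2 * k * (4 * C) + k

    module _ (n : ℕ) (n≥ : N₀ ≤ n) where

      n≥₁ : 8 * d + 8 ≤ n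
      n≥₁ = ≤-trans (≤-trans (m≤m+n _ (δ d)) (≤-trans (m≤m+n _ (2 * k * (4 * C))) (m≤m+n _ k))) n≥

      δ≤ : δ d ≤ n
      δ≤ = ≤-trans (≤-trans (m≤n+m (δ d) (8 * d + 8)) (≤-trans (m≤m+n _ (2 * k * (4 * C))) (m≤m+n _ k))) n≥

      k₁ : 2 * k * (4 * C) ≤ n
      k₁ = ≤-trans (≤-trans (m≤n+m (2 * k * (4 * C)) (8 * d + 8 + δ d)) (m≤m+n _ k)) n≥

      k₂ : k ≤ n
      k₂ = ≤-trans (m≤n+m k _) n≥

      n≥2 : 2 ≤ n
      n≥2 = ≤-trans (≤-trans (s≤s (s≤s z≤n)) (m≤n+m 8 (8 * d))) n≥₁

      n≥1 : 1 ≤ n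
      n≥1 = ≤-trans (s≤s z≤n) n≥2

      r : ℕ
      r = ρ * n

      wts : n * d ≤ 2 * (r * q)
      wts = ≤-trans (*-monoʳ-≤ n (proj₂ (division q q≤d))) (≤-reflexive (l n ρ q))
        where
        l : ∀ n ρ q → n * (2 * (ρ * q)) ≡ 2 * (ρ * n * q)
        l = solve-∀

      open Boosters n d D τ q r n≥1 d≥1 D≥1 q≥1 δ≤ tails wts
      open Expansion n d b h16 d≥1 d≤ C hC n≥₁ using (allBad; allBad-bound; isBad; Π)

      Ex : ℕ
      Ex = (1 + n) + 9 * q * n + 2 * r

      M≤ : length (Js n) * Kmax ≤ 2 ^ Ex
      M≤ = begin
        length (Js n) * (q ^ (9 * n) * 4 ^ r)
          ≤⟨ *-mono-≤ (length-Js n) (*-monoˡ-≤ (4 ^ r) (^-monoˡ-≤ (9 * n) (s≤2^s q))) ⟩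
        2 ^ (1 + n) * ((2 ^ q) ^ (9 * n) * (2 ^ 2) ^ r)
          ≡⟨ cong (2 ^ (1 + n) *_) (cong₂ _*_ (trans (^-*-assoc 2 q (9 * n)) (cong (2 ^_) (l q n))) (^-*-assoc 2 2 r)) ⟩
        2 ^ (1 + n) * (2 ^ (9 * q * n) * 2 ^ (2 * r))
          ≡⟨ trans (sym (*-assoc (2 ^ (1 + n)) _ _)) (trans (cong (_* 2 ^ (2 * r)) (sym (^-distribˡ-+-* 2 (1 + n) (9 * q * n)))) (sym (^-distribˡ-+-* 2 (1 + n + 9 * q * n) (2 * r)))) ⟩
        2 ^ Ex ∎
        where
        open ≤-Reasoning
        l : ∀ q n → q * (9 * n) ≡ 9 * q * n
        l = solve-∀

      -- 9q comes from q^(9n) ≤ 2^(9qn), and 12 from the terms of order n: the indices j, the edges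
      -- of the pairs and the additive constants. d ≥ d₀ was chosen to give ρ ≥ 9q + 12.
      exponent : 2 + 8 * n + (1 + n) + 9 * q * n + 2 * r ≤ 3 * r
      exponent = begin
        2 + 8 * n + (1 + n) + 9 * q * n + 2 * r   ≡⟨ l₁ n (9 * q) r ⟩
        3 + 9 * n + 9 * q * n + 2 * r             ≤⟨ +-monoˡ-≤ (2 * r) (+-monoˡ-≤ (9 * q * n) (+-monoˡ-≤ (9 * n) (*-monoʳ-≤ 3 n≥1))) ⟩
        3 * n + 9 * n + 9 * q * n + 2 * r         ≡⟨ l₂ n (9 * q) r ⟩
        (9 * q + 12) * n + 2 * r                  ≤⟨ +-monoˡ-≤ (2 * r) (*-monoˡ-≤ n ρ≥) ⟩
        r + 2 * r ∎
        where
        open ≤-Reasoning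
        l₁ : ∀ n x r → 2 + 8 * n + (1 + n) + x * n + 2 * r ≡ 3 + 9 * n + x * n + 2 * r
        l₁ = solve-∀
        l₂ : ∀ n x r → 3 * n + 9 * n + x * n + 2 * r ≡ (x + 12) * n + 2 * r
        l₂ = solve-∀

      t≡ : t ≡ 16 * r
      t≡ = *-assoc 16 ρ n

      few-indices : ∀ g → isRegular d g ≡ true → 2 * length (indices D g) * 2 ^ (8 * n) < 2 ^ (2 * t)
      few-indices g reg = begin-strict
        2 * length (indices D g) * 2 ^ (8 * n)
          ≤⟨ *-monoˡ-≤ (2 ^ (8 * n)) (*-monoʳ-≤ 2 (≤-trans (indices-bound g reg) M≤)) ⟩
        2 ^ (1 + Ex) * 2 ^ (8 * n)
          ≡⟨ sym (^-distribˡ-+-* 2 (1 + Ex) (8 * n)) ⟩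
        2 ^ (1 + Ex + 8 * n)
          <⟨ ^-monoʳ-< 2 (s≤s (s≤s z≤n)) (begin-strict
               1 + Ex + 8 * n                              <⟨ n<1+n _ ⟩
               2 + Ex + 8 * n                              ≡⟨ l n (9 * q * n) (2 * r) ⟩
               2 + 8 * n + (1 + n) + 9 * q * n + 2 * r     ≤⟨ exponent ⟩
               3 * r                                       ≤⟨ *-monoˡ-≤ r (≤ᵇ-t⁻ 3 32 refl) ⟩
               32 * r                                      ≡⟨ trans (l′ r) (cong (2 *_) (sym t≡)) ⟩
               2 * t ∎) ⟩
        2 ^ (2 * t) ∎
        where
        open ≤-Reasoning
        l : ∀ n x y → 2 + ((1 + n) + x + y) + 8 * n ≡ 2 + 8 * n + (1 + n) + x + y
        l = solve-∀
        l′ : ∀ r → 32 * r ≡ 2 * (16 * r)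
        l′ = solve-∀

      poor-rare : 2 * k * # (λ g → isRegular d g ∧ poor g) ≤ N
      poor-rare = *-cancelˡ-≤ (2 ^ t) {{m^n≢0 2 t}} (begin
        2 ^ t * (2 * k * P)              ≡⟨ x∙yz≈y∙xz (2 ^ t) (2 * k) P ⟩
        2 * k * (2 ^ t * P)              ≤⟨ *-mono-≤ (*-monoʳ-≤ 2 (≤-trans k₂ (s≤2^s n))) (≤-trans poor-bound (*-monoˡ-≤ N M≤)) ⟩
        2 ^ (1 + n) * (2 ^ Ex * N)       ≡⟨ trans (sym (*-assoc (2 ^ (1 + n)) (2 ^ Ex) N)) (cong (_* N) (sym (^-distribˡ-+-* 2 (1 + n) Ex))) ⟩
        2 ^ (1 + n + Ex) * N             ≤⟨ *-monoˡ-≤ N (^-monoʳ-≤ 2 (begin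
            1 + n + Ex                               ≤⟨ +-monoˡ-≤ Ex (+-mono-≤ (≤ᵇ-t⁻ 1 2 refl) (m≤m+n n (7 * n))) ⟩
            2 + 8 * n + Ex                           ≡⟨ l₂ n (9 * q * n) (2 * r) ⟩
            2 + 8 * n + (1 + n) + 9 * q * n + 2 * r  ≤⟨ exponent ⟩
            3 * r                                    ≤⟨ *-monoˡ-≤ r (≤ᵇ-t⁻ 3 16 refl) ⟩
            16 * r                                   ≡⟨ sym t≡ ⟩
            t ∎)) ⟩
        2 ^ t * N ∎)
        where
        open ≤-Reasoning
        P = # (λ g → isRegular d g ∧ poor g)
        l₂ : ∀ n x y → 2 + 8 * n + ((1 + n) + x + y) ≡ 2 + 8 * n + (1 + n) + x + y
        l₂ = solve-∀

      allBad-rare : 2 * k * # (λ g → isRegular d g ∧ allBad g) ≤ N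
      allBad-rare = *-cancelʳ-≤ _ _ (4 * C) {{>-nonZero D≥1}} (begin
        2 * k * P * (4 * C)    ≡⟨ xy∙z≈y∙xz (2 * k) P (4 * C) ⟩
        P * (2 * k * (4 * C))  ≤⟨ *-monoʳ-≤ P k₁ ⟩
        P * n                  ≤⟨ allBad-bound ⟩
        4 * C * N              ≡⟨ *-comm (4 * C) N ⟩
        N * (4 * C) ∎)
        where
        open ≤-Reasoning
        P = # (λ g → isRegular d g ∧ allBad g)

      typical : Graph n → Bool
      typical g = isRegular d g ∧ (not (allBad g) ∧ not (poor g))

      typical-wins : ∀ g → typical g ≡ true → MakerWinsHam g
      typical-wins g h = from (allB-f⁻ (isBad g) Π (not-t⁻ (proj₁ h₂)))
        where
        h₁ = ∧-t⁻ {isRegular d g} h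
        h₂ = ∧-t⁻ {not (allBad g)} (proj₂ h₁)
        boosters : ∀ {i} → i ∈ indices D g → 4 * t < βof g i
        boosters {i} m = ≰⇒> (λ p → t≢f (anyB-t⁺ (λ i → βof g i ≤ᵇ 4 * t) m (≤ᵇ-t⁺ p)) (not-t⁻ (proj₂ h₂)))
        from : ∃[ π ] (π ∈ Π × isBad g π ≡ false) → MakerWinsHam g
        from (π , _ , good) = Strategy.maker-wins-g n d b h16 d≥1 d≤ C hC n≥₁ g (proj₁ h₁) π good t boosters (few-indices g (proj₁ h₁))

      winners : List (Graph n)
      winners = boolFilter typical (allGraphs n)

      N≡ : numRegular n d ≡ N
      N≡ = length-boolFilter (isRegular d) (allGraphs n)

      missing : k * (numRegular n d ∸ length winners) ≤ numRegular n d
      missing = subst (λ z → k * (z ∸ length winners) ≤ z) (sym N≡) (*-cancelˡ-≤ 2 (begin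
        2 * (k * (N ∸ length winners))   ≤⟨ *-monoʳ-≤ 2 (*-monoʳ-≤ k (m≤n+o⇒m∸n≤o N (length winners) split)) ⟩
        2 * (k * (P₁ + P₂))              ≡⟨ l k P₁ P₂ ⟩
        2 * k * P₁ + 2 * k * P₂          ≤⟨ +-mono-≤ allBad-rare poor-rare ⟩
        N + N                            ≡⟨ cong (N +_) (sym (+-identityʳ N)) ⟩
        2 * N ∎))
        where
        open ≤-Reasoning
        P₁ = # (λ g → isRegular d g ∧ allBad g)
        P₂ = # (λ g → isRegular d g ∧ poor g)
        l : ∀ k a b → 2 * (k * (a + b)) ≡ 2 * k * a + 2 * k * b
        l = solve-∀
        bl : ∀ r a p → 𝟙 r ≤ 𝟙 (r ∧ (not a ∧ not p)) + (𝟙 (r ∧ a) + 𝟙 (r ∧ p))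
        bl false a     p     = z≤n
        bl true  true  p     = s≤s z≤n
        bl true  false true  = s≤s z≤n
        bl true  false false = s≤s z≤n
        split : N ≤ length winners + (P₁ + P₂)
        split = ≤-trans (∑-mono (allGraphs n) (λ g → bl (isRegular d g) (allBad g) (poor g)))
          (≤-reflexive (trans (∑-+ (allGraphs n) (λ g → 𝟙 (typical g)) _)
            (cong₂ _+_ (sym (length-boolFilter typical (allGraphs n))) (∑-+ (allGraphs n) _ _))))

      conclusion : ∃[ L ] (Unique {A = Graph n} L × All (λ g → T (isRegular d g)) L × All MakerWinsHam L
                     × k * (numRegular n d ∸ length L) ≤ numRegular n d)
      conclusion = winners , boolFilter-Unique typical (allGraphs n) (allGraphs-Unique n) ,
        All.tabulate (λ {g} m → t⇒T (proj₁ (∧-t⁻ {isRegular d g} (proj₂ (∈-boolFilter⁻ typical (allGraphs n) m))))) ,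
        All.tabulate (λ {g} m → typical-wins g (proj₂ (∈-boolFilter⁻ typical (allGraphs n) m))) ,
        missing

-- 2^(3s) subsets S of U, (4n/3s)^(3s) sets U and (64·3s/n)^(4s) for the slots multiply to (C₀ s/n)^s.
abstract
  C₀ : ℕ
  C₀ = 2 * 2 * 2 * (4 * 4 * 4) * (64 * 64 * 64 * 64) * 3

  C₀≡ : C₀ ≡ 2 * 2 * 2 * (4 * 4 * 4) * (64 * 64 * 64 * 64) * 3
  C₀≡ = refl

  q₀ : ℕ
  q₀ = 16 * (53 * (4 * C₀ * (4 * C₀)))

  q₀≡ : q₀ ≡ 16 * (53 * (4 * C₀ * (4 * C₀)))
  q₀≡ = refl

theorem6 : ∃[ d₀ ] (0 < d₀ × (∀ d → d₀ ≤ d → ∀ k → ∃[ N ] (∀ n → N ≤ n → 2 ∣ d * n →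
    ∃[ L ] (Unique {A = Graph n} L × All (λ g → T (isRegular d g)) L × All MakerWinsHam L
    × k * (numRegular n d ∸ length L) ≤ numRegular n d))))
theorem6 = d₀ , d₀>0 , λ d d≥ k → N₀ d d≥ k , λ n n≥ _ → conclusion d d≥ k n n≥
  where open Parameters C₀ C₀≡ q₀ q₀≡
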